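{- Let $d\ge2$ be a square-free integer and let $T$ be a regular interval exchange transformation on $[\ell,r[$ such that $\ell$, all separation points $\gamma_i$ and all translation values $\alpha_{a}$ lie in $\mathbb{Z}[\sqrt d]$. Then $\Pi(J)=\Theta(1)$ for every semi-interval $J$ admissible for $T$; that is, there are constants $0<C_1\le C_2$ depending only on $T$ such that $C_1\le \Pi(J)\le C_2$ for every semi-interval $J\subseteq[\ell,r[$ admissible for $T$.
   Context: A semi-interval is a set $[x,y[=\{z\in\mathbb{R}: x\le z<y\}$ with $x<y$. Let $A=\{a_1<\dots<a_s\}$, $\lambda=(\lambda_1,\dots,\lambda_s)$ positive reals with $\sum\lambda_i=r-\ell$, $\pi$ a permutation of $A$. Put $\gamma_{a_i}=\ell+\sum_{j<i}\lambda_j$, $\delta_{a_i}=\ell+\sum_{j:\pi(a_j)<\pi(a_i)}\lambda_j$, $I_{a_i}=[\gamma_{a_i},\gamma_{a_i}+\lambda_i[$, translation values $\alpha_a=\delta_a-\gamma_a$. The interval exchange transformation $T:[\ell,r[\to[\ell,r[$ is $T(z)=z+\alpha_a$ for $z\in I_a$. Separation points: $\gamma_1=\ell,\dots,\gamma_s$ ($\gamma_i=\gamma_{a_i}$). $T$ is regular if the orbits $\{T^n(\gamma_i):n\in\mathbb{Z}\}$ of $\gamma_2,\dots,\gamma_s$ are infinite and pairwise disjoint. Admissibility: for $I=[u,v[\subseteq[\ell,r[$ and $z\in[\ell,r[$ let $\rho^+_{I,T}(z)=\min\{n>0: T^n(z)\in\,]u,v[\}$, $\rho^-_{I,T}(z)=\min\{n\ge0: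 T^{ -n}(z)\in\,]u,v[\}$, $N_{I,T}(z)=\{T^k(z): -\rho^-_{I,T}(z)\le k<\rho^+_{I,T}(z)\}$, $\mathrm{Div}(I,T)=\bigcup_{i=1}^s N_{I,T}(\gamma_i)$. $I=[u,v[$ ($\ell\le u<v\le r$) is admissible for $T$ if $u,v\in\mathrm{Div}(I,T)\cup\{r\}$. Complexity: for $z=m+n\sqrt d\in\mathbb{Z}[\sqrt d]$ put $\Psi(z)=\max(|m|,|n|)$. For a semi-interval $J=[t,w[$ with $t,w\in\mathbb{Z}[\sqrt d]$ put $\Psi(J)=\max\{\Psi(t),\Psi(w)\}$ (the maximum of $\Psi$ over the boundary of $J$) and the reduced complexity $\Pi(J)=|J|\,\Psi(J)$, where $|J|$ is the length of $J$. (Endpoints of admissible semi-intervals lie in $\mathbb{Z}[\sqrt d]$ under the hypotheses.) -}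

module Defs where

open import Data.Nat as ℕ using (ℕ; zero; suc)
open import Data.Nat.Divisibility using (_∣_)
open import Data.Integer as ℤ using (ℤ; +_; -[1+_])
open import Data.Fin as Fin using (Fin; toℕ)
open import Data.Fin.Permutation using (Permutation′; _⟨$⟩ʳ_)
open import Data.Product using (Σ; _×_; ∃; ∃-syntax)
open import Data.Sum using (_⊎_)
open import Data.List using (List)
open import Data.List.Membership.Propositional using (_∈_)
open import Relation.Nullary using (¬_; does)
open import Relation.Binary.PropositionalEquality using (_≡_; _≢_)
open import Data.Bool using (if_then_else_)

SquareFree : ℕ → Set
SquareFree d = ∀ (p : ℕ) → (p ℕ.* p) ∣ d → p ≡ 1

-- The ring ℤ[√d]: m + n√d is represented by the pair (m , n).
-- For square-free d ≥ 2, √d is irrational, so this representation is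
-- unique and propositional equality of pairs is equality of reals.

infix 5 _+√_
record Zd : Set where
  constructor _+√_
  field
    re : ℤ
    im : ℤ
open Zd public

0z : Zd
0z = + 0 +√ + 0

infixl 6 _⊕_ _⊖_
_⊕_ : Zd → Zd → Zd
(a +√ b) ⊕ (c +√ e) = (a ℤ.+ c) +√ (b ℤ.+ e)

⊝_ : Zd → Zd
⊝ (a +√ b) = (ℤ.- a) +√ (ℤ.- b)

_⊖_ : Zd → Zd → Zd
x ⊖ y = x ⊕ (⊝ y)

infixr 7 _·_
_·_ : ℕ → Zd → Zd
k · (a +√ b) = (+ k ℤ.* a) +√ (+ k ℤ.* b)

nat : ℕ → Zd
nat k = + k +√ + 0

-- Positivity of m + n√d as a real number (√d the positive root).
Pos : ℕ → Zd → Set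
Pos d (a +√ b) =
    (+ 0 ℤ.≤ a × + 0 ℤ.≤ b × (+ 0 ℤ.< a ⊎ + 0 ℤ.< b))
  ⊎ (+ 0 ℤ.< a × b ℤ.< + 0 × (+ d ℤ.* b ℤ.* b) ℤ.< a ℤ.* a)
  ⊎ (a ℤ.< + 0 × + 0 ℤ.< b × a ℤ.* a ℤ.< (+ d ℤ.* b ℤ.* b))

_⟨_⟩<_ : Zd → ℕ → Zd → Set
x ⟨ d ⟩< y = Pos d (y ⊖ x)

_⟨_⟩≤_ : Zd → ℕ → Zd → Set
x ⟨ d ⟩≤ y = x ⟨ d ⟩< y ⊎ x ≡ y

Ψ : Zd → ℕ
Ψ (a +√ b) = ℤ.∣ a ∣ ℕ.⊔ ℤ.∣ b ∣

sumZ : ∀ {n} → (Fin n → Zd) → Zd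
sumZ {zero} f = 0z
sumZ {suc n} f = f Fin.zero ⊕ sumZ (λ j → f (Fin.suc j))

-- Interval exchange transformations with data in ℤ[√d].
-- The alphabet A = {a_1 < … < a_s} is identified with Fin s (in its
-- natural order); π is a permutation of A; λ the lengths.

record IET (d s : ℕ) : Set where
  field
    ℓ   : Zd
    len : Fin s → Zd
    len-pos : ∀ i → Pos d (len i)
    π   : Permutation′ s

  r : Zd
  r = ℓ ⊕ sumZ len

  γ : Fin s → Zd
  γ i = ℓ ⊕ sumZ (λ j → if does (j Fin.<? i) then len j else 0z)

  δ : Fin s → Zd
  δ i = ℓ ⊕ sumZ (λ j → if does ((π ⟨$⟩ʳ j) Fin.<? (π ⟨$⟩ʳ i)) then len j else 0z)

  α : Fin s → Zd
  α i = δ i ⊖ γ i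

  -- T z ≡ w  (graph of T): z ∈ I_{a_i} = [γ_i, γ_i + λ_i[ and w = z + α_i
  Step : Zd → Zd → Set
  Step z w = ∃[ i ] (γ i ⟨ d ⟩≤ z × z ⟨ d ⟩< (γ i ⊕ len i) × w ≡ z ⊕ α i)

  data Iter : ℕ → Zd → Zd → Set where
    iter-zero : ∀ {z} → Iter 0 z z
    iter-suc  : ∀ {n z y w} → Iter n z y → Step y w → Iter (suc n) z w

  data IterInv : ℕ → Zd → Zd → Set where
    inv-zero : ∀ {z} → IterInv 0 z z
    inv-suc  : ∀ {n z y w} → IterInv n z y → Step w y → IterInv (suc n) z w

  Orbit : ℤ → Zd → Zd → Set
  Orbit (+ n)    z w = Iter n z w
  Orbit -[1+ n ] z w = IterInv (suc n) z w

  Regular : Set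
  Regular =
      (∀ (i : Fin s) → 1 ℕ.≤ toℕ i →
         ¬ (Σ (List Zd) λ xs → ∀ (n : ℤ) (w : Zd) → Orbit n (γ i) w → w ∈ xs))
    × (∀ (i j : Fin s) → 1 ℕ.≤ toℕ i → 1 ℕ.≤ toℕ j → i ≢ j →
         ∀ (n m : ℤ) (w : Zd) → ¬ (Orbit n (γ i) w × Orbit m (γ j) w))

  InOpen : Zd → Zd → Zd → Set
  InOpen u v z = u ⟨ d ⟩< z × z ⟨ d ⟩< v

  -- w ∈ N_{[u,v[,T}(z) = {T^k z : -ρ⁻(z) ≤ k < ρ⁺(z)}
  -- (with min ∅ = ∞): k ≥ 0 requires no T^n z ∈ ]u,v[ for 0 < n ≤ k;
  -- k = -m < 0 requires no T^{-n} z ∈ ]u,v[ for 0 ≤ n < m.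
  InN : Zd → Zd → Zd → Zd → Set
  InN u v z w =
      (Σ ℕ λ k → Iter k z w ×
         (∀ (n : ℕ) (y : Zd) → 1 ℕ.≤ n → n ℕ.≤ k → Iter n z y → ¬ InOpen u v y))
    ⊎ (Σ ℕ λ m → 1 ℕ.≤ m × IterInv m z w ×
         (∀ (n : ℕ) (y : Zd) → n ℕ.< m → IterInv n z y → ¬ InOpen u v y))

  InDiv : Zd → Zd → Zd → Set
  InDiv u v w = ∃[ i ] InN u v (γ i) w

  Admissible : Zd → Zd → Set
  Admissible u v =
    ℓ ⟨ d ⟩≤ u × u ⟨ d ⟩< v × v ⟨ d ⟩≤ r
    × (InDiv u v u ⊎ u ≡ r) × (InDiv u v v ⊎ v ≡ r)

ΨJ : Zd → Zd → ℕ
ΨJ u v = Ψ u ℕ.⊔ Ψ v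

ΠJ : Zd → Zd → Zd
ΠJ u v = ΨJ u v · (v ⊖ u)

module Submission where

open import Defs
open import Data.Nat using (ℕ; _≤_; _*_)
open import Data.Product using (Σ; _×_)
open import Data.Nat as ℕ using (zero; suc; _+_; _∸_; _<_; _⊔_; z≤n; s≤s; NonZero; ≢-nonZero)
open import Data.Nat.Properties
open import Data.Nat.Divisibility using (_∣_; divides; ∣-refl)
open import Data.Nat.DivMod using (_/_; m/n*n≡m)
open import Data.Nat.GCD using (gcd; gcd[m,n]∣m; gcd[m,n]∣n; gcd[m,n]≢0)
open import Data.Nat.Coprimality using (coprime-/gcd; coprime-divisor)
import Data.Nat.Tactic.RingSolver as ℕR
open import Data.Integer as ℤ using (ℤ; +_; -[1+_])
import Data.Integer.Properties as ℤₚ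
import Data.Integer.Tactic.RingSolver as ℤR
open import Data.Bool using (if_then_else_)
open import Data.Fin as Fin using (Fin; toℕ; fromℕ<; punchIn)
import Data.Fin.Properties as Finₚ
open import Data.Fin.Permutation as Perm using (Permutation′; _⟨$⟩ʳ_; _⟨$⟩ˡ_; inverseʳ; inverseˡ)
open import Data.List using (List; applyUpTo)
open import Data.List.Membership.Propositional using (_∈_)
open import Data.List.Membership.Propositional.Properties using (∈-applyUpTo⁺)
open import Data.Maybe using (just; nothing)
open import Data.Product using (∃; ∃₂; _,_; proj₁; proj₂)
open import Data.Sum using (_⊎_; inj₁; inj₂; [_,_]′)
open import Data.Empty using (⊥; ⊥-elim)
open import Relation.Nullary using (¬_; Dec; yes; no; contradiction; does)
open import Relation.Nullary.Decidable using (_×-dec_; dec-true; dec-false)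
open import Relation.Binary.Definitions using (tri<; tri≈; tri>)
open import Relation.Binary.PropositionalEquality
open import Level using (0ℓ)
open import Algebra.Bundles using (CommutativeRing)
open import Tactic.RingSolver.Core.AlmostCommutativeRing using (AlmostCommutativeRing; fromCommutativeRing)
import Tactic.RingSolver as R

-- Let J be a window of length ε. For z ≠ 0 in ℤ[√d] the norm of z is a nonzero integer, so
-- |z| is at least a constant over Ψ z: this is the lower bound, and it also says that points
-- reached from the γ's within n steps of T are equal or at distance at least a constant over n.
-- For the upper bound, a subtractive Euclidean algorithm on (1 , √d) puts into J a smaller
-- window with endpoints of Ψ at most Q, where Q ε is bounded. A point of that window returns to
-- it within N, a constant multiple of Q: up to the n-th return stage it has a neighbourhood of
-- length at least a constant over Q + n that T translates without cutting, whose images are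
-- disjoint until it returns, so it must be cut before a time linear in Q + n, and every
-- singularity can be responsible for a cut at one of the geometrically growing stages only.
-- By Keane's argument, regularity lets every point enter the window within N: a boundary of the
-- set of entering points would be pushed by T and by its inverse onto singularities, giving a
-- connection. So an endpoint of an admissible J, being reached from some γ before the first
-- visit to J, has Ψ at most a constant times Q.

-- The obstacle is that `Ψ` of the endpoints of J is the unknown, so no estimate may start from it.
-- This is what the window is for: its endpoints have `Ψ` at most Q by construction, and a visit to
-- it is a visit to the interior of J. Recurrence has a rate, but concerns only points of the
-- window; Keane's argument concerns all points, but has no rate of its own. They fit together
-- because the set of points that enter within N steps is already invariant under T and its inverse.
-- So Keane's argument only has to show that this decidable set is everything, and the distance θ
-- used there may depend on N and on the window without affecting any constant. ℤ[√d] is not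
-- complete, so a boundary is represented by two points within θ of each other on which the set
-- differs; the norm bound then turns "closer than θ" into equality. Everything is done for the
-- inverse of T as well, both for Keane's argument and because Div contains backward orbits. With a
-- single letter T is the identity and minimality fails, so that case is separate.

-- The componentwise product plays no mathematical role: it turns Zd into a
-- commutative ring, so that the ring solver proves identities of its additive group.
zd : AlmostCommutativeRing 0ℓ 0ℓ
zd = fromCommutativeRing componentwise λ { (+ 0 +√ + 0) → just refl ; _ → nothing }
  where
  _⊗_ : Zd → Zd → Zd
  (a +√ b) ⊗ (c +√ e) = (a ℤ.* c) +√ (b ℤ.* e)

  componentwise : CommutativeRing 0ℓ 0ℓ
  componentwise = record
    { Carrier = Zd ; _≈_ = _≡_ ; _+_ = _⊕_ ; _*_ = _⊗_ ; -_ = ⊝_ ; 0# = 0z ; 1# = + 1 +√ + 1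
    ; isCommutativeRing = record
      { isRing = record
        { +-isAbelianGroup = record
          { isGroup = record
            { isMonoid = record
              { isSemigroup = record
                { isMagma = record { isEquivalence = isEquivalence ; ∙-cong = cong₂ _⊕_ }
                ; assoc = λ x y z → cong₂ _+√_ (ℤₚ.+-assoc (re x) (re y) (re z))
                    (ℤₚ.+-assoc (im x) (im y) (im z)) }
              ; identity = (λ x → cong₂ _+√_ (ℤₚ.+-identityˡ (re x)) (ℤₚ.+-identityˡ (im x)))
                         , (λ x → cong₂ _+√_ (ℤₚ.+-identityʳ (re x)) (ℤₚ.+-identityʳ (im x))) }
            ; inverse = (λ x → cong₂ _+√_ (ℤₚ.+-inverseˡ (re x)) (ℤₚ.+-inverseˡ (im x)))
                      , (λ x → cong₂ _+√_ (ℤₚ.+-inverseʳ (re x)) (ℤₚ.+-inverseʳ (im x)))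
            ; ⁻¹-cong = cong ⊝_ }
          ; comm = λ x y → cong₂ _+√_ (ℤₚ.+-comm (re x) (re y)) (ℤₚ.+-comm (im x) (im y)) }
        ; *-cong = cong₂ _⊗_
        ; *-assoc = λ x y z → cong₂ _+√_ (ℤₚ.*-assoc (re x) (re y) (re z)) (ℤₚ.*-assoc (im x) (im y) (im z))
        ; *-identity = (λ x → cong₂ _+√_ (ℤₚ.*-identityˡ (re x)) (ℤₚ.*-identityˡ (im x)))
                     , (λ x → cong₂ _+√_ (ℤₚ.*-identityʳ (re x)) (ℤₚ.*-identityʳ (im x)))
        ; distrib = (λ x y z → cong₂ _+√_ (ℤₚ.*-distribˡ-+ (re x) (re y) (re z))
            (ℤₚ.*-distribˡ-+ (im x) (im y) (im z)))
                  , (λ x y z → cong₂ _+√_ (ℤₚ.*-distribʳ-+ (re x) (re y) (re z))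
                      (ℤₚ.*-distribʳ-+ (im x) (im y) (im z))) }
      ; *-comm = λ x y → cong₂ _+√_ (ℤₚ.*-comm (re x) (re y)) (ℤₚ.*-comm (im x) (im y)) } }

-- Irrationality of √d, and signs of `m + n√d` by comparing squares

sq-< : ∀ {m n} → m < n → m * m < n * n
sq-< m<n = *-mono-< m<n m<n

sq-cancel-≤ : ∀ {m n} → m * m ≤ n * n → m ≤ n
sq-cancel-≤ {m} {n} h with ≤-<-connex m n
... | inj₁ m≤n = m≤n
... | inj₂ n<m = contradiction h (<⇒≱ (sq-< n<m))

-- After division by the gcd, `b′` divides `a′ * a′` and is coprime to `a′`, hence `b′ ≡ 1`; then
-- `d` is the square of `a′`, and square-freeness forces `d ≡ 1`.
squarefree⇒irrational : ∀ {d} → 2 ≤ d → SquareFree d → ∀ a b → a * a ≡ d * (b * b) → b ≡ 0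
squarefree⇒irrational {d} 2≤d sf a zero _ = refl
squarefree⇒irrational {d} 2≤d sf a b@(suc _) eq = contradiction (subst (2 ≤_) d≡1 2≤d) λ { (s≤s ()) }
  where
  g = gcd a b
  instance
    g≢0 : NonZero g
    g≢0 = ≢-nonZero (gcd[m,n]≢0 a b (inj₂ λ ()))
    gg≢0 : NonZero (g * g)
    gg≢0 = m*n≢0 g g
  a′ = a / g
  b′ = b / g
  a≡ : a′ * g ≡ a
  a≡ = m/n*n≡m (gcd[m,n]∣m a b)
  b≡ : b′ * g ≡ b
  b≡ = m/n*n≡m (gcd[m,n]∣n a b)
  l₁ : ∀ x y → x * x * (y * y) ≡ x * y * (x * y)
  l₁ = ℕR.solve-∀
  l₂ : ∀ e x y → e * (x * y * (x * y)) ≡ e * (x * x) * (y * y)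
  l₂ = ℕR.solve-∀
  eq′ : a′ * a′ ≡ d * (b′ * b′)
  eq′ = *-cancelʳ-≡ _ _ (g * g) (begin
    a′ * a′ * (g * g)          ≡⟨ l₁ a′ g ⟩
    a′ * g * (a′ * g)          ≡⟨ cong₂ _*_ a≡ a≡ ⟩
    a * a                      ≡⟨ eq ⟩
    d * (b * b)                ≡⟨ cong (λ t → d * (t * t)) b≡ ⟨
    d * (b′ * g * (b′ * g))    ≡⟨ l₂ d b′ g ⟩
    d * (b′ * b′) * (g * g)    ∎)
    where open ≡-Reasoning
  cop = coprime-/gcd a b
  b′∣a′ : b′ ∣ a′
  b′∣a′ = coprime-divisor (λ (p , q) → cop (q , p)) (divides (d * b′) (trans eq′ (sym (*-assoc d b′ b′))))
  b′≡1 : b′ ≡ 1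
  b′≡1 = cop (b′∣a′ , ∣-refl)
  d≡ : d ≡ a′ * a′
  d≡ = sym (trans eq′ (trans (cong (λ t → d * (t * t)) b′≡1) (*-identityʳ d)))
  a′≡1 : a′ ≡ 1
  a′≡1 = sf a′ (divides 1 (trans d≡ (sym (*-identityˡ _))))
  d≡1 : d ≡ 1
  d≡1 = trans d≡ (cong (λ t → t * t) a′≡1)

module _ (d : ℕ) where
  private
    expand : ∀ u w → u * u + 2 * (u * w) + w * w ≡ (u + w) * (u + w)
    expand = ℕR.solve-∀
    expand-d : ∀ e v z → e * (v * v) + 2 * (e * (v * z)) + e * (z * z) ≡ e * ((v + z) * (v + z))
    expand-d = ℕR.solve-∀
    prod : ∀ u w → u * u * (w * w) ≡ u * w * (u * w)
    prod = ℕR.solve-∀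
    prod-d : ∀ e v z → e * (v * v) * (e * (z * z)) ≡ e * (v * z) * (e * (v * z))
    prod-d = ℕR.solve-∀

  -- With √d available this adds `u ≤ v√d` and `w < z√d`. Without it, the cross terms of the two
  -- squared sums are compared through their own squares, which are the products of the hypotheses.
  below-+ : ∀ u w v z → u * u ≤ d * (v * v) → w * w < d * (z * z) → (u + w) * (u + w) < d *
      ((v + z) * (v + z))
  below-+ u w v z h k = begin-strict
    (u + w) * (u + w)                                ≡⟨ expand u w ⟨
    u * u + 2 * (u * w) + w * w                      <⟨ +-mono-≤-< (+-mono-≤ h (*-monoʳ-≤ 2 cross)) k ⟩
    d * (v * v) + 2 * (d * (v * z)) + d * (z * z)    ≡⟨ expand-d d v z ⟩
    d * ((v + z) * (v + z))                          ∎
    where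
    open ≤-Reasoning
    cross : u * w ≤ d * (v * z)
    cross = sq-cancel-≤ (begin
      u * w * (u * w)                    ≡⟨ prod u w ⟨
      u * u * (w * w)                    ≤⟨ *-mono-≤ h (<⇒≤ k) ⟩
      d * (v * v) * (d * (z * z))        ≡⟨ prod-d d v z ⟩
      d * (v * z) * (d * (v * z))        ∎)

  above-+ : ∀ u w v z → d * (v * v) ≤ u * u → d * (z * z) < w * w → d * ((v + z) * (v + z)) < (u + w) *
      (u + w)
  above-+ u w v z h k = begin-strict
    d * ((v + z) * (v + z))                          ≡⟨ expand-d d v z ⟨
    d * (v * v) + 2 * (d * (v * z)) + d * (z * z)    <⟨ +-mono-≤-< (+-mono-≤ h (*-monoʳ-≤ 2 cross)) k ⟩
    u * u + 2 * (u * w) + w * w                      ≡⟨ expand u w ⟩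
    (u + w) * (u + w)                                ∎
    where
    open ≤-Reasoning
    cross : d * (v * z) ≤ u * w
    cross = sq-cancel-≤ (begin
      d * (v * z) * (d * (v * z))        ≡⟨ prod-d d v z ⟨
      d * (v * v) * (d * (z * z))        ≤⟨ *-mono-≤ h (<⇒≤ k) ⟩
      u * u * (w * w)                    ≡⟨ prod u w ⟩
      u * w * (u * w)                    ∎)

-- Pos with the signs of both coordinates made explicit, so that only naturals are squared.
data Pos′ (d : ℕ) (z : Zd) : Set where
  pp : ∀ a b → z ≡ (+ a +√ + b) → 0 < a + b → Pos′ d z
  pn : ∀ a b → z ≡ (+ a +√ (ℤ.- + b)) → d * (b * b) < a * a → Pos′ d z
  np : ∀ a b → z ≡ ((ℤ.- + a) +√ + b) → a * a < d * (b * b) → Pos′ d z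

sq-∣∣ : ∀ x → x ℤ.* x ≡ + (ℤ.∣ x ∣ * ℤ.∣ x ∣)
sq-∣∣ (+ n) = sym (ℤₚ.pos-* n n)
sq-∣∣ -[1+ n ] = refl

d-sq-∣∣ : ∀ d x → + d ℤ.* x ℤ.* x ≡ + (d * (ℤ.∣ x ∣ * ℤ.∣ x ∣))
d-sq-∣∣ d x = trans (ℤₚ.*-assoc (+ d) x x) (trans (cong (+ d ℤ.*_) (sq-∣∣ x)) (sym (ℤₚ.pos-* d _)))

Pos⇒Pos′ : ∀ {d} z → Pos d z → Pos′ d z
Pos⇒Pos′ (+ a +√ + b) (inj₁ (_ , _ , inj₁ (ℤ.+<+ h))) = pp a b refl (≤-trans h (m≤m+n a b))
Pos⇒Pos′ (+ a +√ + b) (inj₁ (_ , _ , inj₂ (ℤ.+<+ h))) = pp a b refl (≤-trans h (m≤n+m b a))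
Pos⇒Pos′ {d} (+ a +√ -[1+ b ]) (inj₂ (inj₁ (_ , _ , h))) =
  pn a (suc b) refl (ℤₚ.drop‿+<+ (subst₂ ℤ._<_ (d-sq-∣∣ d -[1+ b ]) (sq-∣∣ (+ a)) h))
Pos⇒Pos′ {d} (-[1+ a ] +√ + b) (inj₂ (inj₂ (_ , _ , h))) =
  np (suc a) b refl (ℤₚ.drop‿+<+ (subst₂ ℤ._<_ (sq-∣∣ -[1+ a ]) (d-sq-∣∣ d (+ b)) h))
Pos⇒Pos′ (+ _ +√ -[1+ _ ]) (inj₁ (_ , () , _))
Pos⇒Pos′ (+ _ +√ -[1+ _ ]) (inj₂ (inj₂ (ℤ.+<+ () , _)))
Pos⇒Pos′ (+ _ +√ + _) (inj₂ (inj₁ (_ , ℤ.+<+ () , _)))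
Pos⇒Pos′ (+ _ +√ + _) (inj₂ (inj₂ (ℤ.+<+ () , _)))
Pos⇒Pos′ (-[1+ _ ] +√ _) (inj₁ (() , _))
Pos⇒Pos′ (-[1+ _ ] +√ _) (inj₂ (inj₁ (() , _)))
Pos⇒Pos′ (-[1+ _ ] +√ -[1+ _ ]) (inj₂ (inj₂ (_ , () , _)))

0<m*m⇒0<m : ∀ m → 0 < m * m → 0 < m
0<m*m⇒0<m (suc m) _ = s≤s z≤n

Pos′⇒Pos : ∀ {d z} → Pos′ d z → Pos d z
Pos′⇒Pos (pp (suc a) b refl _) = inj₁ (ℤ.+≤+ z≤n , ℤ.+≤+ z≤n , inj₁ (ℤ.+<+ (s≤s z≤n)))
Pos′⇒Pos (pp zero (suc b) refl _) = inj₁ (ℤ.+≤+ z≤n , ℤ.+≤+ z≤n , inj₂ (ℤ.+<+ (s≤s z≤n)))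
Pos′⇒Pos (pn (suc a) zero refl _) = inj₁ (ℤ.+≤+ z≤n , ℤ.+≤+ z≤n , inj₁ (ℤ.+<+ (s≤s z≤n)))
Pos′⇒Pos {d} (pn (suc a) (suc b) refl h) = inj₂ (inj₁ (ℤ.+<+ (s≤s z≤n) , ℤ.-<+ ,
  subst₂ ℤ._<_ (sym (d-sq-∣∣ d -[1+ b ])) (sym (sq-∣∣ (+ suc a))) (ℤ.+<+ h)))
Pos′⇒Pos {d} (np a zero refl h) = contradiction (subst (a * a <_) (*-zeroʳ d) h) λ ()
Pos′⇒Pos (np zero (suc b) refl _) = inj₁ (ℤ.+≤+ z≤n , ℤ.+≤+ z≤n , inj₂ (ℤ.+<+ (s≤s z≤n)))
Pos′⇒Pos {d} (np (suc a) (suc b) refl h) = inj₂ (inj₂ (ℤ.-<+ , ℤ.+<+ (s≤s z≤n) ,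
  subst₂ ℤ._<_ (sym (sq-∣∣ -[1+ a ])) (sym (d-sq-∣∣ d (+ suc b))) (ℤ.+<+ h)))

data Difference (a b : ℕ) : Set where
  surplus : ∀ k → a ≡ b + k → + a ℤ.+ ℤ.- + b ≡ + k → Difference a b
  deficit : ∀ k → b ≡ a + k → + a ℤ.+ ℤ.- + b ≡ ℤ.- + k → Difference a b

private
  cancel⁺ : ∀ x y → x ℤ.+ y ℤ.+ ℤ.- x ≡ y
  cancel⁺ = ℤR.solve-∀
  cancel⁻ : ∀ x y → x ℤ.+ ℤ.- (x ℤ.+ y) ≡ ℤ.- y
  cancel⁻ = ℤR.solve-∀

difference : ∀ a b → Difference a b
difference a b with ≤-total b a
... | inj₁ b≤a with k , refl ← m≤n⇒∃[o]m+o≡n b≤a = surplus k refl (cancel⁺ (+ b) (+ k))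
... | inj₂ a≤b with k , refl ← m≤n⇒∃[o]m+o≡n a≤b = deficit k refl (cancel⁻ (+ a) (+ k))

⊕-comm : ∀ x y → x ⊕ y ≡ y ⊕ x
⊕-comm = R.solve-∀ zd

module _ {d : ℕ} where

  private
    ≤-sq : ∀ a b → a ≤ b → a * a ≤ b * b
    ≤-sq a b h = *-mono-≤ h h
    ≤-dsq : ∀ a b → a ≤ b → d * (a * a) ≤ d * (b * b)
    ≤-dsq a b h = *-monoʳ-≤ d (≤-sq a b h)

  pp+pn : ∀ a b c e → 0 < a + b → d * (e * e) < c * c → Pos′ d ((+ a +√ + b) ⊕ (+ c +√ (ℤ.- + e)))
  pp+pn a b c e _ k with difference b e
  ... | surplus l _ eq = pp (a + c) l (cong₂ _+√_ refl eq)
          (≤-trans (0<m*m⇒0<m c (≤-<-trans z≤n k)) (≤-trans (m≤n+m c a) (m≤m+n (a + c) l)))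
  ... | deficit l refl eq = pn (a + c) l (cong₂ _+√_ refl eq)
          (≤-<-trans (≤-dsq l (b + l) (m≤n+m l b)) (<-≤-trans k (≤-sq c (a + c) (m≤n+m c a))))

  pp+np : ∀ a b c e → 0 < a + b → c * c < d * (e * e) → Pos′ d ((+ a +√ + b) ⊕ ((ℤ.- + c) +√ + e))
  pp+np a b c e _ k with difference a c
  ... | surplus l _ eq = pp l (b + e) (cong₂ _+√_ eq refl)
          (≤-trans (0<e e k) (≤-trans (m≤n+m e b) (m≤n+m (b + e) l)))
    where
    0<e : ∀ e → c * c < d * (e * e) → 0 < e
    0<e zero k = contradiction (subst (c * c <_) (*-zeroʳ d) k) λ ()
    0<e (suc e) _ = s≤s z≤n
  ... | deficit l refl eq = np l (b + e) (cong₂ _+√_ eq refl)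
          (≤-<-trans (≤-sq l (a + l) (m≤n+m l a)) (<-≤-trans k (≤-dsq e (b + e) (m≤n+m e b))))

  -- The cases with remainders of opposite signs are decided by a comparison of squares: if the sum
  -- were not positive, adding the reversed inequality to the positivity of one summand would
  -- contradict that of the other.
  pn+np : ∀ a b c e → d * (b * b) < a * a → c * c < d * (e * e) →
          Pos′ d ((+ a +√ (ℤ.- + b)) ⊕ ((ℤ.- + c) +√ + e))
  pn+np a b c e h k with difference a c | difference e b
  ... | surplus l p q | surplus m p′ q′ =
          pp l m (cong₂ _+√_ q (trans (ℤₚ.+-comm (ℤ.- + b) (+ e)) q′)) (positive l m p p′)
    where
    positive : ∀ l m → a ≡ c + l → e ≡ b + m → 0 < l + m
    positive (suc _) _ _ _ = s≤s z≤n
    positive zero (suc _) _ _ = s≤s z≤n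
    positive zero zero p p′ = ⊥-elim (<-asym h (subst₂ (λ s t → s * s < d * (t * t))
      (sym (trans p (+-identityʳ c))) (trans p′ (+-identityʳ b)) k))
  ... | surplus l refl q | deficit m refl q′ with <-≤-connex (d * (m * m)) (l * l)
  ...   | inj₁ m<l = pn l m (cong₂ _+√_ q (trans (ℤₚ.+-comm (ℤ.- + b) (+ e)) q′)) m<l
  ...   | inj₂ l≤m = ⊥-elim (<-asym h (subst₂ (λ s t → s * s < d * (t * t)) (+-comm l c) (+-comm m e)
                       (below-+ d l c m e l≤m k)))
  pn+np a b c e h k | deficit l refl q | surplus m refl q′ with <-≤-connex (l * l) (d * (m * m))
  ...   | inj₁ l<m = np l m (cong₂ _+√_ q (trans (ℤₚ.+-comm (ℤ.- + b) (+ e)) q′)) l<m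
  ...   | inj₂ m≤l = ⊥-elim (<-asym k (subst₂ (λ s t → d * (s * s) < t * t) (+-comm m b) (+-comm l a)
                       (above-+ d l a m b m≤l h)))
  pn+np a b c e h k | deficit l refl q | deficit m refl q′ =
    ⊥-elim (<-irrefl refl (begin-strict
      d * (b * b)        <⟨ h ⟩
      a * a              ≤⟨ ≤-sq a (a + l) (m≤m+n a l) ⟩
      (a + l) * (a + l)  <⟨ k ⟩
      d * (e * e)        ≤⟨ ≤-dsq e (e + m) (m≤m+n e m) ⟩
      d * (b * b)        ∎))
    where open ≤-Reasoning

  Pos′-+ : ∀ {x y} → Pos′ d x → Pos′ d y → Pos′ d (x ⊕ y)
  Pos′-+ (pp a b refl h) (pp c e refl k) = pp (a + c) (b + e) refl
    (≤-trans h (+-mono-≤ (m≤m+n a c) (m≤m+n b e)))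
  Pos′-+ (pn a b refl h) (pn c e refl k) = pn (a + c) (b + e)
      (cong₂ _+√_ refl (sym (ℤₚ.neg-distrib-+ (+ b) (+ e))))
    (above-+ d a c b e (<⇒≤ h) k)
  Pos′-+ (np a b refl h) (np c e refl k) = np (a + c) (b + e)
      (cong₂ _+√_ (sym (ℤₚ.neg-distrib-+ (+ a) (+ c))) refl)
    (below-+ d a c b e (<⇒≤ h) k)
  Pos′-+ (pp a b refl h) (pn c e refl k) = pp+pn a b c e h k
  Pos′-+ (pp a b refl h) (np c e refl k) = pp+np a b c e h k
  Pos′-+ (pn a b refl h) (np c e refl k) = pn+np a b c e h k
  Pos′-+ x@(pn a b refl h) y@(pp c e refl k) = subst (Pos′ d) (⊕-comm (+ c +√ + e) (+ a +√ (ℤ.- + b)))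
      (pp+pn c e a b k h)
  Pos′-+ x@(np a b refl h) y@(pp c e refl k) = subst (Pos′ d) (⊕-comm (+ c +√ + e) ((ℤ.- + a) +√ + b))
      (pp+np c e a b k h)
  Pos′-+ x@(np a b refl h) y@(pn c e refl k) =
    subst (Pos′ d) (⊕-comm (+ c +√ (ℤ.- + e)) ((ℤ.- + a) +√ + b)) (pn+np c e a b k h)

  ¬Pos′-0 : ¬ Pos′ d 0z
  ¬Pos′-0 (pp a b eq h) with cong re eq | cong im eq
  ... | refl | refl = contradiction h λ ()
  ¬Pos′-0 (pn a b eq h) with cong re eq
  ... | refl = contradiction h λ ()
  ¬Pos′-0 (np a b eq h) with cong im eq
  ... | refl = contradiction (subst (a * a <_) (*-zeroʳ d) h) λ ()

  Pos′-tri : (∀ a b → a * a ≡ d * (b * b) → b ≡ 0) → ∀ z → Pos′ d z ⊎ z ≡ 0z ⊎ Pos′ d (⊝ z)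
  Pos′-tri irr (+ zero +√ + zero) = inj₂ (inj₁ refl)
  Pos′-tri irr (+ zero +√ + suc b) = inj₁ (pp 0 (suc b) refl (s≤s z≤n))
  Pos′-tri irr (+ suc a +√ + b) = inj₁ (pp (suc a) b refl (s≤s z≤n))
  Pos′-tri irr (+ a +√ -[1+ b ]) with <-cmp (d * (suc b * suc b)) (a * a)
  ... | tri< h _ _ = inj₁ (pn a (suc b) refl h)
  ... | tri≈ _ eq _ = contradiction (irr a (suc b) (sym eq)) λ ()
  ... | tri> _ _ h = inj₂ (inj₂ (np a (suc b) refl h))
  Pos′-tri irr (-[1+ a ] +√ + b) with <-cmp (d * (b * b)) (suc a * suc a)
  ... | tri< h _ _ = inj₂ (inj₂ (pn (suc a) b refl h))
  ... | tri≈ _ eq _ with refl ← irr (suc a) b (sym eq) = contradiction (trans (sym (*-zeroʳ d)) eq) λ ()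
  ... | tri> _ _ h = inj₁ (np (suc a) b refl h)
  Pos′-tri irr (-[1+ a ] +√ -[1+ b ]) = inj₂ (inj₂ (pp (suc a) (suc b) refl (s≤s z≤n)))

  -- Estimates of `m + n√d` in terms of `Ψ`

  module _ (1≤d : 1 ≤ d) where

    private
      ≤d* : ∀ x → x ≤ d * x
      ≤d* x = ≤-trans (≤-reflexive (sym (*-identityˡ x))) (*-monoˡ-≤ x 1≤d)

      1<n*a : ∀ n a → 1 < n → 0 < a → 1 < n * a
      1<n*a n (suc a) 1<n _ = ≤-trans 1<n (m≤m*n n (suc a))

      sq-scale : ∀ n a → n * a * (n * a) ≡ n * n * (a * a)
      sq-scale = ℕR.solve-∀

      sq-scale-d : ∀ e n b → e * (n * b * (n * b)) ≡ n * n * (e * (b * b))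
      sq-scale-d = ℕR.solve-∀

      sq-suc : ∀ k → suc k * suc k ≡ k * k + (2 * k + 1)
      sq-suc = ℕR.solve-∀

      distribʳ-suc : ∀ n x → n * n * suc x ≡ n * n * x + n * n
      distribʳ-suc = ℕR.solve-∀

      swap₃ : ∀ n a → 2 * (n * a) ≡ n * (2 * a)
      swap₃ = ℕR.solve-∀

      double : ∀ k → 2 * k + 1 + 1 ≡ 2 * suc k
      double = ℕR.solve-∀

      neg-* : ∀ n b → + n ℤ.* ℤ.- + b ≡ ℤ.- + (n * b)
      neg-* n b = trans (sym (ℤₚ.neg-distribʳ-* (+ n) (+ b))) (cong ℤ.-_ (sym (ℤₚ.pos-* n b)))

      +0 : ∀ x → x ℤ.+ + 0 ≡ x
      +0 = ℤₚ.+-identityʳ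

    -- The norm a² − d b² is a nonzero integer and its factor conjugate to z is O(Ψ z).
    gap′ : ∀ {z} n → Pos′ d z → 2 * Ψ z + 2 ≤ n → Pos′ d ((n · z) ⊖ nat 1)
    gap′ {z} n (pp (suc a) b refl _) h with m≤n⇒∃[o]m+o≡n
        (1<n*a n (suc a) (≤-trans (m≤n+m 2 _) h) (s≤s z≤n))
    ... | k , eq = pp (suc k) (n * b)
          (cong₂ _+√_ (cong (ℤ._- + 1) (trans (sym (ℤₚ.pos-* n (suc a))) (cong +_ (sym eq))))
                  (trans (+0 _) (sym (ℤₚ.pos-* n b)))) (s≤s z≤n)
    gap′ {z} n (pp zero b refl 0<b) h =
      np 1 (n * b) (cong₂ _+√_ (cong (ℤ._- + 1) (ℤₚ.*-zeroʳ (+ n))) (trans (+0 _) (sym (ℤₚ.pos-* n b))))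
        (<-≤-trans (*-mono-< l l) (≤d* _))
      where
      l : 1 < n * b
      l = 1<n*a n b (≤-trans (m≤n+m 2 _) h) 0<b
    gap′ {z} n (pn a b refl p) h with m≤n⇒∃[o]m+o≡n (≤-trans (s≤s z≤n)
                                        (1<n*a n a (≤-trans (m≤n+m 2 _) h) (0<m*m⇒0<m a (≤-<-trans z≤n p))))
    ... | k , eq = pn k (n * b)
          (cong₂ _+√_ (cong (ℤ._- + 1) (trans (sym (ℤₚ.pos-* n a)) (cong +_ (sym eq))))
                  (trans (+0 _) (neg-* n b)))
          -- Integrality of the norm leaves `n * n` to spare, while lowering `n * a` by 1 costs its
          -- square only `2 * k + 1`, which is less than `2 * (n * a)` and so than `n * n`.
          (+-cancelʳ-< (n * n) _ _ (begin-strict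
            d * (n * b * (n * b)) + n * n  ≡⟨ cong (_+ n * n) (sq-scale-d d n b) ⟩
            n * n * (d * (b * b)) + n * n  ≡⟨ distribʳ-suc n _ ⟨
            n * n * suc (d * (b * b))      ≤⟨ *-monoʳ-≤ (n * n) p ⟩
            n * n * (a * a)                ≡⟨ sq-scale n a ⟨
            n * a * (n * a)                ≡⟨ cong (λ t → t * t) (sym eq) ⟩
            suc k * suc k                  ≡⟨ sq-suc k ⟩
            k * k + (2 * k + 1)            <⟨ +-monoʳ-< (k * k) 2k+1<nn ⟩
            k * k + n * n                  ∎))
      where
      open ≤-Reasoning
      2a≤n : 2 * a ≤ n
      2a≤n = ≤-trans (*-monoʳ-≤ 2 (m≤m⊔n a _)) (≤-trans (m≤m+n _ 2) h)
      2k+1<nn : 2 * k + 1 < n * n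
      2k+1<nn = begin-strict
        2 * k + 1      <⟨ m<m+n _ (s≤s z≤n) ⟩
        2 * k + 1 + 1  ≡⟨ double k ⟩
        2 * suc k      ≡⟨ cong (2 *_) eq ⟩
        2 * (n * a)    ≡⟨ swap₃ n a ⟩
        n * (2 * a)    ≤⟨ *-monoʳ-≤ n 2a≤n ⟩
        n * n          ∎
    gap′ {z} n (np a b refl p) h =
      np (suc (n * a)) (n * b)
        (cong₂ _+√_ (trans (cong (ℤ._- + 1) (neg-* n a)) (neg-suc (n * a)))
            (trans (+0 _) (sym (ℤₚ.pos-* n b))))
        (begin-strict
          suc (n * a) * suc (n * a)            ≡⟨ sq-suc (n * a) ⟩
          n * a * (n * a) + (2 * (n * a) + 1)  <⟨ +-monoʳ-< (n * a * (n * a)) l ⟩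
          n * a * (n * a) + n * n              ≡⟨ cong (_+ n * n) (sq-scale n a) ⟩
          n * n * (a * a) + n * n              ≡⟨ distribʳ-suc n _ ⟨
          n * n * suc (a * a)                  ≤⟨ *-monoʳ-≤ (n * n) p ⟩
          n * n * (d * (b * b))                ≡⟨ sq-scale-d d n b ⟨
          d * (n * b * (n * b))                ∎)
      where
      open ≤-Reasoning
      neg-suc : ∀ m → ℤ.- + m ℤ.- + 1 ≡ ℤ.- + suc m
      neg-suc m = trans (sym (ℤₚ.neg-distrib-+ (+ m) (+ 1))) (cong (λ t → ℤ.- + t) (+-comm m 1))
      2a+2≤n : 2 * a + 2 ≤ n
      2a+2≤n = ≤-trans (+-monoˡ-≤ 2 (*-monoʳ-≤ 2
          (≤-trans (≤-reflexive (sym (ℤₚ.∣-i∣≡∣i∣ (+ a)))) (m≤m⊔n _ b)))) h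
      expand₂ : ∀ n a → n * (2 * a + 2) ≡ 2 * (n * a) + 2 * n
      expand₂ = ℕR.solve-∀
      l : 2 * (n * a) + 1 < n * n
      l = begin-strict
        2 * (n * a) + 1        <⟨ +-monoʳ-< (2 * (n * a))
            (≤-trans (≤-trans (m≤n+m 2 _) 2a+2≤n) (m≤m+n n (n + 0))) ⟩
        2 * (n * a) + 2 * n    ≡⟨ expand₂ n a ⟨
        n * (2 * a + 2)        ≤⟨ *-monoʳ-≤ n 2a+2≤n ⟩
        n * n                  ∎

    private
      M-x : ∀ M B x → ℤ.∣ x ∣ ≤ B → Σ ℕ λ m → (M ≤ m) × (+ (B + M) ℤ.- x ≡ + m)
      M-x M B (+ a) a≤B with o , refl ← m≤n⇒∃[o]m+o≡n a≤B =
        o + M , m≤n+m M o , trans (cong (λ t → + t ℤ.- + a) (+-assoc a o M)) (cancel (+ a) (+ (o + M)))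
        where
        cancel : ∀ x y → x ℤ.+ y ℤ.- x ≡ y
        cancel = ℤR.solve-∀
      M-x M B -[1+ a ] _ = B + M + suc a , ≤-trans (m≤n+m M B) (m≤m+n (B + M) (suc a)) , refl

    -- From `√d ≤ d`, the real number `z` is at most `B + d * B`; the successor makes the inequality
    -- strict.
    bounded′ : ∀ z {B} → Ψ z ≤ B → Pos′ d (nat (B + suc (d * B)) ⊖ z)
    bounded′ (x +√ + b) {B} h with m , M≤m , eq ← M-x (suc (d * B)) B x (≤-trans (m≤m⊔n _ b) h) =
      pn m b (cong₂ _+√_ eq (ℤₚ.+-identityˡ _)) (begin-strict
        d * (b * b)        ≤⟨ ≤d* _ ⟩
        d * (d * (b * b))  ≡⟨ l d b ⟩
        d * b * (d * b)    <⟨ sq-< (≤-trans (s≤s (*-monoʳ-≤ d (≤-trans (m≤n⊔m _ b) h))) M≤m) ⟩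
        m * m              ∎)
      where
      open ≤-Reasoning
      l : ∀ d b → d * (d * (b * b)) ≡ d * b * (d * b)
      l = ℕR.solve-∀
    bounded′ (x +√ -[1+ b ]) {B} h with m , M≤m , eq ← M-x (suc (d * B)) B x (≤-trans (m≤m⊔n _ (suc b)) h) =
      pp m (suc b) (cong₂ _+√_ eq refl) (≤-trans (s≤s z≤n) (m≤n+m (suc b) m))

module ReducedComplexity (d : ℕ) (2≤d : 2 ≤ d) (sf : SquareFree d) where

  -- ℤ[√d] as an ordered group

  infix 4 _≺_ _≼_ _≺?_ _≼?_ _≡?_

  -- A record, so that the two sides stay inferable from the type; the bare difference would compute
  -- and lose them.
  record _≺_ (x y : Zd) : Set where
    constructor mk≺
    field
      difference-pos : Pos′ d (y ⊕ ⊝ x)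

  _≼_ : Zd → Zd → Set
  x ≼ y = x ≺ y ⊎ x ≡ y

  ≺⇒< : ∀ {x y} → x ≺ y → x ⟨ d ⟩< y
  ≺⇒< (mk≺ p) = Pos′⇒Pos p

  <⇒≺ : ∀ {x y} → x ⟨ d ⟩< y → x ≺ y
  <⇒≺ p = mk≺ (Pos⇒Pos′ _ p)

  ≼⇒≤ : ∀ {x y} → x ≼ y → x ⟨ d ⟩≤ y
  ≼⇒≤ (inj₁ p) = inj₁ (≺⇒< p)
  ≼⇒≤ (inj₂ e) = inj₂ e

  ≤⇒≼ : ∀ {x y} → x ⟨ d ⟩≤ y → x ≼ y
  ≤⇒≼ (inj₁ p) = inj₁ (<⇒≺ p)
  ≤⇒≼ (inj₂ e) = inj₂ e

  -- An inequality depends only on the difference of its sides. Most order facts below are thereby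
  -- reduced to an identity in the additive group.
  ≺-shift : ∀ {x y z w} → x ≺ y → y ⊕ ⊝ x ≡ w ⊕ ⊝ z → z ≺ w
  ≺-shift (mk≺ p) eq = mk≺ (subst (Pos′ d) eq p)

  private
    ⊕⊝-self : ∀ x → x ⊕ ⊝ x ≡ 0z
    ⊕⊝-self = R.solve-∀ zd
    ⊕⊝-cancel : ∀ x y → y ≡ x ⊕ (y ⊕ ⊝ x)
    ⊕⊝-cancel = R.solve-∀ zd
    ⊕-0 : ∀ x → x ⊕ 0z ≡ x
    ⊕-0 = R.solve-∀ zd

  ⊖≡0⇒≡ : ∀ {x y} → y ⊕ ⊝ x ≡ 0z → x ≡ y
  ⊖≡0⇒≡ {x} {y} eq = sym (trans (⊕⊝-cancel x y) (trans (cong (x ⊕_) eq) (⊕-0 x)))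

  ≼-shift : ∀ {x y z w} → x ≼ y → y ⊕ ⊝ x ≡ w ⊕ ⊝ z → z ≼ w
  ≼-shift (inj₁ p) eq = inj₁ (≺-shift p eq)
  ≼-shift {x} (inj₂ refl) eq = inj₂ (⊖≡0⇒≡ (trans (sym eq) (⊕⊝-self x)))

  ≺-⊕ : ∀ {x y z w} → x ≺ y → z ≺ w → x ⊕ z ≺ y ⊕ w
  ≺-⊕ {x} {y} {z} {w} (mk≺ p) (mk≺ q) = mk≺ (subst (Pos′ d) (l x y z w) (Pos′-+ p q))
    where
    l : ∀ x y z w → (y ⊕ ⊝ x) ⊕ (w ⊕ ⊝ z) ≡ (y ⊕ w) ⊕ ⊝ (x ⊕ z)
    l = R.solve-∀ zd

  ⊕-monoʳ-≺ : ∀ c {x y} → x ≺ y → c ⊕ x ≺ c ⊕ y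
  ⊕-monoʳ-≺ c {x} {y} h = ≺-shift h (l c x y)
    where
    l : ∀ c x y → y ⊕ ⊝ x ≡ c ⊕ y ⊕ ⊝ (c ⊕ x)
    l = R.solve-∀ zd

  ⊕-monoˡ-≺ : ∀ c {x y} → x ≺ y → x ⊕ c ≺ y ⊕ c
  ⊕-monoˡ-≺ c {x} {y} h = subst₂ _≺_ (⊕-comm c x) (⊕-comm c y) (⊕-monoʳ-≺ c h)

  ⊕-monoʳ-≼ : ∀ c {x y} → x ≼ y → c ⊕ x ≼ c ⊕ y
  ⊕-monoʳ-≼ c (inj₁ h) = inj₁ (⊕-monoʳ-≺ c h)
  ⊕-monoʳ-≼ c (inj₂ refl) = inj₂ refl

  ⊕-monoˡ-≼ : ∀ c {x y} → x ≼ y → x ⊕ c ≼ y ⊕ c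
  ⊕-monoˡ-≼ c (inj₁ h) = inj₁ (⊕-monoˡ-≺ c h)
  ⊕-monoˡ-≼ c (inj₂ refl) = inj₂ refl

  ≺-trans : ∀ {x y z} → x ≺ y → y ≺ z → x ≺ z
  ≺-trans {x} {y} {z} p q = ≺-shift (≺-⊕ p q) (l x y z)
    where
    l : ∀ x y z → (y ⊕ z) ⊕ ⊝ (x ⊕ y) ≡ z ⊕ ⊝ x
    l = R.solve-∀ zd

  ≺-≼-trans : ∀ {x y z} → x ≺ y → y ≼ z → x ≺ z
  ≺-≼-trans p (inj₁ q) = ≺-trans p q
  ≺-≼-trans p (inj₂ refl) = p

  ≼-≺-trans : ∀ {x y z} → x ≼ y → y ≺ z → x ≺ z
  ≼-≺-trans (inj₁ p) q = ≺-trans p q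
  ≼-≺-trans (inj₂ refl) q = q

  ≼-trans : ∀ {x y z} → x ≼ y → y ≼ z → x ≼ z
  ≼-trans p (inj₁ q) = inj₁ (≼-≺-trans p q)
  ≼-trans p (inj₂ refl) = p

  ≼-refl : ∀ {x} → x ≼ x
  ≼-refl = inj₂ refl

  ≼-⊕ : ∀ {x y z w} → x ≼ y → z ≼ w → x ⊕ z ≼ y ⊕ w
  ≼-⊕ {x} {y} {z} {w} p q = ≼-trans (⊕-monoˡ-≼ z p) (⊕-monoʳ-≼ y q)

  ≺-≼-⊕ : ∀ {x y z w} → x ≺ y → z ≼ w → x ⊕ z ≺ y ⊕ w
  ≺-≼-⊕ {x} {y} {z} {w} p q = ≺-≼-trans (⊕-monoˡ-≺ z p) (⊕-monoʳ-≼ y q)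

  ≺-irrefl : ∀ {x} → ¬ x ≺ x
  ≺-irrefl {x} (mk≺ p) = ¬Pos′-0 (subst (Pos′ d) (⊕⊝-self x) p)

  ≺⇒⋡ : ∀ {x y} → x ≺ y → ¬ y ≼ x
  ≺⇒⋡ p q = ≺-irrefl (≺-≼-trans p q)

  compare : ∀ x y → x ≺ y ⊎ x ≡ y ⊎ y ≺ x
  compare x y with Pos′-tri (squarefree⇒irrational 2≤d sf) (y ⊕ ⊝ x)
  ... | inj₁ p = inj₁ (mk≺ p)
  ... | inj₂ (inj₁ e) = inj₂ (inj₁ (⊖≡0⇒≡ e))
  ... | inj₂ (inj₂ p) = inj₂ (inj₂ (mk≺ (subst (Pos′ d) (l x y) p)))
    where
    l : ∀ x y → ⊝ (y ⊕ ⊝ x) ≡ x ⊕ ⊝ y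
    l = R.solve-∀ zd

  ≺-≽-connex : ∀ x y → x ≺ y ⊎ y ≼ x
  ≺-≽-connex x y with compare x y
  ... | inj₁ p = inj₁ p
  ... | inj₂ (inj₁ e) = inj₂ (inj₂ (sym e))
  ... | inj₂ (inj₂ q) = inj₂ (inj₁ q)

  _≺?_ : ∀ x y → Dec (x ≺ y)
  x ≺? y with ≺-≽-connex x y
  ... | inj₁ p = yes p
  ... | inj₂ q = no λ p → ≺⇒⋡ p q

  _≼?_ : ∀ x y → Dec (x ≼ y)
  x ≼? y with ≺-≽-connex y x
  ... | inj₁ p = no (≺⇒⋡ p)
  ... | inj₂ q = yes q

  _≡?_ : ∀ (x y : Zd) → Dec (x ≡ y)
  x ≡? y with compare x y
  ... | inj₁ p = no λ { refl → ≺-irrefl p }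
  ... | inj₂ (inj₁ e) = yes e
  ... | inj₂ (inj₂ p) = no λ { refl → ≺-irrefl p }

  ⋠⇒≻ : ∀ {x y} → ¬ x ≼ y → y ≺ x
  ⋠⇒≻ {x} {y} h with ≺-≽-connex y x
  ... | inj₁ p = p
  ... | inj₂ q = contradiction q h

  ⊀⇒≽ : ∀ {x y} → ¬ x ≺ y → y ≼ x
  ⊀⇒≽ {x} {y} h with ≺-≽-connex x y
  ... | inj₁ p = contradiction p h
  ... | inj₂ q = q

  ≺⇒0≺ : ∀ {x y} → x ≺ y → 0z ≺ y ⊕ ⊝ x
  ≺⇒0≺ {x} {y} p = ≺-shift p (l (y ⊕ ⊝ x))
    where
    l : ∀ x → x ≡ x ⊕ ⊝ 0z
    l = R.solve-∀ zd

  0-· : ∀ z → 0 · z ≡ 0z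
  0-· z = cong₂ _+√_ (ℤₚ.*-zeroˡ (re z)) (ℤₚ.*-zeroˡ (im z))

  1-· : ∀ z → 1 · z ≡ z
  1-· z = cong₂ _+√_ (ℤₚ.*-identityˡ (re z)) (ℤₚ.*-identityˡ (im z))

  ·-+ : ∀ m n z → (m + n) · z ≡ m · z ⊕ n · z
  ·-+ m n z = cong₂ _+√_ (ℤₚ.*-distribʳ-+ (re z) (+ m) (+ n)) (ℤₚ.*-distribʳ-+ (im z) (+ m) (+ n))

  suc-· : ∀ k z → suc k · z ≡ z ⊕ k · z
  suc-· k z = trans (·-+ 1 k z) (cong (_⊕ k · z) (1-· z))

  ·-* : ∀ m n z → (m * n) · z ≡ m · n · z
  ·-* m n z = cong₂ _+√_ (l (re z)) (l (im z))
    where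
    l : ∀ x → + (m * n) ℤ.* x ≡ + m ℤ.* (+ n ℤ.* x)
    l x = trans (cong (ℤ._* x) (ℤₚ.pos-* m n)) (ℤₚ.*-assoc (+ m) (+ n) x)

  ·-nat : ∀ k m → k · nat m ≡ nat (k * m)
  ·-nat k m = cong₂ _+√_ (sym (ℤₚ.pos-* k m)) (ℤₚ.*-zeroʳ (+ k))

  ·-swap : ∀ m n z → m · n · z ≡ n · m · z
  ·-swap m n z = trans (sym (·-* m n z)) (trans (cong (_· z) (*-comm m n)) (·-* n m z))

  ·-mono-≼ : ∀ k {x y} → x ≼ y → k · x ≼ k · y
  ·-mono-≼ zero {x} {y} _ = inj₂ (trans (0-· x) (sym (0-· y)))
  ·-mono-≼ (suc k) {x} {y} p = subst₂ _≼_ (sym (suc-· k x)) (sym (suc-· k y)) (≼-⊕ p (·-mono-≼ k p))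

  ·-mono-≺ : ∀ k {x y} → 1 ≤ k → x ≺ y → k · x ≺ k · y
  ·-mono-≺ (suc k) {x} {y} _ p = subst₂ _≺_ (sym (suc-· k x)) (sym (suc-· k y))
      (≺-≼-⊕ p (·-mono-≼ k (inj₁ p)))

  ·-cancel-≼ : ∀ k {x y} → 1 ≤ k → k · x ≼ k · y → x ≼ y
  ·-cancel-≼ k 1≤k h = ⊀⇒≽ λ p → ≺⇒⋡ (·-mono-≺ k 1≤k p) h

  k·0 : ∀ k → k · 0z ≡ 0z
  k·0 k = trans (·-nat k 0) (cong nat (*-zeroʳ k))

  0≼· : ∀ k {z} → 0z ≼ z → 0z ≼ k · z
  0≼· k {z} h = subst (_≼ k · z) (k·0 k) (·-mono-≼ k h)

  ≼-⊕ʳ : ∀ {x y} → 0z ≼ y → x ≼ x ⊕ y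
  ≼-⊕ʳ {x} {y} h = subst (_≼ x ⊕ y) (⊕-0 x) (⊕-monoʳ-≼ x h)

  ·-monoˡ-≼ : ∀ {m n} → m ≤ n → ∀ {z} → 0z ≼ z → m · z ≼ n · z
  ·-monoˡ-≼ {m} m≤n {z} h with k , refl ← m≤n⇒∃[o]m+o≡n m≤n =
    subst (m · z ≼_) (sym (·-+ m k z)) (≼-⊕ʳ (0≼· k h))

  nat-mono-≼ : ∀ {m n} → m ≤ n → nat m ≼ nat n
  nat-mono-≼ {m} {n} m≤n with k , refl ← m≤n⇒∃[o]m+o≡n m≤n = nonneg k
    where
    eq : ∀ k → nat (m + k) ⊕ ⊝ nat m ≡ nat k
    eq k = cong₂ _+√_ (l (+ m) (+ k)) refl
      where
      l : ∀ x y → x ℤ.+ y ℤ.- x ≡ y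
      l = ℤR.solve-∀
    nonneg : ∀ k → nat m ≼ nat (m + k)
    nonneg zero = inj₂ (cong nat (sym (+-identityʳ m)))
    nonneg (suc k) = inj₁ (mk≺ (pp (suc k) 0 (eq (suc k)) (s≤s z≤n)))

  0≺nat1 : 0z ≺ nat 1
  0≺nat1 = mk≺ (pp 1 0 refl (s≤s z≤n))

  1≤d : 1 ≤ d
  1≤d = ≤-trans (s≤s z≤n) 2≤d

  gap : ∀ {z n} → 0z ≺ z → 2 * Ψ z + 2 ≤ n → nat 1 ≺ n · z
  gap {z} {n} (mk≺ p) h = mk≺ (gap′ 1≤d n (subst (Pos′ d) (l z) p) h)
    where
    l : ∀ z → z ⊕ ⊝ 0z ≡ z
    l = R.solve-∀ zd

  bounded : ∀ z → z ≺ nat (Ψ z + suc (d * Ψ z))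
  bounded z = mk≺ (bounded′ 1≤d z ≤-refl)

  Ψ-⊕ : ∀ x y → Ψ (x ⊕ y) ≤ Ψ x + Ψ y
  Ψ-⊕ (a +√ b) (c +√ e) = ⊔-lub
    (≤-trans (ℤₚ.∣i+j∣≤∣i∣+∣j∣ a c) (+-mono-≤ (m≤m⊔n ℤ.∣ a ∣ ℤ.∣ b ∣) (m≤m⊔n ℤ.∣ c ∣ ℤ.∣ e ∣)))
    (≤-trans (ℤₚ.∣i+j∣≤∣i∣+∣j∣ b e) (+-mono-≤ (m≤n⊔m ℤ.∣ a ∣ ℤ.∣ b ∣) (m≤n⊔m ℤ.∣ c ∣ ℤ.∣ e ∣)))

  Ψ-⊝ : ∀ x → Ψ (⊝ x) ≡ Ψ x
  Ψ-⊝ (a +√ b) = cong₂ _⊔_ (ℤₚ.∣-i∣≡∣i∣ a) (ℤₚ.∣-i∣≡∣i∣ b)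

  Ψ-⊖ : ∀ x y → Ψ (x ⊕ ⊝ y) ≤ Ψ x + Ψ y
  Ψ-⊖ x y = ≤-trans (Ψ-⊕ x (⊝ y)) (≤-reflexive (cong (_+_ (Ψ x)) (Ψ-⊝ y)))

  Ψ-nat : ∀ k → Ψ (nat k) ≡ k
  Ψ-nat k = ⊔-identityʳ k

  -- Two points whose difference has small Ψ but which are closer than the gap allows coincide.
  close⇒≡ : ∀ {x y θ n} → n · θ ≼ nat 1 → 2 * Ψ (x ⊕ ⊝ y) + 2 ≤ n → x ≼ y ⊕ θ → y ≼ x ⊕ θ → x ≡ y
  close⇒≡ {x} {y} {θ} {n} nθ≼1 h p q with compare x y
  ... | inj₂ (inj₁ e) = e
  ... | inj₂ (inj₂ y≺x) = contradiction
        (≼-trans (·-mono-≼ n (≼-shift p (l x y θ))) nθ≼1) (≺⇒⋡ (gap (≺⇒0≺ y≺x) h))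
    where
    l : ∀ x y θ → (y ⊕ θ) ⊕ ⊝ x ≡ θ ⊕ ⊝ (x ⊕ ⊝ y)
    l = R.solve-∀ zd
  ... | inj₁ x≺y = contradiction
        (≼-trans (·-mono-≼ n (≼-shift q (l y x θ))) nθ≼1)
        (≺⇒⋡ (gap (≺⇒0≺ x≺y) (subst (λ t → 2 * t + 2 ≤ n)
            (trans (sym (Ψ-⊝ (x ⊕ ⊝ y))) (cong Ψ (l′ x y))) h)))
    where
    l : ∀ x y θ → (y ⊕ θ) ⊕ ⊝ x ≡ θ ⊕ ⊝ (x ⊕ ⊝ y)
    l = R.solve-∀ zd
    l′ : ∀ x y → ⊝ (x ⊕ ⊝ y) ≡ y ⊕ ⊝ x
    l′ = R.solve-∀ zd

  -- Return times

  infixr 8 _^[_]_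
  _^[_]_ : (Zd → Zd) → ℕ → Zd → Zd
  f ^[ zero ] x = x
  f ^[ suc n ] x = f (f ^[ n ] x)

  ^-comm : ∀ f n x → f ^[ n ] (f x) ≡ f (f ^[ n ] x)
  ^-comm f zero x = refl
  ^-comm f (suc n) x = cong f (^-comm f n x)

  ^-+ : ∀ f m n x → f ^[ m + n ] x ≡ f ^[ m ] (f ^[ n ] x)
  ^-+ f zero n x = refl
  ^-+ f (suc m) n x = cong f (^-+ f m n x)

  ^-inverse : ∀ {f g} → (∀ x → g (f x) ≡ x) → ∀ n x → g ^[ n ] (f ^[ n ] x) ≡ x
  ^-inverse gf zero x = refl
  ^-inverse {f} {g} gf (suc n) x =
    trans (sym (^-comm g n (f (f ^[ n ] x))))
        (trans (cong (g ^[ n ]_) (gf (f ^[ n ] x))) (^-inverse gf n x))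

  ^-undo : ∀ {f g} → (∀ x → g (f x) ≡ x) → ∀ j k x → g ^[ j ] (f ^[ j + k ] x) ≡ f ^[ k ] x
  ^-undo {f} {g} gf j k x = trans (cong (g ^[ j ]_) (^-+ f j k x)) (^-inverse gf j (f ^[ k ] x))

  Within : Zd → Zd → Zd → Set
  Within a b x = a ≼ x × x ≺ b

  within? : ∀ a b x → Dec (Within a b x)
  within? a b x = (a ≼? x) ×-dec (x ≺? b)

  -- F translates an interval rigidly unless a singularity lies inside it or at its right end.
  record Exchange (m : ℕ) : Set where
    field
      lo hi : Zd
      F B : Zd → Zd
      BF : ∀ x → B (F x) ≡ x
      FB : ∀ x → F (B x) ≡ x
      F-within : ∀ {x} → Within lo hi x → Within lo hi (F x)
      B-within : ∀ {x} → Within lo hi x → Within lo hi (B x)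
      A : ℕ
      F-Ψ : ∀ x → Ψ (F x ⊕ ⊝ x) ≤ A
      B-Ψ : ∀ x → Ψ (B x ⊕ ⊝ x) ≤ A
      sing sing′ : Fin m → Zd
      F-rigid : ∀ {x y} → x ≼ y → (∀ p → ¬ (x ≺ sing p × sing p ≼ y)) → F y ≡ F x ⊕ (y ⊕ ⊝ x)
      B-rigid : ∀ {x y} → x ≼ y → (∀ p → ¬ (x ≺ sing′ p × sing′ p ≼ y)) → B y ≡ B x ⊕ (y ⊕ ⊝ x)

    F^-injective : ∀ n {x y} → F ^[ n ] x ≡ F ^[ n ] y → x ≡ y
    F^-injective n {x} {y} eq = trans (sym (^-inverse BF n x))
        (trans (cong (B ^[ n ]_) eq) (^-inverse BF n y))

    F^-within : ∀ n {x} → Within lo hi x → Within lo hi (F ^[ n ] x)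
    F^-within zero h = h
    F^-within (suc n) h = F-within (F^-within n h)

    F^-Ψ : ∀ n x → Ψ (F ^[ n ] x ⊕ ⊝ x) ≤ n * A
    F^-Ψ zero x = ≤-reflexive (cong Ψ (l x))
      where
      l : ∀ x → x ⊕ ⊝ x ≡ 0z
      l = R.solve-∀ zd
    F^-Ψ (suc n) x = begin
      Ψ (F y ⊕ ⊝ x)                  ≡⟨ cong Ψ (l (F y) y x) ⟩
      Ψ ((F y ⊕ ⊝ y) ⊕ (y ⊕ ⊝ x))    ≤⟨ Ψ-⊕ (F y ⊕ ⊝ y) (y ⊕ ⊝ x) ⟩
      Ψ (F y ⊕ ⊝ y) + Ψ (y ⊕ ⊝ x)    ≤⟨ +-mono-≤ (F-Ψ y) (F^-Ψ n x) ⟩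
      A + n * A                      ∎
      where
      open ≤-Reasoning
      y = F ^[ n ] x
      l : ∀ a y x → a ⊕ ⊝ x ≡ (a ⊕ ⊝ y) ⊕ (y ⊕ ⊝ x)
      l = R.solve-∀ zd

  op : ∀ {m} → Exchange m → Exchange m
  op E = record
    { lo = lo ; hi = hi ; F = B ; B = F ; BF = FB ; FB = BF ; F-within = B-within ; B-within = F-within
    ; A = A ; F-Ψ = B-Ψ ; B-Ψ = F-Ψ ; sing = sing′ ; sing′ = sing ; F-rigid = B-rigid ; B-rigid = F-rigid }
    where open Exchange E

  first : {C : ℕ → Set} → (∀ i → Dec (C i)) → ∀ n →
          (∀ i → i < n → ¬ C i) ⊎ (∃ λ i → i < n × C i × (∀ j → j < i → ¬ C j))
  first C? zero = inj₁ λ _ ()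
  first C? (suc n) with first C? n
  ... | inj₂ (i , i<n , c , min) = inj₂ (i , m≤n⇒m≤1+n i<n , c , min)
  ... | inj₁ none with C? n
  ...   | yes c = inj₂ (n , ≤-refl , c , none)
  ...   | no ¬c = inj₁ λ i i<1+n → none′ i (m≤n⇒m<n∨m≡n (≤-pred i<1+n))
    where
    none′ : ∀ i → i < n ⊎ i ≡ n → ¬ _
    none′ i (inj₁ i<n) = none i i<n
    none′ i (inj₂ refl) = ¬c

  -- Each point of `P` inside the interval shortens it to the side of `x`, a point equal to `x`
  -- becoming the left end. The new ends are old ends or values of `P`, so a property `S` of all of
  -- these survives; it will be a bound on `Ψ`.
  cut : ∀ {k} (P : Fin k → Zd) (S : Zd → Set) → (∀ p → S (P p)) →
        ∀ {a b x} → Within a b x → S a → S b →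
        ∃₂ λ a′ b′ → a ≼ a′ × b′ ≼ b × Within a′ b′ x × S a′ × S b′ × (∀ p → ¬ (a′ ≺ P p × P p ≺ b′))
  cut {zero} P S SP {a} {b} ax sa sb = a , b , ≼-refl , ≼-refl , ax , sa , sb , λ ()
  cut {suc k} P S SP {a} {b} {x} (a≼x , x≺b) sa sb with ≺-≽-connex x (P Fin.zero)
  ... | inj₁ x≺p with ≺-≽-connex (P Fin.zero) b
  ...   | inj₁ p≺b with a′ , b′ , aa′ , b′p , w , sa′ , sb′ , unc ←
                        cut (λ i → P (Fin.suc i)) S (λ i → SP (Fin.suc i)) {a} {P Fin.zero} {x}
                            (a≼x , x≺p) sa (SP Fin.zero) =
          a′ , b′ , aa′ , ≼-trans b′p (inj₁ p≺b) , w , sa′ , sb′ ,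
          λ { Fin.zero (_ , q) → ≺⇒⋡ q b′p ; (Fin.suc i) → unc i }
  ...   | inj₂ b≼p with a′ , b′ , aa′ , b′b , w , sa′ , sb′ , unc ←
                        cut (λ i → P (Fin.suc i)) S (λ i → SP (Fin.suc i)) {a} {b} {x} (a≼x , x≺b) sa sb =
          a′ , b′ , aa′ , b′b , w , sa′ , sb′ ,
          λ { Fin.zero (_ , q) → ≺⇒⋡ q (≼-trans b′b b≼p) ; (Fin.suc i) → unc i }
  cut {suc k} P S SP {a} {b} {x} (a≼x , x≺b) sa sb | inj₂ p≼x with ≺-≽-connex a (P Fin.zero)
  ...   | inj₁ a≺p with a′ , b′ , pa′ , b′b , w , sa′ , sb′ , unc ←
                        cut (λ i → P (Fin.suc i)) S (λ i → SP (Fin.suc i)) {P Fin.zero} {b} {x}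
                            (p≼x , x≺b) (SP Fin.zero) sb =
          a′ , b′ , ≼-trans (inj₁ a≺p) pa′ , b′b , w , sa′ , sb′ ,
          λ { Fin.zero (q , _) → ≺⇒⋡ q pa′ ; (Fin.suc i) → unc i }
  ...   | inj₂ p≼a with a′ , b′ , aa′ , b′b , w , sa′ , sb′ , unc ←
                        cut (λ i → P (Fin.suc i)) S (λ i → SP (Fin.suc i)) {a} {b} {x} (a≼x , x≺b) sa sb =
          a′ , b′ , aa′ , b′b , w , sa′ , sb′ ,
          λ { Fin.zero (q , _) → ≺⇒⋡ q (≼-trans p≼a aa′) ; (Fin.suc i) → unc i }

  argmax : ∀ n (c : Fin (suc n) → Zd) → ∃ λ k → ∀ i → c i ≼ c k
  argmax zero c = Fin.zero , λ { Fin.zero → ≼-refl }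
  argmax (suc n) c with argmax n (λ i → c (Fin.suc i))
  ... | k , max with ≺-≽-connex (c (Fin.suc k)) (c Fin.zero)
  ...   | inj₁ lt = Fin.zero , λ { Fin.zero → ≼-refl ; (Fin.suc i) → ≼-trans (max i) (inj₁ lt) }
  ...   | inj₂ ge = Fin.suc k , λ { Fin.zero → ge ; (Fin.suc i) → max i }

  -- Induction by removing the largest point: one of the others is high by hypothesis, and the
  -- largest, being apart from it, lies another `L` above.
  spread : ∀ {lo L} → 0z ≺ L → ∀ n (c : Fin (suc n) → Zd) → (∀ i → lo ≼ c i) →
           (∀ i j → i ≢ j → c i ⊕ L ≼ c j ⊎ c j ⊕ L ≼ c i) → ∃ λ i → lo ⊕ n · L ≼ c i
  spread {lo} {L} _ zero c lo≼ _ = Fin.zero , subst (_≼ c Fin.zero)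
      (sym (trans (cong (lo ⊕_) (0-· L)) (l lo))) (lo≼ Fin.zero)
    where
    l : ∀ x → x ⊕ 0z ≡ x
    l = R.solve-∀ zd
  spread {lo} {L} 0≺L (suc n) c lo≼ apart with argmax (suc n) c
  ... | k , max with spread 0≺L n (λ i → c (punchIn k i)) (λ i → lo≼ (punchIn k i))
                       (λ i j i≢j → apart _ _ (λ eq → i≢j (Finₚ.punchIn-injective k i j eq)))
  ...   | i , h with apart (punchIn k i) k (Finₚ.punchInᵢ≢i k i)
  ...     | inj₁ below = k , subst (_≼ c k) eq (≼-trans (⊕-monoˡ-≼ L h) below)
    where
    l : ∀ x y z → (x ⊕ y) ⊕ z ≡ x ⊕ (z ⊕ y)
    l = R.solve-∀ zd
    eq : (lo ⊕ n · L) ⊕ L ≡ lo ⊕ suc n · L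
    eq = trans (l lo (n · L) L) (cong (lo ⊕_) (sym (suc-· n L)))
  ...     | inj₂ above = contradiction (≼-trans above (max (punchIn k i))) (≺⇒⋡ (≺-shift 0≺L (l (c k) L)))
    where
    l : ∀ x y → y ⊕ ⊝ 0z ≡ (x ⊕ y) ⊕ ⊝ x
    l = R.solve-∀ zd

  private
    diff-shift : ∀ a b y → y ⊕ ⊝ a ≡ (b ⊕ (y ⊕ ⊝ a)) ⊕ ⊝ b
    diff-shift = R.solve-∀ zd
    diff-shift-L : ∀ a b y L → (a ⊕ L) ⊕ ⊝ y ≡ (b ⊕ L) ⊕ ⊝ (b ⊕ (y ⊕ ⊝ a))
    diff-shift-L = R.solve-∀ zd

  within-translate : ∀ {a y L} b → Within a (a ⊕ L) y → Within b (b ⊕ L) (b ⊕ (y ⊕ ⊝ a))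
  within-translate {a} {y} {L} b (p , q) = ≼-shift p (diff-shift a b y) , ≺-shift q (diff-shift-L a b y L)

  abstract

    -- Stage times in units of `Q`. At time `n = g * Q` a piece has `Ψ L ≤ 2 * (Q + n * A)`, so by
    -- the gap `(4 * (1 + g * A) + 2) * Q` copies of `L` exceed length 1, and `R` times as many
    -- exceed the domain.
    growth : ℕ → ℕ → ℕ → ℕ
    growth R A zero = 0
    growth R A (suc j) = growth R A j + R * (4 * (1 + growth R A j * A) + 2)

    growth-suc : ∀ R A j → growth R A (suc j) ≡ growth R A j + R * (4 * (1 + growth R A j * A) + 2)
    growth-suc R A j = refl

  growth-mono : ∀ R A {i j} → i ≤ j → growth R A i ≤ growth R A j
  growth-mono R A {zero} {zero} _ = ≤-refl
  growth-mono R A {i} {suc j} h with m≤n⇒m<n∨m≡n h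
  ... | inj₁ i<1+j = ≤-trans (growth-mono R A (≤-pred i<1+j))
      (≤-trans (m≤m+n _ _) (≤-reflexive (sym (growth-suc R A j))))
  ... | inj₂ refl = ≤-refl

  module Recurrence {m} (E : Exchange m)
    (u v : Zd) (u≺v : u ≺ v) (lo≼u : Exchange.lo E ≼ u) (v≼hi : v ≼ Exchange.hi E)
    (Q : ℕ) (1≤Q : 1 ≤ Q) (Ψu : Ψ u ≤ Q) (Ψv : Ψ v ≤ Q) (Ψsing : ∀ p → Ψ (Exchange.sing E p) ≤ Q)
    (R : ℕ) (hi≼ : Exchange.hi E ≼ Exchange.lo E ⊕ nat R) where

    open Exchange E

    InJ : Zd → Set
    InJ = Within u v

    -- The ends of the window count as cut points too, so that an uncut image lies wholly inside the
    -- window or wholly outside it.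
    P : Fin (2 + m) → Zd
    P Fin.zero = u
    P (Fin.suc Fin.zero) = v
    P (Fin.suc (Fin.suc p)) = sing p

    ΨP : ∀ p → Ψ (P p) ≤ Q
    ΨP Fin.zero = Ψu
    ΨP (Fin.suc Fin.zero) = Ψv
    ΨP (Fin.suc (Fin.suc p)) = Ψsing p

    InJ⇒within : ∀ {x} → InJ x → Within lo hi x
    InJ⇒within (p , q) = ≼-trans lo≼u p , ≺-≼-trans q v≼hi

    Uncut : Zd → Zd → Set
    Uncut a b = ∀ p → ¬ (a ≺ P p × P p ≺ b)

    J-uncut : ∀ {a b x y} → Uncut a b → Within a b x → Within a b y → InJ x → InJ y
    J-uncut {a} {b} {x} {y} unc (a≼x , x≺b) (a≼y , y≺b) (u≼x , x≺v) = ⊀⇒≽ (λ y≺u →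
        unc Fin.zero (≼-≺-trans a≼y y≺u , ≼-≺-trans u≼x x≺b)) , ⋠⇒≻ (λ v≼y →
        unc (Fin.suc Fin.zero) (≼-≺-trans a≼x x≺v , ≼-≺-trans v≼y y≺b))

    UncutUntil : ℕ → Zd → Zd → Set
    UncutUntil k α L = ∀ i → i < k → Uncut (F ^[ i ] α) (F ^[ i ] α ⊕ L)

    rigid : ∀ {k α L} → UncutUntil k α L → ∀ {y} → Within α (α ⊕ L) y →
            ∀ i → i ≤ k → F ^[ i ] y ≡ F ^[ i ] α ⊕ (y ⊕ ⊝ α)
    rigid {α = α} unc {y} w zero _ = l α y
      where
      l : ∀ α y → y ≡ α ⊕ (y ⊕ ⊝ α)
      l = R.solve-∀ zd
    rigid {k} {α} {L} unc {y} w (suc i) i<k = begin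
      F (F ^[ i ] y)                                             ≡⟨ F-rigid (proj₁ w′) (λ { p (q , q′) →
                                                                      unc i i<k (Fin.suc (Fin.suc p)) (q , ≼-≺-trans q′ (proj₂ w′)) }) ⟩
      F (F ^[ i ] α) ⊕ (F ^[ i ] y ⊕ ⊝ (F ^[ i ] α))             ≡⟨ cong
          (λ t → F (F ^[ i ] α) ⊕ (t ⊕ ⊝ (F ^[ i ] α))) ih ⟩
      F (F ^[ i ] α) ⊕ ((F ^[ i ] α ⊕ (y ⊕ ⊝ α)) ⊕ ⊝ (F ^[ i ] α)) ≡⟨ cong (F (F ^[ i ] α) ⊕_)
          (sym (diff-shift α (F ^[ i ] α) y)) ⟩
      F (F ^[ i ] α) ⊕ (y ⊕ ⊝ α)                                 ∎
      where
      open ≡-Reasoning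
      ih = rigid unc w i (<⇒≤ i<k)
      w′ : Within (F ^[ i ] α) (F ^[ i ] α ⊕ L) (F ^[ i ] y)
      w′ = subst (Within (F ^[ i ] α) (F ^[ i ] α ⊕ L)) (sym ih) (within-translate (F ^[ i ] α) w)

    image : ∀ {k α L} → UncutUntil k α L → ∀ {y} → Within α (α ⊕ L) y →
            ∀ i → i ≤ k → Within (F ^[ i ] α) (F ^[ i ] α ⊕ L) (F ^[ i ] y)
    image {k} {α} {L} unc w i i≤k =
      subst (Within (F ^[ i ] α) (F ^[ i ] α ⊕ L)) (sym (rigid unc w i i≤k))
          (within-translate (F ^[ i ] α) w)

    -- `Ψ` is controlled at the ends of the last image: there a new cut point enters with `Ψ` at
    -- most `Q`, and an old end gains at most `A` per step. The length, for which the bound is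
    -- wanted, is the same for all images.
    record Piece (x : Zd) (n : ℕ) : Set where
      field
        α L : Zd
        x∈ : Within α (α ⊕ L) x
        uncut : UncutUntil (suc n) α L
        Ψ-left : Ψ (F ^[ n ] α) ≤ Q + n * A
        Ψ-right : Ψ (F ^[ n ] α ⊕ L) ≤ Q + n * A

      0≺L : 0z ≺ L
      0≺L = ≺-shift (≼-≺-trans (proj₁ x∈) (proj₂ x∈)) (l α L)
        where
        l : ∀ x y → (x ⊕ y) ⊕ ⊝ x ≡ y ⊕ ⊝ 0z
        l = R.solve-∀ zd

      ΨL : Ψ L ≤ 2 * (Q + n * A)
      ΨL = begin
        Ψ L                                           ≡⟨ cong Ψ (l (F ^[ n ] α) L) ⟩
        Ψ ((F ^[ n ] α ⊕ L) ⊕ ⊝ (F ^[ n ] α))         ≤⟨ Ψ-⊖ (F ^[ n ] α ⊕ L) (F ^[ n ] α) ⟩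
        Ψ (F ^[ n ] α ⊕ L) + Ψ (F ^[ n ] α)           ≤⟨ +-mono-≤ Ψ-right (≤-trans Ψ-left (m≤m+n _ 0)) ⟩
        2 * (Q + n * A)                               ∎
        where
        open ≤-Reasoning
        l : ∀ x y → y ≡ (x ⊕ y) ⊕ ⊝ x
        l = R.solve-∀ zd

    private
      base-eq : ∀ a b → a ⊕ (b ⊕ ⊝ a) ≡ b
      base-eq = R.solve-∀ zd
      l₁ : ∀ y x L → y ⊕ L ≡ (x ⊕ L) ⊕ (y ⊕ ⊝ x)
      l₁ = R.solve-∀ zd

    F-Ψ-shift : ∀ n z y → Ψ z ≤ Q + n * A → Ψ (z ⊕ (F y ⊕ ⊝ y)) ≤ Q + suc n * A
    F-Ψ-shift n z y h = begin
      Ψ (z ⊕ (F y ⊕ ⊝ y))      ≤⟨ Ψ-⊕ z (F y ⊕ ⊝ y) ⟩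
      Ψ z + Ψ (F y ⊕ ⊝ y)      ≤⟨ +-mono-≤ h (F-Ψ y) ⟩
      Q + n * A + A            ≡⟨ l Q n A ⟩
      Q + suc n * A            ∎
      where
      open ≤-Reasoning
      l : ∀ q n a → q + n * a + a ≡ q + suc n * a
      l = ℕR.solve-∀

    -- The next image is cut around the orbit of `x`, and the shortening is carried back to time 0
    -- by the translation. Earlier images only shrink, so they stay uncut.
    extend : ∀ {x n} → Piece x n → Piece x (suc n)
    extend {x} {n} K
      with a′ , b′ , aa′ , b′b , w , Ψa′ , Ψb′ , unc ←
           cut P (λ z → Ψ z ≤ Q + suc n * A) (λ p → ≤-trans (ΨP p) (m≤m+n Q _))
             (image (Piece.uncut K) (Piece.x∈ K) (suc n) ≤-refl)
             (subst (λ z → Ψ z ≤ Q + suc n * A) (base-eq (F ^[ n ] Piece.α K) (F (F ^[ n ] Piece.α K)))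
               (F-Ψ-shift n (F ^[ n ] Piece.α K) (F ^[ n ] Piece.α K) (Piece.Ψ-left K)))
             (subst (λ z → Ψ z ≤ Q + suc n * A) (sym
                 (l₁ (F ^[ suc n ] Piece.α K) (F ^[ n ] Piece.α K) (Piece.L K)))
               (F-Ψ-shift n (F ^[ n ] Piece.α K ⊕ Piece.L K) (F ^[ n ] Piece.α K) (Piece.Ψ-right K)))
      = record
      { α = α′ ; L = L′
      ; x∈ = ≼-shift (proj₁ w) (trans (cong (_⊕ ⊝ a′) (rigid uncut (x∈) (suc n) ≤-refl)) (l₂ b α x a′))
           , ≺-shift (proj₂ w) (trans (cong (λ t → b′ ⊕ ⊝ t) (rigid uncut (x∈) (suc n) ≤-refl))
               (l₃ b α x a′ b′))
      ; uncut = λ i i<2+n → uncut′ i (m≤n⇒m<n∨m≡n (≤-pred i<2+n))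
      ; Ψ-left = subst (λ z → Ψ z ≤ Q + suc n * A) (sym top) Ψa′
      ; Ψ-right = subst (λ z → Ψ z ≤ Q + suc n * A) (sym (trans (cong (_⊕ L′) top) (base-eq a′ b′))) Ψb′ }
      where
      open Piece K
      b = F ^[ suc n ] α
      α′ = α ⊕ (a′ ⊕ ⊝ b)
      L′ = b′ ⊕ ⊝ a′
      l₂ : ∀ b α x a′ → (b ⊕ (x ⊕ ⊝ α)) ⊕ ⊝ a′ ≡ x ⊕ ⊝ (α ⊕ (a′ ⊕ ⊝ b))
      l₂ = R.solve-∀ zd
      l₃ : ∀ b α x a′ b′ → b′ ⊕ ⊝ (b ⊕ (x ⊕ ⊝ α)) ≡ (α ⊕ (a′ ⊕ ⊝ b) ⊕ (b′ ⊕ ⊝ a′)) ⊕ ⊝ x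
      l₃ = R.solve-∀ zd
      α′∈ : Within α (α ⊕ L) α′
      α′∈ = ≼-shift aa′ (l₄ α a′ b) , ≺-shift (≺-≼-trans (≼-≺-trans (proj₁ w) (proj₂ w)) b′b) (l₅ α a′ b L)
        where
        l₄ : ∀ α a′ b → a′ ⊕ ⊝ b ≡ (α ⊕ (a′ ⊕ ⊝ b)) ⊕ ⊝ α
        l₄ = R.solve-∀ zd
        l₅ : ∀ α a′ b L → (b ⊕ L) ⊕ ⊝ a′ ≡ (α ⊕ L) ⊕ ⊝ (α ⊕ (a′ ⊕ ⊝ b))
        l₅ = R.solve-∀ zd
      moved : ∀ i → i ≤ suc n → F ^[ i ] α′ ≡ F ^[ i ] α ⊕ (a′ ⊕ ⊝ b)
      moved i i≤ = trans (rigid uncut α′∈ i i≤) (cong (F ^[ i ] α ⊕_) (l₆ α (a′ ⊕ ⊝ b)))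
        where
        l₆ : ∀ α t → (α ⊕ t) ⊕ ⊝ α ≡ t
        l₆ = R.solve-∀ zd
      top : F ^[ suc n ] α′ ≡ a′
      top = trans (moved (suc n) ≤-refl) (base-eq b a′)
      uncut′ : ∀ i → i < suc n ⊎ i ≡ suc n → Uncut (F ^[ i ] α′) (F ^[ i ] α′ ⊕ L′)
      uncut′ i (inj₁ i<1+n) p (q , q′) = uncut i i<1+n p
        ( ≼-≺-trans (≼-shift aa′ (trans (l₇ (F ^[ i ] α) a′ b)
            (cong (_⊕ ⊝ (F ^[ i ] α)) (sym (moved i (<⇒≤ i<1+n)))))) q
        , ≺-≼-trans q′ (≼-shift b′b (trans (l₈ (F ^[ i ] α) a′ b b′ L)
            (cong (λ t → (F ^[ i ] α ⊕ L) ⊕ ⊝ (t ⊕ L′)) (sym (moved i (<⇒≤ i<1+n)))))) )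
        where
        l₇ : ∀ c a′ b → a′ ⊕ ⊝ b ≡ (c ⊕ (a′ ⊕ ⊝ b)) ⊕ ⊝ c
        l₇ = R.solve-∀ zd
        l₈ : ∀ c a′ b b′ L → (b ⊕ L) ⊕ ⊝ b′ ≡ (c ⊕ L) ⊕ ⊝ (c ⊕ (a′ ⊕ ⊝ b) ⊕ (b′ ⊕ ⊝ a′))
        l₈ = R.solve-∀ zd
      uncut′ i (inj₂ refl) = subst (λ t → Uncut t (t ⊕ L′)) (sym top)
          (subst (Uncut a′) (sym (base-eq a′ b′)) unc)

    piece : ∀ {x} → InJ x → ∀ n → Piece x n
    piece {x} x∈J zero with a , b , _ , _ , w , Ψa , Ψb , unc ← cut P (λ z → Ψ z ≤ Q) ΨP {u} {v} {x} x∈J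
        Ψu Ψv = record
      { α = a ; L = b ⊕ ⊝ a
      ; x∈ = subst (λ t → Within a t x) (sym (base-eq a b)) w
      ; uncut = λ { zero _ → subst (Uncut a) (sym (base-eq a b)) unc ; (suc i) (s≤s ()) }
      ; Ψ-left = ≤-trans Ψa (m≤m+n Q 0)
      ; Ψ-right = ≤-trans (≤-reflexive (cong Ψ (base-eq a b))) (≤-trans Ψb (m≤m+n Q 0)) }
    piece x∈J (suc n) = extend (piece x∈J n)

    NoReturn : Zd → ℕ → Set
    NoReturn x n = ∀ i → 1 ≤ i → i ≤ n → ¬ InJ (F ^[ i ] x)

    module _ {x α L} (x∈J : InJ x) (x∈ : Within α (α ⊕ L) x) where

      avoids : ∀ {k n} → UncutUntil k α L → NoReturn x n → ∀ {y} → Within α (α ⊕ L) y →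
               ∀ i → 1 ≤ i → i < k → i ≤ n → ¬ InJ (F ^[ i ] y)
      avoids unc noret w i 1≤i i<k i≤n y∈J =
        noret i 1≤i i≤n (J-uncut (unc i i<k) (image unc w i (<⇒≤ i<k)) (image unc x∈ i (<⇒≤ i<k)) y∈J)

      inside : ∀ {k} → UncutUntil (suc k) α L → ∀ {y} → Within α (α ⊕ L) y → InJ y
      inside unc w = J-uncut (unc 0 (s≤s z≤n)) x∈ w x∈J

      module _ {n} (unc : UncutUntil (suc n) α L) (noret : NoReturn x n) (0≺L : 0z ≺ L) where

        private
          α∈ : Within α (α ⊕ L) α
          α∈ = ≼-refl , ≺-shift 0≺L (l α L)
            where
            l : ∀ x y → y ⊕ ⊝ 0z ≡ (x ⊕ y) ⊕ ⊝ x
            l = R.solve-∀ zd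

          reach : ∀ i → i ≤ n → ∀ z → Within (F ^[ i ] α) (F ^[ i ] α ⊕ L) z →
                  Σ Zd λ y → Within α (α ⊕ L) y × F ^[ i ] y ≡ z
          reach i i≤n z w = α ⊕ (z ⊕ ⊝ a) , w′ ,
            trans (rigid unc w′ i (m≤n⇒m≤1+n i≤n)) (trans (cong (a ⊕_) (l₂ α (z ⊕ ⊝ a))) (base-eq a z))
            where
            a = F ^[ i ] α
            w′ = within-translate α w
            l₂ : ∀ α t → (α ⊕ t) ⊕ ⊝ α ≡ t
            l₂ = R.solve-∀ zd

        -- If two images overlap, the left end of one lies in the other. Cancelling `F ^[ i ]`
        -- leaves a point of the piece that is back in the piece, hence in the window, at time
        -- `j - i`; but the whole piece avoids the window along with `x`.
        apart : ∀ i j → i < j → j ≤ n →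
                F ^[ i ] α ⊕ L ≼ F ^[ j ] α ⊎ F ^[ j ] α ⊕ L ≼ F ^[ i ] α
        apart i j i<j j≤n with k , refl ← m≤n⇒∃[o]m+o≡n (<⇒≤ i<j) = go
          where
          1≤k : 1 ≤ k
          1≤k = +-cancelˡ-< i 0 k (subst (_< i + k) (sym (+-identityʳ i)) i<j)
          k≤n : k ≤ n
          k≤n = ≤-trans (m≤n+m k i) j≤n
          i≤n : i ≤ n
          i≤n = ≤-trans (m≤m+n i k) j≤n
          go : F ^[ i ] α ⊕ L ≼ F ^[ i + k ] α ⊎ F ^[ i + k ] α ⊕ L ≼ F ^[ i ] α
          go with ≺-≽-connex (F ^[ i + k ] α) (F ^[ i ] α ⊕ L) | ≺-≽-connex (F ^[ i ] α)
              (F ^[ i + k ] α ⊕ L)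
          ... | inj₂ h | _ = inj₁ h
          ... | inj₁ _ | inj₂ h = inj₂ h
          ... | inj₁ p | inj₁ q with ≺-≽-connex (F ^[ i + k ] α) (F ^[ i ] α)
          ...   | inj₂ ge with y , w , eq ← reach i i≤n (F ^[ i + k ] α) (ge , p) =
                  ⊥-elim (avoids unc noret α∈ k 1≤k (s≤s k≤n) k≤n
                    (subst InJ (F^-injective i (trans eq (^-+ F i k α))) (inside unc w)))
          ...   | inj₁ lt with y , w , eq ← reach (i + k) j≤n (F ^[ i ] α) (inj₁ lt , q) =
                  ⊥-elim (avoids unc noret w k 1≤k (s≤s k≤n) k≤n
                    (subst InJ (sym (F^-injective i (trans (sym (^-+ F i k y)) eq))) (inside unc α∈)))

        apart-images : ∀ (i j : Fin (suc n)) → i ≢ j →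
                       F ^[ toℕ i ] α ⊕ L ≼ F ^[ toℕ j ] α ⊎ F ^[ toℕ j ] α ⊕ L ≼ F ^[ toℕ i ] α
        apart-images i j i≢j with <-cmp (toℕ i) (toℕ j)
        ... | tri< i<j _ _ = apart (toℕ i) (toℕ j) i<j (≤-pred (Finₚ.toℕ<n j))
        ... | tri≈ _ eq _ = contradiction (Finₚ.toℕ-injective eq) i≢j
        ... | tri> _ _ j<i with apart (toℕ j) (toℕ i) j<i (≤-pred (Finₚ.toℕ<n i))
        ...   | inj₁ h = inj₂ h
        ...   | inj₂ h = inj₁ h

        packed : lo ⊕ n · L ≺ hi
        packed with i , h ← spread 0≺L n (λ i → F ^[ toℕ i ] α)
            (λ i → proj₁ (F^-within (toℕ i) (InJ⇒within (inside unc α∈)))) apart-images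
          = ≼-≺-trans h (proj₂ (F^-within (toℕ i) (InJ⇒within (inside unc α∈))))

    -- Expressed through the backward orbit of the cut point alone, without the piece, so that `p`
    -- determines the time `i`.
    FirstVisit : Fin (2 + m) → ℕ → Set
    FirstVisit p i = InJ (B ^[ i ] (P p)) × (∀ j → 1 ≤ j → j < i → ¬ InJ (B ^[ j ] (P p)))

    Cuts : Zd → Zd → ℕ → Set
    Cuts α L i = ∃ λ p → F ^[ i ] α ≺ P p × P p ≺ F ^[ i ] α ⊕ L

    cuts? : ∀ α L i → Dec (Cuts α L i)
    cuts? α L i = Finₚ.any? λ p → (F ^[ i ] α ≺? P p) ×-dec (P p ≺? (F ^[ i ] α ⊕ L))

    -- A piece around x left uncut until time n′ has n′ disjoint images, too many for its length.
    scale : ∀ {x} → InJ x → ∀ n n′ → n ≤ n′ → R * (2 * (2 * (Q + n * A)) + 2) ≤ n′ → NoReturn x n′ →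
            ∃₂ λ i p → n < i × i ≤ n′ × FirstVisit p i
    scale {x} x∈J n n′ n≤n′ big noret with piece x∈J n
    ... | K with first (cuts? (Piece.α K) (Piece.L K)) (suc n′)
    ...   | inj₁ none = contradiction (≼-trans hi≼ (⊕-monoʳ-≼ lo R≼n′L))
        (≺⇒⋡ (packed x∈J x∈ (λ i i<k p q → none i i<k (p , q)) noret 0≺L))
      where
      open Piece K
      -- `gap` makes `2 * (2 * (Q + n * A)) + 2` copies of `L` longer than 1, and `R` times as many
      -- at least as long as the domain.
      R≼n′L : nat R ≼ n′ · L
      R≼n′L = ≼-trans (subst₂ _≼_ (trans (·-nat R 1) (cong nat (*-identityʳ R))) (sym (·-* R _ L))
                         (·-mono-≼ R (inj₁ (gap 0≺L (+-monoˡ-≤ 2 (*-monoʳ-≤ 2 ΨL))))))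
                      (·-monoˡ-≼ big (inj₁ 0≺L))
    ...   | inj₂ (i , i<1+n′ , (p , lo≺ , ≺hi) , min) = i , p , n<i , ≤-pred i<1+n′ ,
            subst InJ (sym back₀) (J-uncut (uncut 0 (s≤s z≤n)) x∈ y∈ x∈J) ,
            λ { j 1≤j j<i j∈J → avoids x∈J x∈ before noret y∈ (i ∸ j) (pos j j<i) (less j 1≤j j<i)
                (≤-trans (<⇒≤ (less j 1≤j j<i)) (≤-pred i<1+n′))
                  (subst InJ (back j (<⇒≤ j<i)) j∈J) }
      where
      open Piece K
      before : UncutUntil i α L
      before j j<i q w = min j j<i (q , w)
      n<i : n < i
      n<i = ≰⇒> λ i≤n → uncut i (s≤s i≤n) p (lo≺ , ≺hi)
      -- The point of the piece that is carried onto the cut point. It is in the window with `x`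
      -- and, like `x`, outside it at the times strictly between, so read backwards from `P p` it is
      -- the first visit.
      y = α ⊕ (P p ⊕ ⊝ (F ^[ i ] α))
      y∈ : Within α (α ⊕ L) y
      y∈ = within-translate α (inj₁ lo≺ , ≺hi)
      Fy : F ^[ i ] y ≡ P p
      Fy = trans (rigid before y∈ i ≤-refl) (l (F ^[ i ] α) α (P p))
        where
        l : ∀ a α p → a ⊕ ((α ⊕ (p ⊕ ⊝ a)) ⊕ ⊝ α) ≡ p
        l = R.solve-∀ zd
      back₀ : B ^[ i ] (P p) ≡ y
      back₀ = trans (cong (B ^[ i ]_) (sym Fy)) (^-inverse BF i y)
      back : ∀ j → j ≤ i → B ^[ j ] (P p) ≡ F ^[ i ∸ j ] y
      back j j≤i = trans (cong (B ^[ j ]_)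
          (trans (sym Fy) (cong (λ t → F ^[ t ] y) (sym (m+[n∸m]≡n j≤i))))) (^-undo BF j (i ∸ j) y)
      pos : ∀ j → j < i → 1 ≤ i ∸ j
      pos j j<i = m<n⇒0<n∸m j<i
      less : ∀ j → 1 ≤ j → j < i → i ∸ j < i
      less (suc j) _ j<i = ∸-monoʳ-< (s≤s z≤n) (<⇒≤ j<i)

    growth-big : ∀ j → R * (2 * (2 * (Q + growth R A j * Q * A)) + 2) ≤ growth R A (suc j) * Q
    growth-big j = begin
      R * (2 * (2 * (Q + g * Q * A)) + 2)              ≤⟨ *-monoʳ-≤ R
          (+-monoʳ-≤ (2 * (2 * (Q + g * Q * A))) (*-monoʳ-≤ 2 1≤Q)) ⟩
      R * (2 * (2 * (Q + g * Q * A)) + 2 * Q)          ≡⟨ l R Q g A ⟩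
      R * (4 * (1 + g * A) + 2) * Q                    ≤⟨ *-monoˡ-≤ Q (m≤n+m _ g) ⟩
      (g + R * (4 * (1 + g * A) + 2)) * Q              ≡⟨ cong (_* Q) (growth-suc R A j) ⟨
      growth R A (suc j) * Q                           ∎
      where
      open ≤-Reasoning
      g = growth R A j
      l : ∀ r q g a → r * (2 * (2 * (q + g * q * a)) + 2 * q) ≡ r * (4 * (1 + g * a) + 2) * q
      l = ℕR.solve-∀

    -- There are `2 + m` cut points, so among `3 + m` stages two blame the same one.
    N : ℕ
    N = growth R A (3 + m) * Q

    recurrence : ∀ {x} → InJ x → ∃ λ i → 1 ≤ i × i ≤ N × InJ (F ^[ i ] x)
    recurrence {x} x∈J with first (λ i → within? u v (F ^[ suc i ] x)) N
    ... | inj₂ (i , i<N , h , _) = suc i , s≤s z≤n , i<N , h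
    ... | inj₁ none = ⊥-elim (clash (Finₚ.pigeonhole ≤-refl (λ j → proj₁ (proj₂ (event j)))))
      where
      noret : NoReturn x N
      noret (suc i) _ i<N = none i i<N
      event : ∀ (j : Fin (3 + m)) → ∃₂ λ i p → growth R A (toℕ j) * Q < i × i ≤ growth R A (suc (toℕ j))
          * Q × FirstVisit p i
      event j = scale x∈J (growth R A (toℕ j) * Q) (growth R A (suc (toℕ j)) * Q)
          (*-monoˡ-≤ Q (growth-mono R A (n≤1+n (toℕ j))))
        (growth-big (toℕ j)) (λ i 1≤i i≤ → noret i 1≤i
            (≤-trans i≤ (*-monoˡ-≤ Q (growth-mono R A (Finₚ.toℕ<n j)))))
      clash : ¬ _
      clash (j , j′ , j<j′ , same) with event j | event j′
      ... | i , p , n<i , i≤ , visit , _ | i′ , p′ , n′<i′ , _ , _ , none′ =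
        -- The earlier stage ends before the later one starts, so the common cut point meets the
        -- window backwards at `i < i′`, against the first visit at `i′`.
        none′ i (≤-trans (s≤s z≤n) n<i) (≤-<-trans i≤
            (≤-<-trans (*-monoˡ-≤ Q (growth-mono R A j<j′)) n′<i′))
          (subst (λ q → InJ (B ^[ i ] (P q))) same visit)

  -- Windows with simple endpoints

  floor : ∀ R {x} → 0z ≼ x → x ≺ nat R → ∃ λ k → k ≤ R × nat k ≼ x × x ⊕ ⊝ nat k ≺ nat 1
  floor zero 0≼x x≺0 = contradiction 0≼x (≺⇒⋡ x≺0)
  floor (suc R) {x} 0≼x x≺ with ≺-≽-connex x (nat R)
  ... | inj₁ lt with k , k≤R , k≼x , r ← floor R 0≼x lt = k , m≤n⇒m≤1+n k≤R , k≼x , r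
  ... | inj₂ ge = R , n≤1+n R , ge , ≺-shift x≺ (l (nat 1) (nat R) x)
    where
    l : ∀ a b x → (a ⊕ b) ⊕ ⊝ x ≡ a ⊕ ⊝ (x ⊕ ⊝ b)
    l = R.solve-∀ zd

  -- A stage of the subtractive Euclidean algorithm on (1 , √d). E and F majorise Ψ e and Ψ f;
  -- as e and f come from conjugates of opposite signs, F e + E f does not change.
  record Stage (R : ℕ) : Set where
    field
      e f : Zd
      E F : ℕ
      0≺e : 0z ≺ e
      0≺f : 0z ≺ f
      Ψe : Ψ e ≤ E
      Ψf : Ψ f ≤ F
      1≤E : 1 ≤ E
      1≤F : 1 ≤ F
      independent : re e ℤ.* im f ≢ im e ℤ.* re f
      weight : F · e ⊕ E · f ≡ (+ 1 +√ + 1)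
      approx : ∀ x → 0z ≼ x → x ≺ nat R →
               ∃ λ y → y ≼ x × (x ⊕ ⊝ y ≺ e ⊎ x ⊕ ⊝ y ≺ f) × Ψ y ≤ R + (E + F)

  start : ∀ R → Stage R
  start R = record
    { e = nat 1 ; f = + 0 +√ + 1 ; E = 1 ; F = 1 ; 0≺e = 0≺nat1 ; 0≺f = mk≺ (pp 0 1 refl (s≤s z≤n))
    ; Ψe = ≤-refl ; Ψf = ≤-refl ; 1≤E = ≤-refl ; 1≤F = ≤-refl ; independent = λ () ; weight = refl
    ; approx = λ x 0≼x x≺R → let k , k≤R , k≼x , r = floor R 0≼x x≺R in
        nat k , k≼x , inj₁ r , ≤-trans (≤-reflexive (Ψ-nat k)) (≤-trans k≤R (m≤m+n R 2)) }

  flip : ∀ {R} → Stage R → Stage R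
  flip {R} st = record
    { e = f ; f = e ; E = F ; F = E ; 0≺e = 0≺f ; 0≺f = 0≺e ; Ψe = Ψf ; Ψf = Ψe ; 1≤E = 1≤F ; 1≤F = 1≤E
    ; independent = λ eq → independent (trans (ℤₚ.*-comm (re e) (im f))
        (trans (sym eq) (ℤₚ.*-comm (re f) (im e))))
    ; weight = trans (⊕-comm (E · f) (F · e)) weight
    ; approx = λ x 0≼x x≺R → flip-approx (approx x 0≼x x≺R) }
    where
    open Stage st
    flip-approx : ∀ {x} → (∃ λ y → y ≼ x × (x ⊕ ⊝ y ≺ e ⊎ x ⊕ ⊝ y ≺ f) × Ψ y ≤ R + (E + F)) →
                  ∃ λ y → y ≼ x × (x ⊕ ⊝ y ≺ f ⊎ x ⊕ ⊝ y ≺ e) × Ψ y ≤ R + (F + E)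
    flip-approx (y , h , inj₁ p , Ψy) = y , h , inj₂ p , ≤-trans Ψy
        (≤-reflexive (cong (_+_ R) (+-comm E F)))
    flip-approx (y , h , inj₂ p , Ψy) = y , h , inj₁ p , ≤-trans Ψy
        (≤-reflexive (cong (_+_ R) (+-comm E F)))

  -- An approximant `y` at distance at least `f` is replaced by `y ⊕ f`, whose distance is below
  -- `e ⊖ f`. Its `Ψ` grows by at most `F`, exactly as `E + F` does.
  subtract : ∀ {R} (st : Stage R) (let open Stage st) → f ≺ e → Stage R
  subtract {R} st f≺e = record
    { e = e ⊕ ⊝ f ; f = f ; E = E + F ; F = F ; 0≺e = ≺⇒0≺ f≺e ; 0≺f = 0≺f
    ; Ψe = ≤-trans (Ψ-⊖ e f) (+-mono-≤ Ψe Ψf) ; Ψf = Ψf ; 1≤E = ≤-trans 1≤E (m≤m+n E F) ; 1≤F = 1≤F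
    ; independent = λ eq → independent (trans (det (re e) (re f) (im f))
        (trans (cong (ℤ._+ re f ℤ.* im f) eq) (sym (det′ (im e) (re f) (im f)))))
    ; weight = trans (cong₂ _+√_ (w (+ E) (+ F) (re e) (re f)) (w (+ E) (+ F) (im e) (im f))) weight
    ; approx = λ x 0≼x x≺R → refine x (approx x 0≼x x≺R) }
    where
    open Stage st
    det : ∀ a c g → a ℤ.* g ≡ (a ℤ.+ ℤ.- c) ℤ.* g ℤ.+ c ℤ.* g
    det = ℤR.solve-∀
    det′ : ∀ b c g → b ℤ.* c ≡ (b ℤ.+ ℤ.- g) ℤ.* c ℤ.+ c ℤ.* g
    det′ = ℤR.solve-∀
    w : ∀ E F a c → F ℤ.* (a ℤ.+ ℤ.- c) ℤ.+ (E ℤ.+ F) ℤ.* c ≡ F ℤ.* a ℤ.+ E ℤ.* c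
    w = ℤR.solve-∀
    l₁ : ∀ x y f → (x ⊕ ⊝ y) ⊕ ⊝ f ≡ x ⊕ ⊝ (y ⊕ f)
    l₁ = R.solve-∀ zd
    l₂ : ∀ x y e f → e ⊕ ⊝ (x ⊕ ⊝ y) ≡ (e ⊕ ⊝ f) ⊕ ⊝ (x ⊕ ⊝ (y ⊕ f))
    l₂ = R.solve-∀ zd
    more : ∀ {y} → Ψ y ≤ R + (E + F) → Ψ y ≤ R + (E + F + F)
    more h = ≤-trans h (+-monoʳ-≤ R (m≤m+n (E + F) F))
    refine : ∀ x → (∃ λ y → y ≼ x × (x ⊕ ⊝ y ≺ e ⊎ x ⊕ ⊝ y ≺ f) × Ψ y ≤ R + (E + F)) →
             ∃ λ y → y ≼ x × (x ⊕ ⊝ y ≺ e ⊕ ⊝ f ⊎ x ⊕ ⊝ y ≺ f) × Ψ y ≤ R + (E + F + F)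
    refine x (y , h , inj₂ p , Ψy) = y , h , inj₂ p , more {y} Ψy
    refine x (y , h , inj₁ p , Ψy) with ≺-≽-connex (x ⊕ ⊝ y) f
    ... | inj₁ lt = y , h , inj₂ lt , more {y} Ψy
    ... | inj₂ ge = y ⊕ f , ≼-shift ge (l₁ x y f) , inj₁ (≺-shift p (l₂ x y e f)) ,
          (begin
            Ψ (y ⊕ f)             ≤⟨ Ψ-⊕ y f ⟩
            Ψ y + Ψ f             ≤⟨ +-mono-≤ Ψy Ψf ⟩
            R + (E + F) + F       ≡⟨ +-assoc R (E + F) F ⟩
            R + (E + F + F)       ∎)
      where open ≤-Reasoning

  size : ∀ {R} → Stage R → ℕ
  size st = Stage.E st + Stage.F st

  -- The nonzero determinant excludes `e ≡ f`, so the algorithm never stops; the size gains one of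
  -- its own two summands, hence at most doubles.
  next : ∀ {R} (st : Stage R) → Σ (Stage R) λ st′ → size st < size st′ × size st′ ≤ 2 * size st
  next st with compare (Stage.e st) (Stage.f st)
  ... | inj₂ (inj₂ f≺e) = subtract st f≺e , m<m+n (E + F) 1≤F ,
        +-monoʳ-≤ (E + F) (≤-trans (m≤n+m F E) (m≤m+n (E + F) 0))
    where open Stage st
  ... | inj₁ e≺f = subtract (flip st) e≺f , subst (_< F + E + E) (+-comm F E) (m<m+n (F + E) 1≤E) ,
        subst (λ t → F + E + E ≤ 2 * t) (+-comm F E)
            (+-monoʳ-≤ (F + E) (≤-trans (m≤n+m E F) (m≤m+n (F + E) 0)))
    where open Stage st
  ... | inj₂ (inj₁ e≡f) = contradiction
      (subst (λ t → re t ℤ.* im f ≡ im t ℤ.* re f) (sym e≡f) (ℤₚ.*-comm (re f) (im f))) independent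
    where open Stage st

  -- Sizes at most double, so every scale is met up to a factor 2; the summand 2 is the size of the
  -- starting stage.
  reach-size : ∀ R W → Σ (Stage R) λ st → W ≤ size st × size st ≤ 2 * W + 2
  reach-size R zero = start R , z≤n , ≤-refl
  reach-size R (suc W) with reach-size R W
  ... | st , lower , upper with m≤n⇒m<n∨m≡n lower
  ...   | inj₁ lt = st , lt , ≤-trans upper (+-monoˡ-≤ 2 (*-monoʳ-≤ 2 (n≤1+n W)))
  ...   | inj₂ refl with st′ , more , less ← next st = st′ , more , ≤-trans less
      (≤-trans (*-monoʳ-≤ 2 (n≤1+n (size st))) (m≤m+n _ 2))

  module Quality (D : ℕ) (weight≼ : (+ 1 +√ + 1) ≼ nat D) where

    -- `(E + F) · (e ⊕ f)` is `E · e ⊕ E · f` plus its mirror image. There `E · f` is at most `D`,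
    -- and `E · e` at most `4 * D * D` because `e` is at most `4 * D` times `f`.
    size-bound : ℕ
    size-bound = (4 * D * D + D) + (D + 4 * D * D)

    module _ {R} (st : Stage R) where
      open Stage st

      private
        Fe≼ : F · e ≼ nat D
        Fe≼ = ≼-trans (subst (F · e ≼_) weight (≼-⊕ʳ (0≼· E (inj₁ 0≺f)))) weight≼

        Ef≼ : E · f ≼ nat D
        Ef≼ = ≼-trans (subst (E · f ≼_) (trans (⊕-comm (E · f) (F · e)) weight) (≼-⊕ʳ (0≼· F (inj₁ 0≺e))))
                weight≼

        -- e is at most a constant times f: F e is bounded, and F f is bounded below by the gap.
        e≼ : e ≼ (4 * D) · f
        e≼ = ·-cancel-≼ F 1≤F (≼-trans Fe≼ (subst₂ _≼_ (trans (·-nat D 1) (cong nat (*-identityʳ D))) eq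
               (·-mono-≼ D (inj₁ (gap {n = 4 * F} 0≺f 2Ψ+2≤)))))
          where
          2Ψ+2≤ : 2 * Ψ f + 2 ≤ 4 * F
          2Ψ+2≤ = ≤-trans (+-mono-≤ (*-monoʳ-≤ 2 Ψf) (*-monoʳ-≤ 2 1≤F)) (≤-reflexive (l F))
            where
            l : ∀ F → 2 * F + 2 * F ≡ 4 * F
            l = ℕR.solve-∀
          eq : D · (4 * F) · f ≡ F · (4 * D) · f
          eq = trans (sym (·-* D (4 * F) f)) (trans (cong (_· f) (l D F)) (·-* F (4 * D) f))
            where
            l : ∀ D F → D * (4 * F) ≡ F * (4 * D)
            l = ℕR.solve-∀

      Ee+Ef≼ : E · e ⊕ E · f ≼ nat (4 * D * D + D)
      Ee+Ef≼ = ≼-⊕ (≼-trans (·-mono-≼ E e≼) (subst₂ _≼_ (·-swap (4 * D) E f) (·-nat (4 * D) D)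
                  (·-mono-≼ (4 * D) Ef≼))) Ef≼

    quality : ∀ {R} (st : Stage R) (let open Stage st) → size st · (e ⊕ f) ≼ nat size-bound
    quality st = subst₂ _≼_ eq (cong nat (cong (_+_ (4 * D * D + D)) (+-comm (4 * D * D) D)))
                   (≼-⊕ (Ee+Ef≼ st) (Ee+Ef≼ (flip st)))
      where
      open Stage st
      eq : (E · e ⊕ E · f) ⊕ (F · f ⊕ F · e) ≡ (E + F) · (e ⊕ f)
      eq = cong₂ _+√_ (l (+ E) (+ F) (re e) (re f)) (l (+ E) (+ F) (im e) (im f))
        where
        l : ∀ E F a c → (E ℤ.* a ℤ.+ E ℤ.* c) ℤ.+ (F ℤ.* c ℤ.+ F ℤ.* a) ≡ (E ℤ.+ F) ℤ.* (a ℤ.+ c)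
        l = ℤR.solve-∀

  module Inscription (C : ℕ) (1≤C : 1 ≤ C)
      (quality : ∀ {R} (st : Stage R) → size st · (Stage.e st ⊕ Stage.f st) ≼ nat C)
    (R S : ℕ) where

    -- This bounds `Q · ε` for `Q = (S + R + 5) + 4 * W`, using `ε ≼ nat R` and
    -- `W · ε ≼ nat (R + 4 * C)`.
    inscribed-bound : ℕ
    inscribed-bound = (S + R + 5) * R + 4 * (R + 4 * C)

    -- Strict on the left only: this already puts the half-open inner window into the open interval
    -- that defines admissibility. `S ≤ Q` lets `Q` bound the singularities as well.
    Inscribed : Zd → Zd → Set
    Inscribed u v = Σ Zd λ u′ → Σ Zd λ v′ → Σ ℕ λ Q → u ≺ u′ × u′ ≺ v′ × v′ ≼ v × 1 ≤ Q × S ≤ Q ×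
                    Ψ u′ ≤ Q × Ψ v′ ≤ Q × Q · (v ⊕ ⊝ u) ≼ nat inscribed-bound

    -- The scale is the least `W` with `nat (4 * C) ≼ W · ε`. A stage of size at least `W` then has
    -- `e ⊕ f` at most a quarter of `ε`, while minimality keeps `W · ε` bounded.
    inscribe : ∀ {lo u v} → Ψ lo ≤ S → lo ≼ u → u ≺ v → v ≼ lo ⊕ nat R → Inscribed u v
    inscribe {lo} {u} {v} Ψlo lo≼u u≺v v≼ = go (first (λ W → nat (4 * C) ≼? W · ε) (suc W₀))
      where
      ε = v ⊕ ⊝ u
      0≺ε : 0z ≺ ε
      0≺ε = ≺⇒0≺ u≺v
      ε≼R : ε ≼ nat R
      ε≼R = ≼-shift (≼-⊕ v≼ lo≼u) (l lo u v (nat R))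
        where
        l : ∀ lo u v R → (lo ⊕ R ⊕ u) ⊕ ⊝ (v ⊕ lo) ≡ R ⊕ ⊝ (v ⊕ ⊝ u)
        l = R.solve-∀ zd
      n₀ = 2 * Ψ ε + 2
      W₀ = 4 * C * n₀
      W₀-big : nat (4 * C) ≼ W₀ · ε
      W₀-big = subst₂ _≼_ (trans (·-nat (4 * C) 1) (cong nat (*-identityʳ (4 * C))))
          (sym (·-* (4 * C) n₀ ε))
                 (·-mono-≼ (4 * C) (inj₁ (gap 0≺ε ≤-refl)))
      four : ∀ z → 4 · z ≡ z ⊕ z ⊕ z ⊕ z
      four z = cong₂ _+√_ (l (re z)) (l (im z))
        where
        l : ∀ a → + 4 ℤ.* a ≡ a ℤ.+ a ℤ.+ a ℤ.+ a
        l = ℤR.solve-∀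

      build : ∀ W → 1 ≤ W → nat (4 * C) ≼ W · ε → W · ε ≼ nat (R + 4 * C) → Inscribed u v
      build W 1≤W big small with st , lower , upper ← reach-size R W = construct
        where
        open Stage st
        h = e ⊕ f
        e≺h : e ≺ h
        e≺h = ≺-shift 0≺f (l e f)
          where
          l : ∀ e f → f ⊕ ⊝ 0z ≡ (e ⊕ f) ⊕ ⊝ e
          l = R.solve-∀ zd
        f≺h : f ≺ h
        f≺h = ≺-shift 0≺e (l e f)
          where
          l : ∀ e f → e ⊕ ⊝ 0z ≡ (e ⊕ f) ⊕ ⊝ f
          l = R.solve-∀ zd
        0≺h : 0z ≺ h
        0≺h = ≺-trans 0≺e e≺h
        4h≼ε : h ⊕ h ⊕ h ⊕ h ≼ ε
        4h≼ε = subst (_≼ ε) (four h) (·-cancel-≼ W 1≤W (≼-trans (≼-trans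
                 (subst (_≼ 4 · (E + F) · h) (·-swap 4 W h) (·-mono-≼ 4 (·-monoˡ-≼ lower (inj₁ 0≺h))))
                 (subst (4 · (E + F) · h ≼_) (·-nat 4 C) (·-mono-≼ 4 (quality st)))) big))
        -- Aiming at `u ⊕ h ⊕ h` leaves room on both sides: the approximant is less than `h` below
        -- it, so still beyond `u`, and adding `f` stays below `u` plus three times `h`. Subtracting
        -- `lo` moves the target into the range of `approx`.
        x = (u ⊕ h ⊕ h) ⊕ ⊝ lo
        0≼x : 0z ≼ x
        0≼x = ≼-shift (≼-⊕ lo≼u (inj₁ (≺-⊕ 0≺h 0≺h))) (l lo u h)
          where
          l : ∀ lo u h → (u ⊕ (h ⊕ h)) ⊕ ⊝ (lo ⊕ (0z ⊕ 0z)) ≡ ((u ⊕ h ⊕ h) ⊕ ⊝ lo) ⊕ ⊝ 0z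
          l = R.solve-∀ zd
        x≺R : x ≺ nat R
        x≺R = ≺-shift (≺-≼-⊕ (≺-⊕ 0≺h 0≺h) (≼-⊕ 4h≼ε v≼)) (l lo u v h (nat R))
          where
          l : ∀ lo u v h R → ((h ⊕ h) ⊕ ((v ⊕ ⊝ u) ⊕ (lo ⊕ R))) ⊕ ⊝ ((0z ⊕ 0z) ⊕ ((h ⊕ h ⊕ h ⊕ h) ⊕ v))
              ≡ R ⊕ ⊝ ((u ⊕ h ⊕ h) ⊕ ⊝ lo)
          l = R.solve-∀ zd
        construct : Inscribed u v
        construct with approx x 0≼x x≺R
        ... | y , y≼x , near , Ψy = lo ⊕ y , (lo ⊕ y) ⊕ f , Q , u≺u′ , u′≺v′ , inj₁ v′≺v , 1≤Q , S≤Q ,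
            Ψu′ , Ψv′ , Qε
          where
          -- `S` is for `lo`, `R + (2 * W + 2)` for `y`, and another `2 * W + 2` for `f`; together
          -- one less than `Q`.
          Q = (S + R + 5) + 4 * W
          near-h : x ⊕ ⊝ y ≺ h
          near-h = [ (λ p → ≺-trans p e≺h) , (λ p → ≺-trans p f≺h) ]′ near
          u≺u′ : u ≺ lo ⊕ y
          u≺u′ = ≺-shift (≺-⊕ near-h 0≺h) (l lo u h y)
            where
            l : ∀ lo u h y → (h ⊕ h) ⊕ ⊝ ((((u ⊕ h ⊕ h) ⊕ ⊝ lo) ⊕ ⊝ y) ⊕ 0z) ≡ (lo ⊕ y) ⊕ ⊝ u
            l = R.solve-∀ zd
          u′≺v′ : lo ⊕ y ≺ (lo ⊕ y) ⊕ f
          u′≺v′ = ≺-shift 0≺f (l (lo ⊕ y) f)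
            where
            l : ∀ a f → f ⊕ ⊝ 0z ≡ (a ⊕ f) ⊕ ⊝ a
            l = R.solve-∀ zd
          v′≺v : (lo ⊕ y) ⊕ f ≺ v
          v′≺v = ≺-shift (≺-≼-⊕ (≺-⊕ f≺h 0≺h) (≼-⊕ 4h≼ε y≼x)) (l lo u v h y f)
            where
            l : ∀ lo u v h y f → ((h ⊕ h) ⊕ ((v ⊕ ⊝ u) ⊕ ((u ⊕ h ⊕ h) ⊕ ⊝ lo))) ⊕ ⊝
                ((f ⊕ 0z) ⊕ ((h ⊕ h ⊕ h ⊕ h) ⊕ y)) ≡ v ⊕ ⊝ ((lo ⊕ y) ⊕ f)
            l = R.solve-∀ zd
          1≤Q : 1 ≤ Q
          1≤Q = ≤-trans (≤-trans (s≤s z≤n) (m≤n+m 5 (S + R))) (m≤m+n _ (4 * W))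
          S≤Q : S ≤ Q
          S≤Q = ≤-trans (≤-trans (m≤m+n S R) (m≤m+n (S + R) 5)) (m≤m+n _ (4 * W))
          Ψu₀ : Ψ (lo ⊕ y) ≤ S + (R + (2 * W + 2))
          Ψu₀ = ≤-trans (Ψ-⊕ lo y) (+-mono-≤ Ψlo (≤-trans Ψy (+-monoʳ-≤ R upper)))
          Ψv₀ : Ψ ((lo ⊕ y) ⊕ f) ≤ S + (R + (2 * W + 2)) + (2 * W + 2)
          Ψv₀ = ≤-trans (Ψ-⊕ (lo ⊕ y) f) (+-mono-≤ Ψu₀ (≤-trans Ψf (≤-trans (m≤n+m F E) upper)))
          total : S + (R + (2 * W + 2)) + (2 * W + 2) ≤ Q
          total = ≤-trans (n≤1+n _) (≤-reflexive (l S R W))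
            where
            l : ∀ S R W → suc (S + (R + (2 * W + 2)) + (2 * W + 2)) ≡ (S + R + 5) + 4 * W
            l = ℕR.solve-∀
          Ψu′ : Ψ (lo ⊕ y) ≤ Q
          Ψu′ = ≤-trans Ψu₀ (≤-trans (m≤m+n _ (2 * W + 2)) total)
          Ψv′ : Ψ ((lo ⊕ y) ⊕ f) ≤ Q
          Ψv′ = ≤-trans Ψv₀ total
          Qε : Q · ε ≼ nat inscribed-bound
          Qε = subst (_≼ nat inscribed-bound) (sym (·-+ (S + R + 5) (4 * W) ε))
                 (≼-⊕ (subst ((S + R + 5) · ε ≼_) (·-nat (S + R + 5) R) (·-mono-≼ (S + R + 5) ε≼R))
                      (subst₂ _≼_ (sym (·-* 4 W ε)) (·-nat 4 (R + 4 * C)) (·-mono-≼ 4 small)))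

      go : _ → Inscribed u v
      go (inj₁ none) = contradiction W₀-big (none W₀ ≤-refl)
      go (inj₂ (zero , _ , big , _)) = contradiction (subst (nat (4 * C) ≼_) (0-· ε) big)
          (≺⇒⋡ (≺-≼-trans 0≺nat1 (nat-mono-≼ (≤-trans 1≤C (m≤m+n C _)))))
      go (inj₂ (suc W , _ , big , min)) = build (suc W) (s≤s z≤n) big
        (subst (_≼ nat (R + 4 * C)) (sym (suc-· W ε)) (≼-⊕ ε≼R (inj₁ (⋠⇒≻ (min W ≤-refl)))))

  -- Minimality

  Differ : (Zd → Set) → Zd → Zd → Set
  Differ X x y = (X x × ¬ X y) ⊎ (¬ X x × X y)

  differ-nearby : ∀ {X} → (∀ x → Dec (X x)) → ∀ {θ} → 0z ≺ θ → ∀ n {a b} → a ≺ b → b ≼ a ⊕ n · θ →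
      Differ X a b →
                  ∃₂ λ x y → a ≼ x × y ≼ b × x ≺ y × y ≼ x ⊕ θ × Differ X x y
  differ-nearby X? {θ} 0≺θ zero {a} {b} a≺b b≼ _ = contradiction
      (subst (b ≼_) (trans (cong (a ⊕_) (0-· θ)) (l a)) b≼) (≺⇒⋡ a≺b)
    where
    l : ∀ a → a ⊕ 0z ≡ a
    l = R.solve-∀ zd
  differ-nearby {X} X? {θ} 0≺θ (suc n) {a} {b} a≺b b≼ diff with ≺-≽-connex (a ⊕ θ) b
  ... | inj₂ b≼a+θ = a , b , ≼-refl , ≼-refl , a≺b , b≼a+θ , diff
  ... | inj₁ c≺b = go diff (X? (a ⊕ θ))
    where
    l : ∀ a θ → θ ⊕ ⊝ 0z ≡ (a ⊕ θ) ⊕ ⊝ a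
    l = R.solve-∀ zd
    l′ : ∀ a θ t → a ⊕ (θ ⊕ t) ≡ (a ⊕ θ) ⊕ t
    l′ = R.solve-∀ zd
    a≺c : a ≺ a ⊕ θ
    a≺c = ≺-shift 0≺θ (l a θ)
    further : Differ X (a ⊕ θ) b → ∃₂ λ x y → a ≼ x × y ≼ b × x ≺ y × y ≼ x ⊕ θ × Differ X x y
    further diff with x , y , cx , rest ← differ-nearby X? 0≺θ n c≺b
        (subst (b ≼_) (trans (cong (a ⊕_) (suc-· n θ)) (l′ a θ (n · θ))) b≼) diff =
      x , y , ≼-trans (inj₁ a≺c) cx , rest
    here : Differ X a (a ⊕ θ) → ∃₂ λ x y → a ≼ x × y ≼ b × x ≺ y × y ≼ x ⊕ θ × Differ X x y
    here diff = a , a ⊕ θ , ≼-refl , inj₁ c≺b , a≺c , ≼-refl , diff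
    go : Differ X a b → Dec (X (a ⊕ θ)) → ∃₂ λ x y → a ≼ x × y ≼ b × x ≺ y × y ≼ x ⊕ θ × Differ X x y
    go (inj₁ (Xa , ¬Xb)) (yes Xc) = further (inj₁ (Xc , ¬Xb))
    go (inj₁ (Xa , ¬Xb)) (no ¬Xc) = here (inj₁ (Xa , ¬Xc))
    go (inj₂ (¬Xa , Xb)) (yes Xc) = here (inj₂ (¬Xa , Xc))
    go (inj₂ (¬Xa , Xb)) (no ¬Xc) = further (inj₂ (¬Xc , Xb))

  -- Substitute for a boundary point of a decidable set, which need not exist in ℤ[√d]; found by
  -- walking in steps of `θ` between a member and a non-member.
  record NearbyPair (X : Zd → Set) (lo hi θ : Zd) : Set where
    constructor nearby
    field
      x y : Zd
      x∈ : Within lo hi x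
      y∈ : Within lo hi y
      x≺y : x ≺ y
      y≼ : y ≼ x ⊕ θ
      differ : Differ X x y

  archimedean : ∀ {θ} → 0z ≺ θ → ∀ a b → ∃ λ n → b ≼ a ⊕ n · θ
  archimedean {θ} 0≺θ a b = M * n , ≼-shift (≼-trans (inj₁ (bounded (b ⊕ ⊝ a)))
      (subst₂ _≼_ (trans (·-nat M 1) (cong nat (*-identityʳ M))) (sym (·-* M n θ))
          (·-mono-≼ M (inj₁ (gap 0≺θ ≤-refl)))))
      (l a b ((M * n) · θ))
    where
    M = Ψ (b ⊕ ⊝ a) + suc (d * Ψ (b ⊕ ⊝ a))
    n = 2 * Ψ θ + 2
    l : ∀ a b t → t ⊕ ⊝ (b ⊕ ⊝ a) ≡ (a ⊕ t) ⊕ ⊝ b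
    l = R.solve-∀ zd

  ordered-pair : ∀ {X} → (∀ x → Dec (X x)) → ∀ {lo hi θ} → 0z ≺ θ → ∀ {a b} → Within lo hi a → Within lo
      hi b → a ≺ b → Differ X a b → NearbyPair X lo hi θ
  ordered-pair {X} X? {lo} {hi} {θ} 0≺θ {a} {b} a∈ b∈ a≺b diff
      with n , b≼ ← archimedean 0≺θ a b
      with x , y , a≼x , y≼b , x≺y , y≼ , diff′ ← differ-nearby X? 0≺θ n a≺b b≼ diff =
      nearby x y (≼-trans (proj₁ a∈) a≼x , ≺-trans (≺-≼-trans x≺y y≼b) (proj₂ b∈))
                 (≼-trans (proj₁ a∈) (≼-trans a≼x (inj₁ x≺y)) , ≼-≺-trans y≼b (proj₂ b∈)) x≺y y≼ diff′

  nearby-pair : ∀ {X} → (∀ x → Dec (X x)) → ∀ {lo hi θ} → 0z ≺ θ → ∀ {a b} → Within lo hi a → Within lo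
      hi b →
                X a → ¬ X b → NearbyPair X lo hi θ
  nearby-pair {X} X? {lo} {hi} {θ} 0≺θ {a} {b} a∈ b∈ Xa ¬Xb with compare a b
  ... | inj₁ a≺b = ordered-pair X? 0≺θ a∈ b∈ a≺b (inj₁ (Xa , ¬Xb))
  ... | inj₂ (inj₁ refl) = contradiction Xa ¬Xb
  ... | inj₂ (inj₂ b≺a) = ordered-pair X? 0≺θ b∈ a∈ b≺a (inj₂ (¬Xb , Xa))

  module Pairs {m} (E : Exchange m) where
    open Exchange E

    Crosses : Zd → Zd → ℕ → Set
    Crosses x y i = ∃ λ p → F ^[ i ] x ≺ sing p × sing p ≼ F ^[ i ] y

    crosses? : ∀ x y i → Dec (Crosses x y i)
    crosses? x y i = Finₚ.any? λ p → (F ^[ i ] x ≺? sing p) ×-dec (sing p ≼? F ^[ i ] y)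

    pair-rigid : ∀ {x y k} → (∀ i → i < k → ¬ Crosses x y i) → ∀ {w} → x ≼ w → w ≼ y →
                 ∀ i → i ≤ k → F ^[ i ] w ≡ F ^[ i ] x ⊕ (w ⊕ ⊝ x)
    pair-rigid {x} unc {w} x≼w w≼y zero _ = l x w
      where
      l : ∀ x w → w ≡ x ⊕ (w ⊕ ⊝ x)
      l = R.solve-∀ zd
    pair-rigid {x} {y} {k} unc {w} x≼w w≼y (suc i) i<k = begin
      F (F ^[ i ] w)                                ≡⟨ F-rigid
          (≼-shift x≼w (trans (l a x w) (cong (_⊕ ⊝ a) (sym ih))))
                                                         (λ { p (q , q′) → unc i i<k (p , q , ≼-trans q′
                                                             Fw≼Fy) }) ⟩
      F a ⊕ (F ^[ i ] w ⊕ ⊝ a)                      ≡⟨ cong (λ t → F a ⊕ (t ⊕ ⊝ a)) ih ⟩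
      F a ⊕ ((a ⊕ (w ⊕ ⊝ x)) ⊕ ⊝ a)                 ≡⟨ cong (F a ⊕_) (sym (l a x w)) ⟩
      F a ⊕ (w ⊕ ⊝ x)                               ∎
      where
      open ≡-Reasoning
      a = F ^[ i ] x
      l : ∀ a x w → w ⊕ ⊝ x ≡ (a ⊕ (w ⊕ ⊝ x)) ⊕ ⊝ a
      l = R.solve-∀ zd
      l′ : ∀ a x w y → y ⊕ ⊝ w ≡ (a ⊕ (y ⊕ ⊝ x)) ⊕ ⊝ (a ⊕ (w ⊕ ⊝ x))
      l′ = R.solve-∀ zd
      ih = pair-rigid unc x≼w w≼y i (<⇒≤ i<k)
      Fw≼Fy : F ^[ i ] w ≼ F ^[ i ] y
      Fw≼Fy = ≼-shift w≼y (trans (l′ a x w y) (cong₂ (λ s t → s ⊕ ⊝ t)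
                (sym (pair-rigid unc (≼-trans x≼w w≼y) ≼-refl i (<⇒≤ i<k))) (sym ih)))

    uncut⇒same-period : ∀ {x y} p → x ≺ y → (∀ i → i < p → ¬ Crosses x y i) →
                        (F ^[ p ] x ≡ x → F ^[ p ] y ≡ y) × (F ^[ p ] y ≡ y → F ^[ p ] x ≡ x)
    uncut⇒same-period {x} {y} p x≺y unc =
      (λ eq → trans rigid (trans (cong (_⊕ (y ⊕ ⊝ x)) eq) (l₁ x y))) ,
      (λ eq → trans (l₂ (F ^[ p ] x) x y) (trans (cong (_⊕ ⊝ (y ⊕ ⊝ x)) (trans (sym rigid) eq)) (l₃ x y)))
      where
      rigid = pair-rigid unc (inj₁ x≺y) ≼-refl p ≤-refl
      l₁ : ∀ x y → x ⊕ (y ⊕ ⊝ x) ≡ y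
      l₁ = R.solve-∀ zd
      l₂ : ∀ a x y → a ≡ (a ⊕ (y ⊕ ⊝ x)) ⊕ ⊝ (y ⊕ ⊝ x)
      l₂ = R.solve-∀ zd
      l₃ : ∀ x y → y ⊕ ⊝ (y ⊕ ⊝ x) ≡ x
      l₃ = R.solve-∀ zd

    record FirstCrossing (M : ℕ) (x y : Zd) : Set where
      constructor crossing
      field
        time : ℕ
        time< : time < M
        which : Fin m
        after : F ^[ time ] x ≺ sing which
        before : sing which ≼ F ^[ time ] y
        clear : ∀ j → j < time → ¬ Crosses x y j

    first-crossing : ∀ M {x y} → ¬ (∀ i → i < M → ¬ Crosses x y i) → FirstCrossing M x y
    first-crossing M {x} {y} h with first (crosses? x y) M
    ... | inj₁ none = contradiction none h
    ... | inj₂ (i , i<M , (p , a , b) , min) = crossing i i<M p a b min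

  Differ⇒¬same : ∀ {X x y} → Differ X x y → ¬ ((X x → X y) × (X y → X x))
  Differ⇒¬same (inj₁ (p , q)) (f , _) = q (f p)
  Differ⇒¬same (inj₂ (p , q)) (_ , g) = p (g q)

  Interior : Zd → Zd → Zd → Set
  Interior lo hi z = lo ≺ z × z ≺ hi

  -- Keane's condition. Only interior singularities are concerned, as the lists may also contain the
  -- ends of the domain. The time `k` may be 0: a singularity of the inverse must not be one of `F`
  -- either.
  Disconnected : ∀ {m} → Exchange m → Set
  Disconnected E = ∀ k p p′ → Interior lo hi (sing p) → Interior lo hi (sing′ p′) → F ^[ k ] (sing′ p′)
      ≢ sing p
    where open Exchange E

  module Connections {m} (E : Exchange m)
    (S : ℕ) (Ψsing : ∀ p → Ψ (Exchange.sing E p) ≤ S) (Ψsing′ : ∀ p → Ψ (Exchange.sing′ E p) ≤ S)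
    (no-connection : Disconnected E)
    (small : ∀ n → ∃ λ θ → 0z ≺ θ × n · θ ≼ nat 1) where

    open Exchange E
    open Pairs E
    module Back = Pairs (op E)

    -- The multiplier of the gap for `F ^[ i + i′ ] q′ ⊖ q`: fewer than `M + M` steps of `Ψ` at most
    -- `A`, and two singularities of `Ψ` at most `S`.
    tightness : ℕ → ℕ
    tightness M = 2 * ((M + M) * A + S + S) + 2

    -- A boundary that is swept over a singularity both by F and by B lies within the gap of a connection.
    no-double-crossing : ∀ {x y θ} M → tightness M · θ ≼ nat 1 → Within lo hi x → Within lo hi y → x ≺ y
        → y ≼ x ⊕ θ →
                         FirstCrossing M x y → Back.FirstCrossing M x y → ⊥
    no-double-crossing {x} {y} {θ} M tight x∈ y∈ x≺y y≼ (crossing i i<M p a b clear)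
        (Back.crossing i′ i′<M p′ a′ b′ clear′) =
      no-connection (i + i′) p p′
        (≼-≺-trans (proj₁ (F^-within i x∈)) a , ≼-≺-trans b (proj₂ (F^-within i y∈)))
        (≼-≺-trans (proj₁ (Exchange.F^-within (op E) i′ x∈)) a′ , ≼-≺-trans b′
            (proj₂ (Exchange.F^-within (op E) i′ y∈)))
        (trans (trans (^-+ F i i′ q′) (cong (F ^[ i ]_) F^q′)) same)
      where
      q = sing p
      q′ = sing′ p′
      bx = B ^[ i′ ] x
      -- The point between `x` and `y` that `B ^[ i′ ]` carries onto `q′`. Its image under
      -- `F ^[ i ]` lies with `q` in an interval of length at most `θ`, which makes them equal.
      w = x ⊕ (q′ ⊕ ⊝ bx)
      l₁ : ∀ x q′ bx → q′ ⊕ ⊝ bx ≡ (x ⊕ (q′ ⊕ ⊝ bx)) ⊕ ⊝ x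
      l₁ = R.solve-∀ zd
      l₂ : ∀ x y q′ bx → (bx ⊕ (y ⊕ ⊝ x)) ⊕ ⊝ q′ ≡ y ⊕ ⊝ (x ⊕ (q′ ⊕ ⊝ bx))
      l₂ = R.solve-∀ zd
      l₃ : ∀ x q′ bx → bx ⊕ ((x ⊕ (q′ ⊕ ⊝ bx)) ⊕ ⊝ x) ≡ q′
      l₃ = R.solve-∀ zd
      l₄ : ∀ x w y a → y ⊕ ⊝ w ≡ (a ⊕ (y ⊕ ⊝ x)) ⊕ ⊝ (a ⊕ (w ⊕ ⊝ x))
      l₄ = R.solve-∀ zd
      l₅ : ∀ x w a → w ⊕ ⊝ x ≡ (a ⊕ (w ⊕ ⊝ x)) ⊕ ⊝ a
      l₅ = R.solve-∀ zd
      By : B ^[ i′ ] y ≡ bx ⊕ (y ⊕ ⊝ x)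
      By = Back.pair-rigid clear′ (inj₁ x≺y) ≼-refl i′ ≤-refl
      x≼w : x ≼ w
      x≼w = inj₁ (≺-shift a′ (l₁ x q′ bx))
      w≼y : w ≼ y
      w≼y = ≼-shift (subst (q′ ≼_) By b′) (l₂ x y q′ bx)
      Bw : B ^[ i′ ] w ≡ q′
      Bw = trans (Back.pair-rigid clear′ x≼w w≼y i′ ≤-refl) (l₃ x q′ bx)
      F^q′ : F ^[ i′ ] q′ ≡ w
      F^q′ = trans (cong (F ^[ i′ ]_) (sym Bw)) (^-inverse FB i′ w)
      fx = F ^[ i ] x
      fw = F ^[ i ] w
      fy = F ^[ i ] y
      fw≡ : fw ≡ fx ⊕ (w ⊕ ⊝ x)
      fw≡ = pair-rigid clear x≼w w≼y i ≤-refl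
      fy≡ : fy ≡ fx ⊕ (y ⊕ ⊝ x)
      fy≡ = pair-rigid clear (inj₁ x≺y) ≼-refl i ≤-refl
      fx≼fw : fx ≼ fw
      fx≼fw = ≼-shift x≼w (trans (l₅ x w fx) (cong (_⊕ ⊝ fx) (sym fw≡)))
      fw≼fy : fw ≼ fy
      fw≼fy = ≼-shift w≼y (trans (l₄ x w y fx) (cong₂ (λ s t → s ⊕ ⊝ t) (sym fy≡) (sym fw≡)))
      fy≼ : fy ≼ fx ⊕ θ
      fy≼ = subst (_≼ fx ⊕ θ) (sym fy≡) (≼-shift y≼ (l₆ x y fx θ))
        where
        l₆ : ∀ x y fx θ → (x ⊕ θ) ⊕ ⊝ y ≡ (fx ⊕ θ) ⊕ ⊝ (fx ⊕ (y ⊕ ⊝ x))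
        l₆ = R.solve-∀ zd
      Ψdiff : 2 * Ψ (fw ⊕ ⊝ q) + 2 ≤ tightness M
      Ψdiff = +-monoˡ-≤ 2 (*-monoʳ-≤ 2 (begin
        Ψ (fw ⊕ ⊝ q)                                   ≤⟨ Ψ-⊖ fw q ⟩
        Ψ fw + Ψ q                                     ≡⟨ cong (λ t → Ψ t + Ψ q)
            (trans (sym (trans (^-+ F i i′ q′) (cong (F ^[ i ]_) F^q′))) (l₇ q′ (F ^[ i + i′ ] q′))) ⟩
        Ψ ((F ^[ i + i′ ] q′ ⊕ ⊝ q′) ⊕ q′) + Ψ q       ≤⟨ +-monoˡ-≤ (Ψ q)
            (Ψ-⊕ (F ^[ i + i′ ] q′ ⊕ ⊝ q′) q′) ⟩
        Ψ (F ^[ i + i′ ] q′ ⊕ ⊝ q′) + Ψ q′ + Ψ q       ≤⟨ +-mono-≤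
            (+-mono-≤ (F^-Ψ (i + i′) q′) (Ψsing′ p′)) (Ψsing p) ⟩
        (i + i′) * A + S + S                           ≤⟨ +-monoˡ-≤ S
            (+-monoˡ-≤ S (*-monoˡ-≤ A (+-mono-≤ (<⇒≤ i<M) (<⇒≤ i′<M)))) ⟩
        (M + M) * A + S + S                            ∎))
        where
        open ≤-Reasoning
        l₇ : ∀ q f → f ≡ (f ⊕ ⊝ q) ⊕ q
        l₇ = R.solve-∀ zd
      same : fw ≡ q
      same = close⇒≡ tight Ψdiff
        (≼-trans fw≼fy (≼-trans fy≼ (⊕-monoˡ-≼ θ (inj₁ a))))
        (≼-trans b (≼-trans fy≼ (⊕-monoˡ-≼ θ fx≼fw)))

    Periodic : ℕ → Zd → Set
    Periodic p x = F ^[ p ] x ≡ x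

    -- Having period `p` is all or nothing. Otherwise two close points differ in it, and a pair
    -- translated rigidly for `p` steps, by `F` or by `B`, cannot; so the pair is swept over
    -- singularities in both directions.
    aperiodic : ∀ {z₀} → Within lo hi z₀ → ∀ p → F ^[ p ] z₀ ≢ z₀ → ∀ {z} → Within lo hi z → F ^[ p ] z ≢ z
    aperiodic {z₀} z₀∈ p moves {z} z∈ per with θ , 0≺θ , tight ← small (tightness p)
      with nearby x y x∈ y∈ x≺y y≼ diff ← nearby-pair {Periodic p} (λ x → F ^[ p ] x ≡? x) 0≺θ z∈ z₀∈
          per moves =
      no-double-crossing p tight x∈ y∈ x≺y y≼
        (first-crossing p λ unc → Differ⇒¬same {Periodic p} diff (uncut⇒same-period p x≺y unc))
        (Back.first-crossing p λ unc → Differ⇒¬same {Periodic p} diff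
          (let f , g = Back.uncut⇒same-period p x≺y unc in (λ e → F-per (f (B-per e))) , (λ e → F-per (g (B-per e)))))
      where
      B-per : ∀ {x} → F ^[ p ] x ≡ x → B ^[ p ] x ≡ x
      B-per {x} e = trans (cong (B ^[ p ]_) (sym e)) (^-inverse BF p x)
      F-per : ∀ {x} → B ^[ p ] x ≡ x → F ^[ p ] x ≡ x
      F-per {x} e = trans (cong (F ^[ p ]_) (sym e)) (^-inverse FB p x)

  module Hitting {m} (E : Exchange m) (u v : Zd) (N : ℕ)
    (returns : ∀ {x} → Within u v x → ∃ λ i → 1 ≤ i × i ≤ N × Within u v (Exchange.F E ^[ i ] x))
    (returns′ : ∀ {x} → Within u v x → ∃ λ i → 1 ≤ i × i ≤ N × Within u v (Exchange.B E ^[ i ] x)) where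

    open Exchange E
    open Pairs E

    -- The bound `N` makes this decidable. As points of the window return within `N` both ways, it
    -- is also invariant, and its complement never enters the window at any positive time.
    Hits : Zd → Set
    Hits x = ∃ λ i → i < N × Within u v (F ^[ suc i ] x)

    hits? : ∀ x → Dec (Hits x)
    hits? x with first (λ i → within? u v (F ^[ suc i ] x)) N
    ... | inj₁ none = no λ (i , i<N , h) → none i i<N h
    ... | inj₂ (i , i<N , h , _) = yes (i , i<N , h)

    hits-forward : ∀ {x} → Hits x → Hits (F x)
    hits-forward {x} (zero , _ , h) with suc j , _ , j<N , h′ ← returns h = j , j<N , h′
    hits-forward {x} (suc i , i<N , h) = i , <⇒≤ i<N , subst (Within u v) (sym (^-comm F (suc i) x)) h

    hits-backward : ∀ {x} → Hits (F x) → Hits x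
    hits-backward {x} (i , i<N , h) with m≤n⇒m<n∨m≡n i<N
    ... | inj₁ 1+i<N = suc i , 1+i<N , subst (Within u v) (^-comm F (suc i) x) h
    -- Counted from `x` this visit is at time `suc N`, one too late; returning backwards from it
    -- gives an earlier one that is still at a positive time.
    ... | inj₂ refl with suc j , _ , j<N , h′ ← returns′ h =
      i ∸ j , s≤s (m∸n≤m i j) , subst (Within u v)
          (trans (cong (B ^[ suc j ]_) eq) (^-undo {F} {B} BF (suc j) (suc (i ∸ j)) x)) h′
      where
      eq : F ^[ suc i ] (F x) ≡ F ^[ suc j + suc (i ∸ j) ] x
      eq = trans (^-comm F (suc i) x) (cong (λ k → F ^[ suc k ] x)
             (sym (trans (+-suc j (i ∸ j)) (cong suc (m+[n∸m]≡n (≤-pred j<N))))))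

    hits-always : ∀ k {x} → Hits x → Hits (F ^[ k ] x)
    hits-always zero h = h
    hits-always (suc k) h = hits-forward (hits-always k h)

    hits-before : ∀ k {x} → Hits (F ^[ k ] x) → Hits x
    hits-before zero h = h
    hits-before (suc k) h = hits-before k (hits-backward h)

    -- By invariance the point `suc N` steps before `x` enters the window within `N` steps, that is,
    -- strictly before its orbit reaches `x`.
    hits⇒hits′ : ∀ {x} → Hits x → ∃ λ i → i < N × Within u v (B ^[ suc i ] x)
    hits⇒hits′ {x} h
      with i , i<N , w ← hits-before (suc N) (subst Hits (sym (^-inverse {B} {F} FB (suc N) x)) h) =
      N ∸ suc i , ≤-trans (≤-reflexive (sym (+-∸-assoc 1 i<N))) (m∸n≤m N i) , subst (Within u v) eq w
      where
      eq : F ^[ suc i ] (B ^[ suc N ] x) ≡ B ^[ suc (N ∸ suc i) ] x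
      eq = trans (cong (λ k → F ^[ suc i ] (B ^[ k ] x))
          (sym (trans (+-suc (suc i) (N ∸ suc i)) (cong suc (m+[n∸m]≡n i<N)))))
                 (^-undo {B} {F} FB (suc i) (suc (N ∸ suc i)) x)

    misses : ∀ {x} → ¬ Hits x → ∀ k → ¬ Within u v (F ^[ suc k ] x)
    misses ¬h k w = ¬h (hits-before k (0 , 0<N , w))
      where
      0<N : 0 < N
      0<N with i , 1≤i , i≤N , _ ← returns w = ≤-trans 1≤i i≤N

    -- While a boundary of Hits is not cut, its end that hits [u,v[ does so next to the same endpoint
    -- of [u,v[ every time, and two close points of one orbit give a period.
    uncut-boundary : ∀ {x y θ} → (2 * (N * A) + 2) · θ ≼ nat 1 → x ≺ y → y ≼ x ⊕ θ →
                     (∀ i → i < N + N → ¬ Crosses x y i) → Differ Hits x y →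
                     ∃₂ λ k p → 1 ≤ p × F ^[ p ] (F ^[ k ] y) ≡ F ^[ k ] y ⊎ 1 ≤ p × F ^[ p ]
                         (F ^[ k ] x) ≡ F ^[ k ] x
    uncut-boundary {x} {y} {θ} tight x≺y y≼ unc = go
      where
      l₁ : ∀ x y a → y ⊕ ⊝ x ≡ (a ⊕ (y ⊕ ⊝ x)) ⊕ ⊝ a
      l₁ = R.solve-∀ zd
      l₂ : ∀ x y a θ → (x ⊕ θ) ⊕ ⊝ y ≡ (a ⊕ θ) ⊕ ⊝ (a ⊕ (y ⊕ ⊝ x))
      l₂ = R.solve-∀ zd
      below : ∀ k → k ≤ N + N → F ^[ k ] x ≺ F ^[ k ] y
      below k k≤ = ≺-shift x≺y (trans (l₁ x y (F ^[ k ] x))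
          (cong (_⊕ ⊝ (F ^[ k ] x)) (sym (pair-rigid unc (inj₁ x≺y) ≼-refl k k≤))))
      close : ∀ k → k ≤ N + N → F ^[ k ] y ≼ F ^[ k ] x ⊕ θ
      close k k≤ = subst (_≼ F ^[ k ] x ⊕ θ) (sym (pair-rigid unc (inj₁ x≺y) ≼-refl k k≤))
          (≼-shift y≼ (l₂ x y (F ^[ k ] x) θ))
      same : ∀ z k → k ≤ N → z ≼ F ^[ k ] z ⊕ θ → F ^[ k ] z ≼ z ⊕ θ → F ^[ k ] z ≡ z
      same z k k≤N p q = close⇒≡ tight (+-monoˡ-≤ 2
          (*-monoʳ-≤ 2 (≤-trans (F^-Ψ k z) (*-monoˡ-≤ A k≤N)))) q p

      enter : ¬ Hits x → ∀ k → suc k ≤ N + N → Within u v (F ^[ suc k ] y) → u ≼ F ^[ suc k ] y × F ^[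
          suc k ] y ≼ u ⊕ θ
      enter ¬h k k≤ (u≼y , y≺v) = u≼y , ≼-trans (close (suc k) k≤) (⊕-monoˡ-≼ θ (inj₁ (⋠⇒≻ λ u≼x →
        misses ¬h k (u≼x , ≺-trans (below (suc k) k≤) y≺v))))
      leave : ¬ Hits y → ∀ k → suc k ≤ N + N → Within u v (F ^[ suc k ] x) → F ^[ suc k ] x ≼ v × v ≼ F
          ^[ suc k ] x ⊕ θ
      leave ¬h k k≤ (u≼x , x≺v) = inj₁ x≺v , ≼-trans
          (⊀⇒≽ (λ y≺v → misses ¬h k (≼-trans u≼x (inj₁ (below (suc k) k≤)) , y≺v))) (close (suc k) k≤)

      bound : ∀ {i j} → i < N → j < N → suc j + suc i ≤ N + N
      bound i<N j<N = +-mono-≤ j<N i<N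

      go : Differ Hits x y → _
      go (inj₂ (¬hx , hy)) with i , i<N , w ← hy with j , j<N , w′ ← hits-always (suc i) hy =
        suc i , suc j , inj₁ (s≤s z≤n , same (F ^[ suc i ] y) (suc j) j<N
          (≼-trans (proj₂ e) (⊕-monoˡ-≼ θ (proj₁ e′))) (≼-trans (proj₂ e′) (⊕-monoˡ-≼ θ (proj₁ e))))
        where
        e = enter ¬hx i (≤-trans i<N (m≤m+n N N)) w
        e′ : u ≼ F ^[ suc j ] (F ^[ suc i ] y) × F ^[ suc j ] (F ^[ suc i ] y) ≼ u ⊕ θ
        e′ = subst (λ t → u ≼ t × t ≼ u ⊕ θ) (^-+ F (suc j) (suc i) y)
               (enter ¬hx (j + suc i) (bound i<N j<N)
                   (subst (Within u v) (sym (^-+ F (suc j) (suc i) y)) w′))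
      go (inj₁ (hx , ¬hy)) with i , i<N , w ← hx with j , j<N , w′ ← hits-always (suc i) hx =
        suc i , suc j , inj₂ (s≤s z≤n , same (F ^[ suc i ] x) (suc j) j<N
          (≼-trans (proj₁ e) (proj₂ e′)) (≼-trans (proj₁ e′) (proj₂ e)))
        where
        e = leave ¬hy i (≤-trans i<N (m≤m+n N N)) w
        e′ : F ^[ suc j ] (F ^[ suc i ] x) ≼ v × v ≼ F ^[ suc j ] (F ^[ suc i ] x) ⊕ θ
        e′ = subst (λ t → t ≼ v × v ≼ t ⊕ θ) (^-+ F (suc j) (suc i) x)
               (leave ¬hy (j + suc i) (bound i<N j<N)
                   (subst (Within u v) (sym (^-+ F (suc j) (suc i) x)) w′))

    crosses-soon : (∀ {z} → Within lo hi z → ∀ p → 1 ≤ p → F ^[ p ] z ≢ z) →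
                   ∀ {x y θ} → Within lo hi x → Within lo hi y → (2 * (N * A) + 2) · θ ≼ nat 1 → x ≺ y →
                       y ≼ x ⊕ θ →
                   Differ Hits x y → FirstCrossing (N + N) x y
    crosses-soon aper x∈ y∈ tight x≺y y≼ diff = first-crossing (N + N) λ unc → clash
        (uncut-boundary tight x≺y y≼ unc diff)
      where
      clash : ¬ _
      clash (k , p , inj₁ (1≤p , eq)) = aper (F^-within k y∈) p 1≤p eq
      clash (k , p , inj₂ (1≤p , eq)) = aper (F^-within k x∈) p 1≤p eq

  module Minimality {m} (E : Exchange m)
    (S : ℕ) (Ψsing : ∀ p → Ψ (Exchange.sing E p) ≤ S) (Ψsing′ : ∀ p → Ψ (Exchange.sing′ E p) ≤ S)
    (no-connection : Disconnected E)
    (small : ∀ n → ∃ λ θ → 0z ≺ θ × n · θ ≼ nat 1)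
    (z₀ : Zd) (z₀∈ : Within (Exchange.lo E) (Exchange.hi E) z₀)
    (z₀-moves : ∀ p → 1 ≤ p → Exchange.F E ^[ p ] z₀ ≢ z₀)
    (u v : Zd) (u≺v : u ≺ v) (lo≼u : Exchange.lo E ≼ u) (v≼hi : v ≼ Exchange.hi E) (N : ℕ)
    (returns : ∀ {x} → Within u v x → ∃ λ i → 1 ≤ i × i ≤ N × Within u v (Exchange.F E ^[ i ] x))
    (returns′ : ∀ {x} → Within u v x → ∃ λ i → 1 ≤ i × i ≤ N × Within u v (Exchange.B E ^[ i ] x)) where

    open Exchange E
    open Connections E S Ψsing Ψsing′ no-connection small
    open Hitting E u v N returns returns′
    module Back′ = Hitting (op E) u v N returns′ returns

    never-periodic : ∀ {z} → Within lo hi z → ∀ p → 1 ≤ p → F ^[ p ] z ≢ z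
    never-periodic z∈ p 1≤p = aperiodic z₀∈ p (z₀-moves p 1≤p) z∈

    never-periodic′ : ∀ {z} → Within lo hi z → ∀ p → 1 ≤ p → B ^[ p ] z ≢ z
    never-periodic′ {z} z∈ p 1≤p e = never-periodic z∈ p 1≤p
        (trans (cong (F ^[ p ]_) (sym e)) (^-inverse FB p z))

    hits-u : Hits u
    hits-u with suc i , _ , i≤N , w ← returns {u} (≼-refl , u≺v) = i , i≤N , w

    -- Keane's argument sweeps one and the same pair both ways, so the pair must be a boundary for
    -- the backward hitting set too.
    differ′ : ∀ {x y} → Differ Hits x y → Differ Back′.Hits x y
    differ′ (inj₁ (p , q)) = inj₁ (hits⇒hits′ p , λ h → q (Back′.hits⇒hits′ h))
    differ′ (inj₂ (p , q)) = inj₂ ((λ h → p (Back′.hits⇒hits′ h)) , hits⇒hits′ q)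

    all-hit : ∀ {z} → Within lo hi z → Hits z
    all-hit {z} z∈ with hits? z
    ... | yes h = h
    -- One `θ` has to serve two purposes: forcing a crossing in each direction, and turning two
    -- crossings into a connection.
    ... | no ¬h with θ , 0≺θ , tight ← small (tightness (N + N) + (2 * (N * A) + 2))
      with nearby x y x∈ y∈ x≺y y≼ diff ← nearby-pair hits? 0≺θ (lo≼u , ≺-≼-trans u≺v v≼hi) z∈ hits-u ¬h =
      let tight′ = ≼-trans (·-monoˡ-≼ (m≤n+m (2 * (N * A) + 2) (tightness (N + N))) (inj₁ 0≺θ)) tight in
      ⊥-elim (no-double-crossing (N + N) (≼-trans (·-monoˡ-≼ (m≤m+n (tightness (N + N)) _) (inj₁ 0≺θ))
          tight) x∈ y∈ x≺y y≼
        (crosses-soon never-periodic x∈ y∈ tight′ x≺y y≼ diff)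
        (Back′.crosses-soon never-periodic′ x∈ y∈ tight′ x≺y y≼ (differ′ diff)))

  -- Piecewise translations along a tiling

  sumZ-cong : ∀ {n} {f g : Fin n → Zd} → (∀ i → f i ≡ g i) → sumZ f ≡ sumZ g
  sumZ-cong {zero} _ = refl
  sumZ-cong {suc n} h = cong₂ _⊕_ (h Fin.zero) (sumZ-cong (λ i → h (Fin.suc i)))

  sumZ-zero : ∀ {n} {f : Fin n → Zd} → (∀ i → f i ≡ 0z) → sumZ f ≡ 0z
  sumZ-zero {zero} _ = refl
  sumZ-zero {suc n} h = cong₂ _⊕_ (h Fin.zero) (sumZ-zero (λ i → h (Fin.suc i)))

  sumZ-⊕ : ∀ {n} (f g : Fin n → Zd) → sumZ (λ i → f i ⊕ g i) ≡ sumZ f ⊕ sumZ g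
  sumZ-⊕ {zero} f g = refl
  sumZ-⊕ {suc n} f g = trans (cong ((f Fin.zero ⊕ g Fin.zero) ⊕_)
      (sumZ-⊕ (λ i → f (Fin.suc i)) (λ i → g (Fin.suc i))))
    (l (f Fin.zero) (g Fin.zero) (sumZ (λ i → f (Fin.suc i))) (sumZ (λ i → g (Fin.suc i))))
    where
    l : ∀ a b x y → (a ⊕ b) ⊕ (x ⊕ y) ≡ (a ⊕ x) ⊕ (b ⊕ y)
    l = R.solve-∀ zd

  sumZ-single : ∀ {n} {f : Fin n → Zd} k → (∀ i → i ≢ k → f i ≡ 0z) → sumZ f ≡ f k
  sumZ-single {suc n} {f} Fin.zero h = trans
      (cong (f Fin.zero ⊕_) (sumZ-zero (λ i → h (Fin.suc i) λ ()))) (l (f Fin.zero))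
    where
    l : ∀ x → x ⊕ 0z ≡ x
    l = R.solve-∀ zd
  sumZ-single {suc n} {f} (Fin.suc k) h =
    trans (cong₂ _⊕_ (h Fin.zero λ ()) (sumZ-single {f = λ i → f (Fin.suc i)} k
        (λ i i≢k → h (Fin.suc i) (λ e → i≢k (Finₚ.suc-injective e)))))
      (l (f (Fin.suc k)))
    where
    l : ∀ x → 0z ⊕ x ≡ x
    l = R.solve-∀ zd

  total : ∀ {n} → (Fin n → ℕ) → ℕ
  total {zero} f = 0
  total {suc n} f = f Fin.zero + total (λ i → f (Fin.suc i))

  ≤-total-sum : ∀ {n} (f : Fin n → ℕ) i → f i ≤ total f
  ≤-total-sum f Fin.zero = m≤m+n _ _
  ≤-total-sum f (Fin.suc i) = ≤-trans (≤-total-sum (λ i → f (Fin.suc i)) i) (m≤n+m _ _)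

  module Tiles {s} (ℓ : Zd) (len : Fin s → Zd) (0≺len : ∀ i → 0z ≺ len i) (σ : Permutation′ s) where

    rank : Fin s → ℕ
    rank j = toℕ (σ ⟨$⟩ʳ j)

    -- Indexed by rank instead of by tile, so that the right end `r` is included as `G s`. At the
    -- ranks given by the identity and by `π` it computes to `γ` and `δ`.
    G : ℕ → Zd
    G t = ℓ ⊕ sumZ (λ j → if does (rank j ℕ.<? t) then len j else 0z)

    left : Fin s → Zd
    left i = G (rank i)

    r : Zd
    r = ℓ ⊕ sumZ len

    G-0 : G 0 ≡ ℓ
    G-0 = trans (cong (ℓ ⊕_) (sumZ-zero {s} {λ _ → 0z} (λ _ → refl))) (l ℓ)
      where
      l : ∀ x → x ⊕ 0z ≡ x
      l = R.solve-∀ zd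

    G-end : G s ≡ r
    G-end = cong (ℓ ⊕_) (sumZ-cong λ j → cong (if_then len j else 0z)
        (dec-true (rank j ℕ.<? s) (Finₚ.toℕ<n (σ ⟨$⟩ʳ j))))

    rank-injective : ∀ {i j} → rank i ≡ rank j → i ≡ j
    rank-injective {i} {j} eq = trans (sym (inverseˡ σ))
        (trans (cong (σ ⟨$⟩ˡ_) (Finₚ.toℕ-injective eq)) (inverseˡ σ))

    unrank : ∀ {t} → t < s → ∃ λ i → rank i ≡ t
    unrank t<s = σ ⟨$⟩ˡ fromℕ< t<s , trans (cong toℕ (inverseʳ σ)) (Finₚ.toℕ-fromℕ< t<s)

    right : ∀ i → G (suc (rank i)) ≡ left i ⊕ len i
    right i = trans (cong (ℓ ⊕_) (trans (sumZ-cong split)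
        (trans (sumZ-⊕ before only) (cong (sumZ before ⊕_)
        (trans (sumZ-single {f = only} i else0) only-i)))))
                (l ℓ (sumZ before) (len i))
      where
      l : ∀ a b c → a ⊕ (b ⊕ c) ≡ (a ⊕ b) ⊕ c
      l = R.solve-∀ zd
      l₁ : ∀ x → x ≡ x ⊕ 0z
      l₁ = R.solve-∀ zd
      l₂ : ∀ x → x ≡ 0z ⊕ x
      l₂ = R.solve-∀ zd
      before only : Fin s → Zd
      before j = if does (rank j ℕ.<? rank i) then len j else 0z
      only j = if does (rank j ℕ.≟ rank i) then len j else 0z
      only-i : only i ≡ len i
      only-i = cong (if_then len i else 0z) (dec-true (rank i ℕ.≟ rank i) refl)
      else0 : ∀ j → j ≢ i → only j ≡ 0z
      else0 j j≢i = cong (if_then len j else 0z)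
          (dec-false (rank j ℕ.≟ rank i) (λ e → j≢i (rank-injective e)))
      split : ∀ j → (if does (rank j ℕ.<? suc (rank i)) then len j else 0z) ≡ before j ⊕ only j
      split j with <-cmp (rank j) (rank i)
      ... | tri< lt ne _ = trans (cong (if_then len j else 0z)
          (dec-true (rank j ℕ.<? suc (rank i)) (m≤n⇒m≤1+n lt)))
            (trans (l₁ (len j)) (sym (cong₂ _⊕_ (cong (if_then len j else 0z)
                (dec-true (rank j ℕ.<? rank i) lt))
                                                 (cong (if_then len j else 0z) (dec-false
                                                     (rank j ℕ.≟ rank i) ne)))))
      ... | tri≈ nl eq _ = trans (cong (if_then len j else 0z)
          (dec-true (rank j ℕ.<? suc (rank i)) (s≤s (≤-reflexive eq))))
            (trans (l₂ (len j)) (sym (cong₂ _⊕_ (cong (if_then len j else 0z)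
                (dec-false (rank j ℕ.<? rank i) nl))
                                                 (cong (if_then len j else 0z) (dec-true
                                                     (rank j ℕ.≟ rank i) eq)))))
      ... | tri> nl ne gt = trans (cong (if_then len j else 0z)
          (dec-false (rank j ℕ.<? suc (rank i)) (λ h → <⇒≱ gt (≤-pred h))))
            (sym (cong₂ _⊕_ (cong (if_then len j else 0z) (dec-false (rank j ℕ.<? rank i) nl))
                            (cong (if_then len j else 0z) (dec-false (rank j ℕ.≟ rank i) ne))))

    left≺right : ∀ i → left i ≺ left i ⊕ len i
    left≺right i = ≺-shift (0≺len i) (l (left i) (len i))
      where
      l : ∀ a b → b ⊕ ⊝ 0z ≡ (a ⊕ b) ⊕ ⊝ a
      l = R.solve-∀ zd

    G-step : ∀ {t} → t < s → G t ≺ G (suc t)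
    G-step t<s with i , refl ← unrank t<s = subst (left i ≺_) (sym (right i)) (left≺right i)

    G-mono : ∀ {t t′} → t ≤ t′ → t′ ≤ s → G t ≼ G t′
    G-mono {t′ = zero} z≤n _ = ≼-refl
    G-mono {t} {suc t′} h t′<s with m≤n⇒m<n∨m≡n h
    ... | inj₁ lt = ≼-trans (G-mono (≤-pred lt) (<⇒≤ t′<s)) (inj₁ (G-step t′<s))
    ... | inj₂ refl = ≼-refl

    ℓ≼G : ∀ {t} → t ≤ s → ℓ ≼ G t
    ℓ≼G {t} h = subst (_≼ G t) G-0 (G-mono z≤n h)

    G≼r : ∀ {t} → t ≤ s → G t ≼ r
    G≼r {t} h = subst (G t ≼_) G-end (G-mono h ≤-refl)

    Tile : Fin s → Zd → Set
    Tile i = Within (left i) (left i ⊕ len i)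

    left-tile : ∀ i → Tile i (left i)
    left-tile i = ≼-refl , left≺right i

    tile⇒within : ∀ {i x} → Tile i x → Within ℓ r x
    tile⇒within {i} {x} (p , q) = ≼-trans (ℓ≼G (<⇒≤ i<s)) p , ≺-≼-trans (subst (x ≺_) (sym (right i)) q)
        (G≼r i<s)
      where i<s = Finₚ.toℕ<n (σ ⟨$⟩ʳ i)

    locate : ∀ {x} → Within ℓ r x → ∃ λ i → Tile i x
    locate {x} (ℓ≼x , x≺r) = go s ≤-refl (subst (x ≺_) (sym G-end) x≺r)
      where
      go : ∀ t → t ≤ s → x ≺ G t → ∃ λ i → Tile i x
      go zero _ x≺ = contradiction ℓ≼x (≺⇒⋡ (subst (x ≺_) G-0 x≺))
      go (suc t) t<s x≺ with ≺-≽-connex x (G t)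
      ... | inj₁ lt = go t (<⇒≤ t<s) lt
      ... | inj₂ ge with i , refl ← unrank t<s = i , ge , subst (x ≺_) (right i) x≺

    tile-unique : ∀ {i j x} → Tile i x → Tile j x → i ≡ j
    tile-unique {i} {j} {x} p q with <-cmp (rank i) (rank j)
    ... | tri≈ _ eq _ = rank-injective eq
    ... | tri< lt _ _ = contradiction (≼-trans (G-mono lt (<⇒≤ (Finₚ.toℕ<n (σ ⟨$⟩ʳ j)))) (proj₁ q))
                          (≺⇒⋡ (subst (x ≺_) (sym (right i)) (proj₂ p)))
    ... | tri> _ _ gt = contradiction (≼-trans (G-mono gt (<⇒≤ (Finₚ.toℕ<n (σ ⟨$⟩ʳ i)))) (proj₁ p))
                          (≺⇒⋡ (subst (x ≺_) (sym (right j)) (proj₂ q)))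

    -- Both ends of the domain are listed, since a translation extended by the identity may jump
    -- there.
    sing : Fin (suc s) → Zd
    sing p = G (toℕ p)

    sing-at : ∀ {t} → t ≤ s → ∃ λ p → sing p ≡ G t
    sing-at t≤s = fromℕ< (s≤s t≤s) , cong G (Finₚ.toℕ-fromℕ< (s≤s t≤s))

    -- Extending the piecewise translation by the identity makes it a total function.
    module Translate (a : Fin s → Zd) where

      abstract

        shift : ∀ x → Dec (Within ℓ r x) → Zd
        shift x (yes w) = x ⊕ a (proj₁ (locate w))
        shift x (no _) = x

        move : Zd → Zd
        move x = shift x (within? ℓ r x)

        move-tile : ∀ {i x} → Tile i x → move x ≡ x ⊕ a i
        move-tile {i} {x} t = go (within? ℓ r x)
          where
          go : ∀ w? → shift x w? ≡ x ⊕ a i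
          go (yes w) = cong (λ j → x ⊕ a j) (tile-unique (proj₂ (locate w)) t)
          go (no ¬w) = contradiction (tile⇒within t) ¬w

        move-outside : ∀ {x} → ¬ Within ℓ r x → move x ≡ x
        move-outside {x} ¬w = go (within? ℓ r x)
          where
          go : ∀ w? → shift x w? ≡ x
          go (yes w) = contradiction w ¬w
          go (no _) = refl

        move-Ψ : ∀ {A} → (∀ i → Ψ (a i) ≤ A) → ∀ x → Ψ (move x ⊕ ⊝ x) ≤ A
        move-Ψ {A} Ψa x = go (within? ℓ r x)
          where
          l₁ : ∀ x a → (x ⊕ a) ⊕ ⊝ x ≡ a
          l₁ = R.solve-∀ zd
          l₂ : ∀ x → x ⊕ ⊝ x ≡ 0z
          l₂ = R.solve-∀ zd
          go : ∀ w? → Ψ (shift x w? ⊕ ⊝ x) ≤ A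
          go (yes w) = ≤-trans (≤-reflexive (cong Ψ (l₁ x (a (proj₁ (locate w)))))) (Ψa _)
          go (no _) = ≤-trans (≤-reflexive (cong Ψ (l₂ x))) z≤n

      move-rigid : ∀ {x y} → x ≼ y → (∀ p → ¬ (x ≺ sing p × sing p ≼ y)) → move y ≡ move x ⊕ (y ⊕ ⊝ x)
      move-rigid {x} {y} x≼y clear with within? ℓ r x
      ... | yes w with i , x∈ ← locate w =
        trans (move-tile y∈) (trans (l x y (a i)) (cong (_⊕ (y ⊕ ⊝ x)) (sym (move-tile x∈))))
        where
        l : ∀ x y a → y ⊕ a ≡ (x ⊕ a) ⊕ (y ⊕ ⊝ x)
        l = R.solve-∀ zd
        p = sing-at (Finₚ.toℕ<n (σ ⟨$⟩ʳ i))
        y∈ : Tile i y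
        y∈ = ≼-trans (proj₁ x∈) x≼y , ⋠⇒≻ λ h →
               clear (proj₁ p) (subst (λ z → x ≺ z × z ≼ y) (sym (trans (proj₂ p) (right i)))
                   (proj₂ x∈ , h))
      ... | no ¬w = trans (move-outside ¬w′) (trans (l x y) (cong (_⊕ (y ⊕ ⊝ x)) (sym (move-outside ¬w))))
        where
        l : ∀ x y → y ≡ x ⊕ (y ⊕ ⊝ x)
        l = R.solve-∀ zd
        ¬w′ : ¬ Within ℓ r y
        ¬w′ (ℓ≼y , y≺r) with ≺-≽-connex x ℓ
        ... | inj₁ x≺ℓ = clear Fin.zero (subst (λ z → x ≺ z × z ≼ y) (sym G-0) (x≺ℓ , ℓ≼y))
        ... | inj₂ ℓ≼x = ¬w (ℓ≼x , ≼-≺-trans x≼y y≺r)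

  -- Interval exchange transformations

  module FromIET {s} (T : IET d s) where
    open IET T

    0≺len : ∀ i → 0z ≺ len i
    0≺len i = mk≺ (subst (Pos′ d) (l (len i)) (Pos⇒Pos′ (len i) (len-pos i)))
      where
      l : ∀ x → x ≡ x ⊕ ⊝ 0z
      l = R.solve-∀ zd

    module Dom = Tiles ℓ len 0≺len Perm.id
    module Im = Tiles ℓ len 0≺len π
    module Fwd = Dom.Translate α
    module Bwd = Im.Translate (λ i → ⊝ α i)

    open Fwd public using () renaming (move to F)
    open Bwd public using () renaming (move to B)

    private
      l₁ : ∀ γ δ x → x ⊕ ⊝ γ ≡ (x ⊕ (δ ⊕ ⊝ γ)) ⊕ ⊝ δ
      l₁ = R.solve-∀ zd
      l₂ : ∀ γ δ x e → (γ ⊕ e) ⊕ ⊝ x ≡ (δ ⊕ e) ⊕ ⊝ (x ⊕ (δ ⊕ ⊝ γ))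
      l₂ = R.solve-∀ zd
      l₃ : ∀ γ δ x → x ⊕ ⊝ δ ≡ (x ⊕ ⊝ (δ ⊕ ⊝ γ)) ⊕ ⊝ γ
      l₃ = R.solve-∀ zd
      l₄ : ∀ γ δ x e → (δ ⊕ e) ⊕ ⊝ x ≡ (γ ⊕ e) ⊕ ⊝ (x ⊕ ⊝ (δ ⊕ ⊝ γ))
      l₄ = R.solve-∀ zd
      l₅ : ∀ x a → (x ⊕ a) ⊕ ⊝ a ≡ x
      l₅ = R.solve-∀ zd
      l₆ : ∀ x a → (x ⊕ ⊝ a) ⊕ a ≡ x
      l₆ = R.solve-∀ zd

    to-image : ∀ {i x} → Dom.Tile i x → Im.Tile i (x ⊕ α i)
    to-image {i} {x} (p , q) = ≼-shift p (l₁ (γ i) (δ i) x) , ≺-shift q (l₂ (γ i) (δ i) x (len i))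

    from-image : ∀ {i x} → Im.Tile i x → Dom.Tile i (x ⊕ ⊝ α i)
    from-image {i} {x} (p , q) = ≼-shift p (l₃ (γ i) (δ i) x) , ≺-shift q (l₄ (γ i) (δ i) x (len i))

    BF-tile : ∀ {i x} → Dom.Tile i x → B (F x) ≡ x
    BF-tile {i} {x} t = trans (cong B (Fwd.move-tile t)) (trans (Bwd.move-tile (to-image t)) (l₅ x (α i)))

    FB-tile : ∀ {i x} → Im.Tile i x → F (B x) ≡ x
    FB-tile {i} {x} t = trans (cong F (Bwd.move-tile t)) (trans (Fwd.move-tile (from-image t)) (l₆ x (α i)))

    BF : ∀ x → B (F x) ≡ x
    BF x = by-cases (within? ℓ r x)
      where
      by-cases : Dec (Within ℓ r x) → B (F x) ≡ x
      by-cases (yes w) = BF-tile (proj₂ (Dom.locate w))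
      by-cases (no ¬w) = trans (cong B (Fwd.move-outside ¬w)) (Bwd.move-outside ¬w)

    FB : ∀ x → F (B x) ≡ x
    FB x = by-cases (within? ℓ r x)
      where
      by-cases : Dec (Within ℓ r x) → F (B x) ≡ x
      by-cases (yes w) = FB-tile (proj₂ (Im.locate w))
      by-cases (no ¬w) = trans (cong F (Bwd.move-outside ¬w)) (Fwd.move-outside ¬w)

    F-within : ∀ {x} → Within ℓ r x → Within ℓ r (F x)
    F-within w with i , t ← Dom.locate w = subst (Within ℓ r) (sym (Fwd.move-tile t))
        (Im.tile⇒within (to-image t))

    B-within : ∀ {x} → Within ℓ r x → Within ℓ r (B x)
    B-within w with i , t ← Im.locate w = subst (Within ℓ r) (sym (Bwd.move-tile t))
        (Dom.tile⇒within (from-image t))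

    max-α : ℕ
    max-α = total (λ i → Ψ (α i))

    exchange : Exchange (suc s)
    exchange = record
      { lo = ℓ ; hi = r ; F = F ; B = B ; BF = BF ; FB = FB ; F-within = F-within ; B-within = B-within
      ; A = max-α ; F-Ψ = Fwd.move-Ψ (≤-total-sum (λ i → Ψ (α i)))
      ; B-Ψ = Bwd.move-Ψ (λ i → ≤-trans (≤-reflexive (Ψ-⊝ (α i))) (≤-total-sum (λ i → Ψ (α i)) i))
      ; sing = Dom.sing ; sing′ = Im.sing ; F-rigid = Fwd.move-rigid ; B-rigid = Bwd.move-rigid }

    open Exchange exchange public using (F^-within; F^-Ψ; F^-injective)

    max-sing : ℕ
    max-sing = total (λ p → Ψ (Dom.sing p)) + total (λ p → Ψ (Im.sing p))

    Ψsing : ∀ p → Ψ (Dom.sing p) ≤ max-sing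
    Ψsing p = ≤-trans (≤-total-sum (λ p → Ψ (Dom.sing p)) p) (m≤m+n _ _)

    Ψsing′ : ∀ p → Ψ (Im.sing p) ≤ max-sing
    Ψsing′ p = ≤-trans (≤-total-sum (λ p → Ψ (Im.sing p)) p) (m≤n+m _ (total (λ p → Ψ (Dom.sing p))))

    Ψ-G : ∀ {t} → t ≤ s → Ψ (Dom.G t) ≤ max-sing
    Ψ-G t≤s with p , eq ← Dom.sing-at t≤s = subst (λ z → Ψ z ≤ max-sing) eq (Ψsing p)

    Ψγ : ∀ i → Ψ (γ i) ≤ max-sing
    Ψγ i = Ψ-G (<⇒≤ (Finₚ.toℕ<n i))

    Ψr : Ψ r ≤ max-sing
    Ψr = subst (λ z → Ψ z ≤ max-sing) Dom.G-end (Ψ-G ≤-refl)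

    Ψℓ : Ψ ℓ ≤ max-sing
    Ψℓ = subst (λ z → Ψ z ≤ max-sing) Dom.G-0 (Ψ-G z≤n)

    width : ℕ
    width = Ψ (r ⊕ ⊝ ℓ) + suc (d * Ψ (r ⊕ ⊝ ℓ))

    r≼ : r ≼ ℓ ⊕ nat width
    r≼ = inj₁ (≺-shift (bounded (r ⊕ ⊝ ℓ)) (l r ℓ (nat width)))
      where
      l : ∀ r ℓ w → w ⊕ ⊝ (r ⊕ ⊝ ℓ) ≡ (ℓ ⊕ w) ⊕ ⊝ r
      l = R.solve-∀ zd

    γ-within : ∀ i → Within ℓ r (γ i)
    γ-within i = Dom.tile⇒within (Dom.left-tile i)

    step⇒F : ∀ {z w} → Step z w → w ≡ F z
    step⇒F (i , p , q , refl) = sym (Fwd.move-tile (≤⇒≼ p , <⇒≺ q))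

    F⇒step : ∀ {z} → Within ℓ r z → Step z (F z)
    F⇒step w with i , t ← Dom.locate w = i , ≼⇒≤ (proj₁ t) , ≺⇒< (proj₂ t) , Fwd.move-tile t

    iter⇒F^ : ∀ {n z w} → Iter n z w → w ≡ F ^[ n ] z
    iter⇒F^ iter-zero = refl
    iter⇒F^ (iter-suc it st) = trans (step⇒F st) (cong F (iter⇒F^ it))

    F^⇒iter : ∀ n {z} → Within ℓ r z → Iter n z (F ^[ n ] z)
    F^⇒iter zero w = iter-zero
    F^⇒iter (suc n) w = iter-suc (F^⇒iter n w) (F⇒step (F^-within n w))

    iterInv⇒B^ : ∀ {n z w} → IterInv n z w → w ≡ B ^[ n ] z
    iterInv⇒B^ inv-zero = refl
    iterInv⇒B^ (inv-suc {w = w} it st) = trans (sym (BF w))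
        (cong B (trans (sym (step⇒F st)) (iterInv⇒B^ it)))

    B^⇒iterInv : ∀ n {z} → Within ℓ r z → IterInv n z (B ^[ n ] z)
    B^⇒iterInv zero w = inv-zero
    B^⇒iterInv (suc n) {z} w = inv-suc (B^⇒iterInv n w)
      (subst (Step (B y)) (FB y) (F⇒step (B-within (Exchange.F^-within (op exchange) n w))))
      where y = B ^[ n ] z

    periodic⇒finite-orbit : ∀ {z p} → F ^[ suc p ] z ≡ z → Σ (List Zd) λ xs → ∀ n w → Orbit n z w → w ∈ xs
    periodic⇒finite-orbit {z} {p} per = applyUpTo (λ k → F ^[ k ] z) (suc p) , λ
      { (+ n) w o → member (forward o) ; -[1+ n ] w o → member (backward o) }
      where
      OnCycle : Zd → Set
      OnCycle w = ∃ λ k → k < suc p × w ≡ F ^[ k ] z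
      member : ∀ {w} → OnCycle w → w ∈ applyUpTo (λ k → F ^[ k ] z) (suc p)
      member (k , k<p , refl) = ∈-applyUpTo⁺ (λ k → F ^[ k ] z) k<p
      forward : ∀ {n w} → Iter n z w → OnCycle w
      forward iter-zero = 0 , s≤s z≤n , refl
      forward (iter-suc it st) with k , k<p , eq ← forward it with m≤n⇒m<n∨m≡n k<p
      ... | inj₁ lt = suc k , lt , trans (step⇒F st) (cong F eq)
      ... | inj₂ refl = 0 , s≤s z≤n , trans (step⇒F st) (trans (cong F eq) per)
      backward : ∀ {n w} → IterInv n z w → OnCycle w
      backward inv-zero = 0 , s≤s z≤n , refl
      backward (inv-suc {w = w} it st) with backward it
      ... | suc k , k<p , eq = k , <⇒≤ k<p , F^-injective 1 (trans (sym (step⇒F st)) eq)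
      ... | zero , _ , eq = p , ≤-refl , F^-injective 1 (trans (sym (step⇒F st)) (trans eq (sym per)))

    module _ (regular : Regular) where

      no-return : ∀ {i} → 1 ≤ toℕ i → ∀ p → 1 ≤ p → F ^[ p ] (γ i) ≢ γ i
      no-return {i} 1≤i (suc p) _ per = proj₁ regular i 1≤i (periodic⇒finite-orbit {p = p} per)

      no-meeting : ∀ {i j} → 1 ≤ toℕ i → 1 ≤ toℕ j → ∀ n → 1 ≤ n → F ^[ n ] (γ i) ≢ γ j
      no-meeting {i} {j} 1≤i 1≤j n 1≤n eq with i Finₚ.≟ j
      ... | yes refl = no-return 1≤i n 1≤n eq
      ... | no i≢j = proj₂ regular i j 1≤i 1≤j i≢j (+ n) (+ 0) (γ j)
          (subst (Iter n (γ i)) eq (F^⇒iter n (γ-within i)) , iter-zero)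

      Fγ : ∀ i → F (γ i) ≡ δ i
      Fγ i = trans (Fwd.move-tile (Dom.left-tile i)) (l (γ i) (δ i))
        where
        l : ∀ γ δ → γ ⊕ (δ ⊕ ⊝ γ) ≡ δ
        l = R.solve-∀ zd

      γ≡ℓ : ∀ {i} → toℕ i ≡ 0 → γ i ≡ ℓ
      γ≡ℓ eq = trans (cong Dom.G eq) Dom.G-0

      -- ℓ is not a separation point that Regular speaks about, but when T moves ℓ it is the image of one.
      no-connection-δ : ∀ k {i j} → ℓ ≺ δ i → 1 ≤ toℕ j → F ^[ k ] (δ i) ≢ γ j
      no-connection-δ k {i} {j} ℓ≺δ 1≤j eq with toℕ i in eqi
      ... | suc _ = no-meeting (subst (1 ≤_) (sym eqi) (s≤s z≤n)) 1≤j (suc k) (s≤s z≤n)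
            (trans (sym (^-comm F k (γ i))) (trans (cong (F ^[ k ]_) (Fγ i)) eq))
      ... | zero with h , rank-h ← Im.unrank (≤-trans (s≤s z≤n) (Finₚ.toℕ<n i)) =
            no-meeting (n≢0⇒n>0 h≢0) 1≤j (suc (suc k)) (s≤s z≤n)
              (trans (sym (^-comm F (suc k) (γ h))) (trans (sym (^-comm F k (F (γ h))))
                (trans (cong (λ t → F ^[ k ] (F t)) Fγh) (trans (cong (F ^[ k ]_) (Fγ i)) eq))))
        where
        δh : δ h ≡ ℓ
        δh = trans (cong Im.G rank-h) Im.G-0
        Fγh : F (γ h) ≡ γ i
        Fγh = trans (Fγ h) (trans δh (sym (γ≡ℓ eqi)))
        h≢0 : toℕ h ≢ 0
        h≢0 e with refl ← Finₚ.toℕ-injective (trans e (sym eqi)) = ≺-irrefl (subst (ℓ ≺_) δh ℓ≺δ)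

      no-connection : Disconnected exchange
      no-connection k p p′ (ℓ≺p , p≺r) (ℓ≺p′ , p′≺r) eq
        with i , rank-i ← Dom.unrank (≤∧≢⇒< (≤-pred (Finₚ.toℕ<n p))
            (λ e → ≺-irrefl (subst (_≺ r) (trans (cong Dom.G e) Dom.G-end) p≺r)))
        with j , rank-j ← Im.unrank (≤∧≢⇒< (≤-pred (Finₚ.toℕ<n p′))
            (λ e → ≺-irrefl (subst (_≺ r) (trans (cong Im.G e) Im.G-end) p′≺r))) =
        no-connection-δ k {j} {i} (subst (ℓ ≺_) (sym δj) ℓ≺p′)
          (n≢0⇒n>0 (λ e → ≺-irrefl (subst (ℓ ≺_) (trans (sym γi) (γ≡ℓ e)) ℓ≺p)))
          (trans (cong (F ^[ k ]_) δj) (trans eq (sym γi)))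
        where
        γi : γ i ≡ Dom.sing p
        γi = cong Dom.G rank-i
        δj : δ j ≡ Im.sing p′
        δj = cong Im.G rank-j

    Orbits-bounded : ℕ → Zd → Zd → Set
    Orbits-bounded K u v = ∀ {w} → InDiv u v w → Ψ w ≤ K

    Ψ-admissible : ∀ {K u v} → max-sing ≤ K → Orbits-bounded K u v → Admissible u v → ΨJ u v ≤ K
    Ψ-admissible {K} {u} {v} S≤K bound (_ , _ , _ , du , dv) = ⊔-lub (endpoint du) (endpoint dv)
      where
      endpoint : ∀ {w} → InDiv u v w ⊎ w ≡ r → Ψ w ≤ K
      endpoint (inj₁ h) = bound h
      endpoint (inj₂ refl) = ≤-trans Ψr S≤K

    Ψ-iterate : ∀ {k N} i → k ≤ N → Ψ (F ^[ k ] (γ i)) ≤ max-sing + N * max-α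
    Ψ-iterate {k} {N} i k≤N = begin
      Ψ (F ^[ k ] (γ i))                        ≡⟨ cong Ψ (l (γ i) (F ^[ k ] (γ i))) ⟩
      Ψ (γ i ⊕ (F ^[ k ] (γ i) ⊕ ⊝ γ i))        ≤⟨ Ψ-⊕ (γ i) (F ^[ k ] (γ i) ⊕ ⊝ γ i) ⟩
      Ψ (γ i) + Ψ (F ^[ k ] (γ i) ⊕ ⊝ γ i)      ≤⟨ +-mono-≤ (Ψγ i)
          (≤-trans (F^-Ψ k (γ i)) (*-monoˡ-≤ max-α k≤N)) ⟩
      max-sing + N * max-α                      ∎
      where
      open ≤-Reasoning
      l : ∀ g f → f ≡ g ⊕ (f ⊕ ⊝ g)
      l = R.solve-∀ zd

    Ψ-iterate′ : ∀ {k N} i → k ≤ N → Ψ (B ^[ k ] (γ i)) ≤ max-sing + N * max-α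
    Ψ-iterate′ {k} {N} i k≤N = begin
      Ψ (B ^[ k ] (γ i))                        ≡⟨ cong Ψ (l (γ i) (B ^[ k ] (γ i))) ⟩
      Ψ (γ i ⊕ (B ^[ k ] (γ i) ⊕ ⊝ γ i))        ≤⟨ Ψ-⊕ (γ i) (B ^[ k ] (γ i) ⊕ ⊝ γ i) ⟩
      Ψ (γ i) + Ψ (B ^[ k ] (γ i) ⊕ ⊝ γ i)      ≤⟨ +-mono-≤ (Ψγ i)
          (≤-trans (Exchange.F^-Ψ (op exchange) k (γ i)) (*-monoˡ-≤ max-α k≤N)) ⟩
      max-sing + N * max-α                      ∎
      where
      open ≤-Reasoning
      l : ∀ g f → f ≡ g ⊕ (f ⊕ ⊝ g)
      l = R.solve-∀ zd

    -- A point of Div is reached from some `γ i` without an earlier visit to the open interval,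
    -- which contains the inner window; so it is at most `N` steps away.
    visits⇒bounded : ∀ {u v u′ v′ N} → u ≺ u′ → v′ ≼ v →
      (∀ {z} → Within ℓ r z → ∃ λ n → n < N × Within u′ v′ (F ^[ suc n ] z)) →
      (∀ {z} → Within ℓ r z → ∃ λ n → n < N × Within u′ v′ (B ^[ suc n ] z)) →
      Orbits-bounded (max-sing + N * max-α) u v
    visits⇒bounded {u} {v} {u′} {v′} {N} u≺u′ v′≼v fwd bwd = bound
      where
      open-window : ∀ {y} → Within u′ v′ y → InOpen u v y
      open-window {y} (p , q) = ≺⇒< {u} {y} (≺-≼-trans u≺u′ p) , ≺⇒< {y} {v} (≺-≼-trans q v′≼v)
      early : ∀ {z k} → Within ℓ r z → (∀ n y → 1 ≤ n → n ≤ k → Iter n z y → ¬ InOpen u v y) → k ≤ N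
      early {z} {k} w avoid = let n , n<N , h = fwd w in ≮⇒≥ λ N<k →
        avoid (suc n) (F ^[ suc n ] z) (s≤s z≤n) (≤-trans n<N (<⇒≤ N<k)) (F^⇒iter (suc n) w) (open-window h)
      early′ : ∀ {z k} → Within ℓ r z → (∀ n y → n < k → IterInv n z y → ¬ InOpen u v y) → k ≤ N
      early′ {z} {k} w avoid = let n , n<N , h = bwd w in ≮⇒≥ λ N<k →
        avoid (suc n) (B ^[ suc n ] z) (≤-<-trans n<N N<k) (B^⇒iterInv (suc n) w) (open-window h)
      bound : Orbits-bounded (max-sing + N * max-α) u v
      bound (i , inj₁ (k , it , avoid)) =
        subst (λ z → Ψ z ≤ max-sing + N * max-α) (sym (iter⇒F^ it)) (Ψ-iterate i (early (γ-within i) avoid))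
      bound (i , inj₂ (k , _ , it , avoid)) =
        subst (λ z → Ψ z ≤ max-sing + N * max-α) (sym (iterInv⇒B^ it))
            (Ψ-iterate′ i (early′ (γ-within i) avoid))

  Ψ≡0⇒≡0 : ∀ z → Ψ z ≡ 0 → z ≡ 0z
  Ψ≡0⇒≡0 (+ zero +√ + zero) _ = refl
  Ψ≡0⇒≡0 (+ zero +√ + suc _) ()
  Ψ≡0⇒≡0 (+ zero +√ -[1+ _ ]) ()
  Ψ≡0⇒≡0 (+ suc _ +√ + zero) ()
  Ψ≡0⇒≡0 (+ suc _ +√ + suc _) ()
  Ψ≡0⇒≡0 (+ suc _ +√ -[1+ _ ]) ()
  Ψ≡0⇒≡0 (-[1+ _ ] +√ + zero) ()
  Ψ≡0⇒≡0 (-[1+ _ ] +√ + suc _) ()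
  Ψ≡0⇒≡0 (-[1+ _ ] +√ -[1+ _ ]) ()

  -- The gap for `v ⊖ u`, whose `Ψ` is at most twice `ΨJ u v`. The endpoints are not both 0, so
  -- `1 ≤ ΨJ u v` and the multiplier `2 * (2 * ΨJ u v) + 2` is at most `6 * ΨJ u v`.
  lower-bound : ∀ {u v} → u ≺ v → nat 1 ≼ 6 · ΠJ u v
  lower-bound {u} {v} u≺v = inj₁ (subst (nat 1 ≺_) (·-* 6 (ΨJ u v) (v ⊖ u)) (gap (≺⇒0≺ u≺v) (begin
      2 * Ψ (v ⊖ u) + 2                ≤⟨ +-mono-≤ (*-monoʳ-≤ 2 ΨΔ) (*-monoʳ-≤ 2 1≤Ψ) ⟩
      2 * (ΨJ u v + ΨJ u v) + 2 * ΨJ u v ≡⟨ l (ΨJ u v) ⟩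
      6 * ΨJ u v                       ∎)))
    where
    open ≤-Reasoning
    l : ∀ p → 2 * (p + p) + 2 * p ≡ 6 * p
    l = ℕR.solve-∀
    ΨΔ : Ψ (v ⊖ u) ≤ ΨJ u v + ΨJ u v
    ΨΔ = ≤-trans (Ψ-⊖ v u) (+-mono-≤ (m≤n⊔m (Ψ u) (Ψ v)) (m≤m⊔n (Ψ u) (Ψ v)))
    1≤Ψ : 1 ≤ ΨJ u v
    1≤Ψ = n≢0⇒n>0 λ e → ≺-irrefl (subst₂ _≺_
      (Ψ≡0⇒≡0 u (n≤0⇒n≡0 (≤-trans (m≤m⊔n (Ψ u) (Ψ v)) (≤-reflexive e))))
      (Ψ≡0⇒≡0 v (n≤0⇒n≡0 (≤-trans (m≤n⊔m (Ψ u) (Ψ v)) (≤-reflexive e)))) u≺v)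

  -- The lower constant is `1 / q`, which keeps the bound inside ℤ[√d]; `1 ≤ q * C₂` says that it is
  -- at most `C₂`.
  Conclusion : ∀ {s} → IET d s → Set
  Conclusion T = Σ ℕ λ q → Σ ℕ λ C₂ → 1 ≤ q × 1 ≤ q * C₂ ×
    (∀ (u v : Zd) → IET.Admissible T u v → (nat 1 ⟨ d ⟩≤ (q · ΠJ u v)) × (ΠJ u v ⟨ d ⟩≤ nat C₂))

  conclude : ∀ {s} (T : IET d s) C → (∀ u v → IET.Admissible T u v → ΠJ u v ≼ nat C) → Conclusion T
  conclude T C upper = 6 , suc C , s≤s z≤n , s≤s z≤n , λ u v adm →
    ≼⇒≤ (lower-bound {u} {v} (<⇒≺ (proj₁ (proj₂ adm)))) , ≼⇒≤
        (≼-trans (upper u v adm) (nat-mono-≼ (n≤1+n C)))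

  -- The two bounds

  -- With one letter the only translation value is 0, so orbits do not move and `Ψ` on Div never
  -- exceeds `max-sing`.
  single : (T : IET d 1) → Conclusion T
  single T = conclude T (max-sing * width) upper
    where
    open IET T
    open FromIET T
    l : ∀ lo u v R → (lo ⊕ R ⊕ u) ⊕ ⊝ (v ⊕ lo) ≡ R ⊕ ⊝ (v ⊕ ⊝ u)
    l = R.solve-∀ zd
    cancel : ∀ x → x ⊕ ⊝ x ≡ 0z
    cancel = R.solve-∀ zd
    δ≡γ : δ Fin.zero ≡ γ Fin.zero
    δ≡γ = cong Im.G (n<1⇒n≡0 (Finₚ.toℕ<n (π ⟨$⟩ʳ Fin.zero)))
    no-shift : max-α ≡ 0
    no-shift = trans (+-identityʳ _) (cong Ψ (trans (cong (_⊕ ⊝ (γ Fin.zero)) δ≡γ) (cancel (γ Fin.zero))))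
    no-growth : ∀ k → max-sing + k * max-α ≡ max-sing
    no-growth k = trans (cong (λ a → max-sing + k * a) no-shift)
        (trans (cong (max-sing ℕ.+_) (*-zeroʳ k)) (+-identityʳ max-sing))
    bounded-orbits : ∀ {u v} → Orbits-bounded max-sing u v
    bounded-orbits (i , inj₁ (k , it , _)) =
      subst₂ (λ z K → Ψ z ≤ K) (sym (iter⇒F^ it)) (no-growth k) (Ψ-iterate i (≤-refl {k}))
    bounded-orbits (i , inj₂ (k , _ , it , _)) =
      subst₂ (λ z K → Ψ z ≤ K) (sym (iterInv⇒B^ it)) (no-growth k) (Ψ-iterate′ i (≤-refl {k}))
    upper : ∀ u v → Admissible u v → ΠJ u v ≼ nat (max-sing * width)
    upper u v adm@(ℓ≤u , u<v , v≤r , _) =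
      ≼-trans (·-monoˡ-≼ (Ψ-admissible {max-sing} {u} {v} ≤-refl (bounded-orbits {u} {v}) adm)
          (inj₁ (≺⇒0≺ u≺v)))
        (subst (max-sing · (v ⊕ ⊝ u) ≼_) (·-nat max-sing width)
          (·-mono-≼ max-sing (≼-shift (≼-⊕ (≼-trans v≼r r≼) ℓ≼u) (l ℓ u v (nat width)))))
      where
      ℓ≼u : ℓ ≼ u
      ℓ≼u = ≤⇒≼ ℓ≤u
      u≺v : u ≺ v
      u≺v = <⇒≺ u<v
      v≼r : v ≼ r
      v≼r = ≤⇒≼ v≤r

  module Several (C : ℕ) (1≤C : 1 ≤ C) 
    (quality : ∀ {R} (st : Stage R) → size st · (Stage.e st ⊕ Stage.f st) ≼ nat C) where

    -- A stage of size at least `C * n` has `n · f` at most 1, because size times `e ⊕ f` is at most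
    -- `C`.
    small : ∀ n → ∃ λ θ → 0z ≺ θ × n · θ ≼ nat 1
    small n with st , lower , _ ← reach-size 0 (C * n) = f , 0≺f , ·-cancel-≼ C 1≤C
        (subst₂ _≼_ (·-* C n f) (sym (trans (·-nat C 1) (cong nat (*-identityʳ C))))
          (≼-trans (·-monoˡ-≼ lower (inj₁ 0≺f)) (≼-trans (·-mono-≼ (size st) f≼e+f) (quality st))))
      where
      open Stage st
      f≼e+f : f ≼ e ⊕ f
      f≼e+f = inj₁ (≺-shift 0≺e (l e f))
        where
        l : ∀ e f → e ⊕ ⊝ 0z ≡ (e ⊕ f) ⊕ ⊝ f
        l = R.solve-∀ zd

    module _ {s} (T : IET d (suc (suc s))) (regular : IET.Regular T) where
      open IET T
      open FromIET T
      open Inscription C 1≤C quality width max-sing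

      rate : ℕ
      rate = growth width max-α (3 + suc (suc (suc s)))

      module Window (u v : Zd) (u≺v : u ≺ v) (ℓ≼u : ℓ ≼ u) (v≼r : v ≼ r) (Q : ℕ) (1≤Q : 1 ≤ Q)
          (S≤Q : max-sing ≤ Q)
        (Ψu : Ψ u ≤ Q) (Ψv : Ψ v ≤ Q) where

        module Rec = Recurrence exchange u v u≺v ℓ≼u v≼r Q 1≤Q Ψu Ψv (λ p → ≤-trans (Ψsing p) S≤Q) width r≼
        module Rec′ = Recurrence (op exchange) u v u≺v ℓ≼u v≼r Q 1≤Q Ψu Ψv
            (λ p → ≤-trans (Ψsing′ p) S≤Q) width r≼

        visits : ∀ {z} → Within ℓ r z → ∃ λ n → n < rate * Q × Within u v (F ^[ suc n ] z)
        visits = Minimality.all-hit exchange max-sing Ψsing Ψsing′ (no-connection regular) small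
          -- The second separation point is the aperiodic point that the minimality argument starts
          -- from: regularity makes its orbit infinite.
          (γ (Fin.suc Fin.zero)) (γ-within (Fin.suc Fin.zero))
              (no-return regular {Fin.suc Fin.zero} (s≤s z≤n))
          u v u≺v ℓ≼u v≼r (rate * Q) Rec.recurrence Rec′.recurrence

        visits′ : ∀ {z} → Within ℓ r z → ∃ λ n → n < rate * Q × Within u v (B ^[ suc n ] z)
        visits′ w = Hitting.hits⇒hits′ exchange u v (rate * Q) Rec.recurrence Rec′.recurrence (visits w)

      -- `ΨJ u v` is at most a constant times `Q`, and `Q` times the length of J is at most a
      -- constant; `Q`, the only quantity that depends on J, drops out.
      upper : ∀ u v → Admissible u v → ΠJ u v ≼ nat ((max-sing + rate * max-α) * inscribed-bound)
      upper u v adm@(ℓ≤u , u<v , v≤r , _) = from-window (inscribe Ψℓ ℓ≼u u≺v (≼-trans v≼r r≼))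
        where
        ℓ≼u : ℓ ≼ u
        ℓ≼u = ≤⇒≼ ℓ≤u
        u≺v : u ≺ v
        u≺v = <⇒≺ u<v
        v≼r : v ≼ r
        v≼r = ≤⇒≼ v≤r
        rearrange : ∀ S g Q A → S * Q + g * Q * A ≡ (S + g * A) * Q
        rearrange = ℕR.solve-∀
        from-window : Inscribed u v → ΠJ u v ≼ nat ((max-sing + rate * max-α) * inscribed-bound)
        from-window (u′ , v′ , Q , u≺u′ , u′≺v′ , v′≼v , 1≤Q , S≤Q , Ψu′ , Ψv′ , Qε) =
          ≼-trans (·-monoˡ-≼ ΨJ≤ (inj₁ (≺⇒0≺ u≺v)))
            (subst₂ _≼_ (sym (·-* (max-sing + rate * max-α) Q (v ⊕ ⊝ u)))
                (·-nat (max-sing + rate * max-α) inscribed-bound)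
              (·-mono-≼ (max-sing + rate * max-α) Qε))
          where
          open Window u′ v′ u′≺v′ (≼-trans ℓ≼u (inj₁ u≺u′)) (≼-trans v′≼v v≼r) Q 1≤Q S≤Q Ψu′ Ψv′
          open ≤-Reasoning
          ΨJ≤ : ΨJ u v ≤ (max-sing + rate * max-α) * Q
          ΨJ≤ = begin
            ΨJ u v                                ≤⟨ Ψ-admissible {max-sing + rate * Q * max-α} {u} {v}
                (m≤m+n max-sing _) (visits⇒bounded {u} {v} {u′} {v′} u≺u′ v′≼v visits visits′) adm ⟩
            max-sing + rate * Q * max-α           ≤⟨ +-monoˡ-≤ (rate * Q * max-α)
                (m≤m*n max-sing Q {{ℕ.>-nonZero 1≤Q}}) ⟩
            max-sing * Q + rate * Q * max-α       ≡⟨ rearrange max-sing rate Q max-α ⟩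
            (max-sing + rate * max-α) * Q         ∎

      several : Conclusion T
      several = conclude T ((max-sing + rate * max-α) * inscribed-bound) upper

  reduced-complexity : ∀ s → 1 ≤ s → (T : IET d s) → IET.Regular T → Conclusion T
  reduced-complexity (suc zero) _ T _ = single T
  reduced-complexity (suc (suc s)) _ T regular = several-with constants T regular
    where
    constants : Σ ℕ λ D → (1 ≤ D) × ((+ 1 +√ + 1) ≼ nat D)
    constants = 1 + suc (d * 1) , s≤s z≤n , inj₁ (bounded (+ 1 +√ + 1))
    several-with : Σ ℕ (λ D → (1 ≤ D) × ((+ 1 +√ + 1) ≼ nat D)) → (T : IET d (suc (suc s))) →
        IET.Regular T → Conclusion T
    several-with (D , 1≤D , weight≼) = Several.several (Quality.size-bound D weight≼)
      (≤-trans 1≤D (≤-trans (m≤n+m D (4 * D * D)) (m≤m+n _ _))) (Quality.quality D weight≼)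

theorem9 : (d : ℕ) → 2 ≤ d → SquareFree d → (s : ℕ) → 1 ≤ s → (T : IET d s) → IET.Regular T →
    Σ ℕ λ q → Σ ℕ λ C₂ → 1 ≤ q × 1 ≤ q * C₂ ×
    (∀ (u v : Zd) → IET.Admissible T u v →
    (nat 1 ⟨ d ⟩≤ (q · ΠJ u v)) × (ΠJ u v ⟨ d ⟩≤ nat C₂))
theorem9 = ReducedComplexity.reduced-complexity
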